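{- Let $m,n,s,k$ be positive integers with $m+s=n+k$, and let $\mathbf a=(a_1,\ldots,a_s)$, $\mathbf d=(d_1,\ldots,d_m)$, $\mathbf b=(b_1,\ldots,b_k)$, $\mathbf c=(c_1,\ldots,c_n)$ be partitions with $c_i\neq d_j$ for all $i,j$. With the notation of the context, there exists a partition $\mathbf g=(g_1,\ldots,g_{m+s})$ with $\mathbf g\prec'(\mathbf d,\mathbf a)$ and $\mathbf g\prec'(\mathbf c,\mathbf b)$ if and only if $$\sum_{i=1}^n c_i+\sum_{i=1}^k b_i=\sum_{i=1}^m d_i+\sum_{i=1}^s a_i$$ and both of the following hold: (i) for every $y\in\{1,\ldots,h'\}$ with $t_y\le m_y$, $$\sum_{i=z_y+t_y}^{z_y+m_y}e_i\le \sum_{i=y}^{h'}c^i-\sum_{i\ge z_y+1,\ i\notin\Delta}d_i-\sum_{i=m_y+1}^{s}a_i;$$ (ii) for every $x\in\{1,\ldots,h\}$ with $t'_x\le m'_x$, $$\sum_{i=z'_x+t'_x}^{z'_x+m'_x}e'_i\le \sum_{i=x}^{h}d^i-\sum_{i\ge z'_x+1,\ i\notin S}c_i-\sum_{i=m'_x+1}^{k}b_i.$$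
   Context: A partition is a finite nonincreasing sequence of integers. Empty sums are $0$; for any sequence $y_1,\ldots,y_w$ one sets $y_i=+\infty$ for $i\le0$ and $y_i=-\infty$ for $i>w$. Generalized majorization: for partitions $\mathbf d=(d_1,\ldots,d_p)$, $\mathbf a=(a_1,\ldots,a_s)$, $\mathbf g=(g_1,\ldots,g_{p+s})$, put $h_j=\min\{i\mid d_{i-j+1}<g_i\}$ for $j=1,\ldots,s$. We write $\mathbf g\prec'(\mathbf d,\mathbf a)$ if $d_i\ge g_{i+s}$ for $i=1,\ldots,p$; $\sum_{i=1}^{h_j}g_i-\sum_{i=1}^{h_j-j}d_i\le\sum_{i=1}^{j}a_i$ for $j=1,\ldots,s$; and $\sum_{i=1}^{p+s}g_i=\sum_{i=1}^p d_i+\sum_{i=1}^s a_i$. $\mathbf e=(e_1,\ldots,e_{m+s})$ is the nonincreasing rearrangement of all entries of $\mathbf d$ and $\mathbf a$, where whenever some $d_i$ equals some $a_j$, all $a$'s of that value are placed before the $d$'s of that value. Similarly $\mathbf e'=(e'_1,\ldots,e'_{n+k})$ is the nonincreasing rearrangement of entries of $\mathbf c$ and $\mathbf b$, with equal $b$'s placed before equal $c$'s. Sets $S\subseteq\{1,\ldots,n\}$, $\Delta\subseteq\{1,\ldots,m\}$ are defined inductively: start with $S=\Delta=\emptyset$ and process all entries of $\mathbf c$ and $\mathbf d$ one at a time, from the smallest value to the largest; among equal entries of $\mathbf c$ (resp. $\mathbf d$) the one with the larger index is processed first. All sets and counts below refer to the decisions made so far. If the processed entry is $d_j$: set $q_j=s-\#\{i\in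 S\mid c_i<d_j\}+\#\{i>j\mid i\notin\Delta\}+1$. If $q_j>s$, put $j\in\Delta$. If $q_j\le s$, let $l\in S$ be the minimal index with $d_j>c_l$, and let $N=\#\{i\mid a_i>c_l\}-s+\#\{i\in S\mid i>l\}-\#\{i\notin\Delta\mid d_i<c_l\}+1$. (a) If $N\ge1$ and the entry $d_j$ of $\mathbf e$ is among the $N$ smallest entries of $\mathbf e$ that are larger than $c_l$, put $j\notin\Delta$. (b) Otherwise put $j\notin\Delta$ if $\sum_{i\in S,\,c_i<d_j}c_i\ge\sum_{i\notin\Delta,\,i>j}d_i+d_j+\sum_{i=q_j+1}^{s}a_i$, and $j\in\Delta$ if not. If the processed entry is $c_j$: dually, set $q'_j=k-\#\{i\in\Delta\mid d_i<c_j\}+\#\{i>j\mid i\notin S\}+1$. If $q'_j>k$, put $j\in S$. If $q'_j\le k$, let $l\in\Delta$ be the minimal index with $c_j>d_l$, and $N'=\#\{i\mid b_i>d_l\}-k+\#\{i\in\Delta\mid i>l\}-\#\{i\notin S\mid c_i<d_l\}+1$. (a) If $N'\ge1$ and the entry $c_j$ of $\mathbf e'$ is among the $N'$ smallest entries of $\mathbf e'$ larger than $d_l$, put $j\notin S$. (b) Otherwise put $j\notin S$ if $\sum_{i\in\Delta,\,d_i<c_j}d_i\ge\sum_{i\notin S,\,i>j}c_i+c_j+\sum_{i=q'_j+1}^{k}b_i$, and $j\in S$ if not. Let $h=|\Delta|$, $h'=|S|$; $d^1\ge\cdots\ge d^h$ are the $d_i$ with $i\in\Delta$ and $c^1\ge\cdots\ge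 c^{h'}$ the $c_i$ with $i\in S$. For $j=1,\ldots,h'$: $m_j=\#\{i\mid a_i>c^j\}$, $t_j=s-(h'-j)+\#\{i\notin\Delta\mid d_i<c^j\}$, $z_j=\#\{i\mid d_i>c^j\}$. For $j=1,\ldots,h$: $m'_j=\#\{i\mid b_i>d^j\}$, $t'_j=k-(h-j)+\#\{i\notin S\mid c_i<d^j\}$, $z'_j=\#\{i\mid c_i>d^j\}$. -}

module Defs where

open import Data.Bool using (Bool; true; false; if_then_else_; not; _∧_; _∨_)
open import Data.Nat as ℕ using (ℕ; zero; suc)
open import Data.Integer as ℤ using (ℤ; +_; 0ℤ; 1ℤ; _≤ᵇ_)
open import Data.List as L using (List; []; _∷_)
open import Data.Vec as V using (Vec)
open import Data.Fin as F using (Fin)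
open import Data.Product using (_×_; _,_; proj₁; proj₂)
open import Data.Maybe using (Maybe; just; nothing)
open import Relation.Binary.PropositionalEquality using (_≡_)

-- Basic helpers.  Sequences are 1-indexed as in the paper.

sumℤ : List ℤ → ℤ
sumℤ = L.foldr ℤ._+_ 0ℤ

_<ᵇ_ : ℤ → ℤ → Bool
x <ᵇ y = not (y ≤ᵇ x)

countᵇ : {A : Set} → (A → Bool) → List A → ℕ
countᵇ p []       = 0
countᵇ p (x ∷ xs) = if p x then suc (countᵇ p xs) else countᵇ p xs

indexed : List ℤ → List (ℕ × ℤ)
indexed = go 1
  where
  go : ℕ → List ℤ → List (ℕ × ℤ)
  go i []       = []
  go i (x ∷ xs) = (i , x) ∷ go (suc i) xs

-- Σ_{i=1}^{r} x_i  (used only with r ≤ length)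
sumTo : List ℤ → ℕ → ℤ
sumTo xs r = sumℤ (L.take r xs)

sumFrom : List ℤ → ℕ → ℤ
sumFrom xs r = sumℤ (L.drop r xs)

-- Nonincreasing vector, i.e. a partition (finite nonincreasing integer sequence)
Nonincreasing : {n : ℕ} → Vec ℤ n → Set
Nonincreasing {n} v = (i j : Fin n) → i F.≤ j → V.lookup v j ℤ.≤ V.lookup v i

-- Extended integers, for the conventions y_i = +∞ (i ≤ 0), y_i = -∞ (i > w).

data ℤ∞ : Set where
  -∞  : ℤ∞
  fin : ℤ → ℤ∞
  +∞  : ℤ∞

data _≤∞_ : ℤ∞ → ℤ∞ → Set where
  -∞≤  : ∀ {x} → -∞ ≤∞ x
  ≤+∞  : ∀ {x} → x ≤∞ +∞
  fin≤ : ∀ {x y} → x ℤ.≤ y → fin x ≤∞ fin y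

_≤∞ᵇ_ : ℤ∞ → ℤ∞ → Bool
-∞    ≤∞ᵇ y     = true
x     ≤∞ᵇ +∞    = true
+∞    ≤∞ᵇ _     = false
fin x ≤∞ᵇ -∞    = false
fin x ≤∞ᵇ fin y = x ≤ᵇ y

_<∞ᵇ_ : ℤ∞ → ℤ∞ → Bool
x <∞ᵇ y = not (y ≤∞ᵇ x)

addFin : ℤ → ℤ∞ → ℤ∞
addFin x -∞      = -∞
addFin x (fin y) = fin (x ℤ.+ y)
addFin x +∞      = +∞

at∞ : List ℤ → ℤ → ℤ∞
at∞ xs (+ zero)  = +∞
at∞ xs ℤ.-[1+ _ ] = +∞
at∞ xs (+ suc i) = go xs i
  where
  go : List ℤ → ℕ → ℤ∞
  go []       _       = -∞
  go (x ∷ _)  zero    = fin x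
  go (_ ∷ ys) (suc j) = go ys j

-- Σ_{i=lo}^{hi} y_i with the above conventions (empty sum = 0 when hi < lo).
-- A term with index ≤ 0 makes the sum +∞; otherwise a term with index
-- > length makes it -∞.  (The mixed case never occurs in our uses.)
rangeSum∞ : List ℤ → ℤ → ℤ → ℤ∞
rangeSum∞ xs lo hi =
  if hi <ᵇ lo then fin 0ℤ
  else if lo ≤ᵇ 0ℤ then +∞
  else if (+ L.length xs) <ᵇ hi then -∞
  else fin (sumℤ (L.take ℤ.∣ hi ℤ.- lo ℤ.+ 1ℤ ∣ (L.drop ℤ.∣ lo ℤ.- 1ℤ ∣ xs)))

module _ (g d a : List ℤ) where
  private
    p s : ℕ
    p = L.length d
    s = L.length a

  -- h_j = min { i | d_{i-j+1} < g_i }; the minimum exists and is ≤ p + j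
  -- (for 1 ≤ j ≤ s); we search i = 1 … p + s (default p+s+1, unreachable).
  hIdx : ℕ → ℕ
  hIdx j = search 1 (p ℕ.+ s)
    where
    test : ℕ → Bool
    test i = at∞ d ((+ i) ℤ.- (+ j) ℤ.+ 1ℤ) <∞ᵇ at∞ g (+ i)
    search : ℕ → ℕ → ℕ
    search i zero    = i
    search i (suc r) = if test i then i else search (suc i) r

  record GMaj : Set where
    field
      cond-d   : ∀ i → 1 ℕ.≤ i → i ℕ.≤ p → at∞ g (+ (i ℕ.+ s)) ≤∞ at∞ d (+ i)
      cond-h   : ∀ j → 1 ℕ.≤ j → j ℕ.≤ s →
                   sumTo g (hIdx j) ℤ.- sumTo d (hIdx j ℕ.∸ j) ℤ.≤ sumTo a j
      cond-sum : sumℤ g ≡ sumℤ d ℤ.+ sumℤ a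

record Tag : Set where
  constructor tag
  field
    left : Bool
    idx  : ℕ
    val  : ℤ
open Tag public

tagList : Bool → List ℤ → List Tag
tagList b xs = L.map (λ p → tag b (proj₁ p) (proj₂ p)) (indexed xs)

mergeT : List Tag → List Tag → List Tag
mergeT []       ys       = ys
mergeT (x ∷ xs) []       = x ∷ xs
mergeT (x ∷ xs) (y ∷ ys) =
  if val y ≤ᵇ val x then x ∷ mergeT xs (y ∷ ys) else y ∷ mergeT (x ∷ xs) ys

eTagged : (d a : List ℤ) → List Tag
eTagged d a = mergeT (tagList true a) (tagList false d)

posOf : List Tag → Bool → ℕ → ℕ
posOf ts b j = go 1 ts
  where
  go : ℕ → List Tag → ℕ
  go i []       = 0
  go i (t ∷ ts') =
    if (left t Data.Bool.∧ b) ∨ (not (left t) ∧ not b) then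
      (if idx t ℕ.≡ᵇ j then i else go (suc i) ts')
    else go (suc i) ts'

record Decision : Set where
  constructor dec
  field
    dIdx  : ℕ
    dVal  : ℤ
    inSet : Bool
open Decision public

_<ℕᵇ_ : ℕ → ℕ → Bool
i <ℕᵇ j = not (j ℕ.≤ᵇ i)

minIdx : List Decision → Maybe (ℕ × ℤ)
minIdx []       = nothing
minIdx (x ∷ xs) with minIdx xs
... | nothing      = just (dIdx x , dVal x)
... | just (i , v) = if dIdx x ℕ.≤ᵇ i then just (dIdx x , dVal x) else just (i , v)

sumVals : List Decision → ℤ
sumVals ds = sumℤ (L.map dVal ds)

-- Decision for the processed entry d_j (value dj), written for the d-side;
-- the c-side is the same function with the roles (d,a,e,Δ,s) ↔ (c,b,e',S,k)
-- exchanged.  Arguments: s = length of a, the list a, the tagged list e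
-- (d-entries tagged false), own = decisions on d so far (in Δ?),
-- other = decisions on c so far (in S?).  Returns true iff j ∈ Δ.
decide : (s : ℕ) (a : List ℤ) (e : List Tag) (j : ℕ) (dj : ℤ)
         (own other : List Decision) → Bool
decide s a e j dj own other =
  if (+ s) <ᵇ q then true else caseLe (minIdx lCands)
  where
  q : ℤ
  q = (+ s) ℤ.- (+ countᵇ (λ x → inSet x ∧ (dVal x <ᵇ dj)) other)
        ℤ.+ (+ countᵇ (λ x → not (inSet x) ∧ (j <ℕᵇ dIdx x)) own) ℤ.+ 1ℤ
  lCands : List Decision
  lCands = L.filterᵇ (λ x → inSet x ∧ (dVal x <ᵇ dj)) other
  ruleB : Bool
  ruleB = not (rhs ≤∞ᵇ fin lhs)
    where
    lhs : ℤ
    lhs = sumVals (L.filterᵇ (λ x → inSet x ∧ (dVal x <ᵇ dj)) other)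
    rhs : ℤ∞
    rhs = addFin (sumVals (L.filterᵇ (λ x → not (inSet x) ∧ (j <ℕᵇ dIdx x)) own) ℤ.+ dj)
                 (rangeSum∞ a (q ℤ.+ 1ℤ) (+ s))
  caseLe : Maybe (ℕ × ℤ) → Bool
  caseLe nothing         = ruleB   -- unreachable: l exists when q ≤ s
  caseLe (just (l , cl)) = if condA then false else ruleB
    where
    N : ℤ
    N = (+ countᵇ (λ x → cl <ᵇ x) a) ℤ.- (+ s)
          ℤ.+ (+ countᵇ (λ x → inSet x ∧ (l <ℕᵇ dIdx x)) other)
          ℤ.- (+ countᵇ (λ x → not (inSet x) ∧ (dVal x <ᵇ cl)) own) ℤ.+ 1ℤ
    -- entries of e larger than c_l occupy positions 1..K of e;
    -- the N smallest of them are those at positions > K - N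
    K : ℕ
    K = countᵇ (λ t → cl <ᵇ val t) e
    condA : Bool
    condA = (1ℤ ≤ᵇ N) ∧ (cl <ᵇ dj) ∧ (((+ K) ℤ.- N) <ᵇ (+ posOf e false j))

construct : (a d b c : List ℤ) → List Decision × List Decision
construct a d b c = L.foldl step ([] , []) order
  where
  e e' : List Tag
  e  = eTagged d a
  e' = eTagged c b
  order : List Tag
  order = L.reverse (mergeT (tagList true c) (tagList false d))
  step : List Decision × List Decision → Tag → List Decision × List Decision
  step (dD , dC) t =
    if left t
    then (dD , dec (idx t) (val t) (decide (L.length b) b e' (idx t) (val t) dC dD) ∷ dC)
    else (dec (idx t) (val t) (decide (L.length a) a e (idx t) (val t) dD dC) ∷ dD , dC)

memberᵇ : List Decision → ℕ → Bool
memberᵇ []       i = false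
memberᵇ (x ∷ ds) i = ((dIdx x ℕ.≡ᵇ i) ∧ inSet x) ∨ memberᵇ ds i

inΔ inS : (a d b c : List ℤ) → ℕ → Bool
inΔ a d b c = memberᵇ (proj₁ (construct a d b c))
inS a d b c = memberᵇ (proj₂ (construct a d b c))

selected : (ℕ → Bool) → List ℤ → List ℤ
selected mem xs = L.map proj₂ (L.filterᵇ (λ p → mem (proj₁ p)) (indexed xs))

-- Condition (i) of Theorem 4.2 written for the (d,a,e,Δ; c^1..c^{h'}) side;
-- condition (ii) is the same with (c,b,e',S; d^1..d^h).
--   a   : the sequence a (s = its length)
--   d   : the sequence d
--   e   : the values of e
--   mem : membership in Δ
--   cs  : c^1 ≥ … ≥ c^{h'}

Cond : (a d e : List ℤ) (mem : ℕ → Bool) (cs : List ℤ) → Set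
Cond a d e mem cs =
  (y : Fin (L.length cs)) →
  let y′ = suc (F.toℕ y)            -- the paper's 1-based index y
      cy = L.lookup cs y
      my = countᵇ (λ x → cy <ᵇ x) a
      ty = (+ L.length a) ℤ.- (+ (L.length cs ℕ.∸ y′))
             ℤ.+ (+ countᵇ (λ p → not (mem (proj₁ p)) ∧ (proj₂ p <ᵇ cy)) (indexed d))
      zy = countᵇ (λ x → cy <ᵇ x) d
  in ty ℤ.≤ (+ my) →
     rangeSum∞ e ((+ zy) ℤ.+ ty) (+ (zy ℕ.+ my))
       ≤∞ fin (sumℤ (L.drop (F.toℕ y) cs)
               ℤ.- sumℤ (L.map proj₂ (L.filterᵇ (λ p → (zy <ℕᵇ proj₁ p) ∧ not (mem (proj₁ p))) (indexed d)))
               ℤ.- sumFrom a my)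

valsOf : List Tag → List ℤ
valsOf = L.map val

{-# OPTIONS --safe #-}
module Submission where

{- Process the entries of c and d in increasing order and call an entry accepted if it is put into
   Δ ∪ S.  Let p be the number of entries of d to come, Γ the total number of entries of g minus
   the number of accepted ones, Q the total sum minus the sum of the accepted entries, w = Γ - p,
   and write P_x for prefix sums.  Rule (a) for d_p amounts to a_{w+1} ≥ d_p, and rule (b) to
   Q ≤ P_d(p-1) + P_a(w+1); so d_p is accepted iff w = s, or a_{w+1} < d_p and rule (b) fails.
   Condition (i) says that Q ≤ P_e(Γ) after each entry put into S.

   If g is a solution then Q ≤ P_g(Γ) throughout: were g_Γ > d_p at an accepted d_p, the first index
   violating g_l ≤ d_{l-j+1} for a suitable j ≥ w+1 would give P_g(Γ) ≤ P_d(p-1) + P_a(w+1) < Q.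
   Since P_g ≤ P_e, both conditions follow.

   Conversely, the conditions give Q ≤ P_e(Γ) throughout.  Stop just before the first value v with
   Q ≤ vΓ, and let g consist of the accepted entries and of Γ balanced entries of sum Q.  For each j
   the required inequality is checked at the last state before the stop with w ≥ j: it follows from
   Q ≤ P_d(p) + P_a(w), valid whenever d_p ≥ a_{w+1}, or from P_g ≤ P_e. -}

open import Defs
open import Data.Nat using (ℕ; _≤_; _+_)
open import Data.Integer as ℤ using (ℤ)
open import Data.Vec using (Vec; lookup; toList)
open import Data.Fin using (Fin)
open import Data.Product using (Σ-syntax; _×_)
open import Function.Bundles using (_⇔_)
open import Relation.Binary.PropositionalEquality using (_≡_; _≢_)

open import Data.Bool using (Bool; true; false; if_then_else_; not; _∧_; _∨_; T)
open import Data.Bool.Properties using (∨-identityʳ)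
open import Data.Empty using (⊥; ⊥-elim)
import Data.Fin as F
open import Data.Integer using (0ℤ; 1ℤ)
open import Data.Integer.DivMod using (_/ℕ_; _%ℕ_; a≡a%ℕn+[a/ℕn]*n; n%ℕd<d)
import Data.Integer.Properties as ℤₚ
open import Data.Integer.Tactic.RingSolver using (solve-∀)
open import Data.List as L using (List; []; _∷_; length; _++_; drop; replicate)
import Data.List.Properties as Lₚ
open import Data.List.Relation.Unary.All as All using (All; []; _∷_)
open import Data.Maybe using (just; nothing)
open import Data.Nat as ℕ using (zero; suc; _<_; _∸_; z≤n; s≤s)
import Data.Nat.Properties as ℕₚ
open import Data.Product using (∃-syntax; _,_; proj₁; proj₂)
open import Data.Sum using (_⊎_; inj₁; inj₂)
open import Data.Unit using (⊤; tt)
import Data.Vec as V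
import Data.Vec.Properties as Vₚ
open import Function using (_∘_)
open import Function.Bundles using (mk⇔)
open import Relation.Binary.PropositionalEquality
  using (refl; sym; trans; cong; cong₂; subst; subst₂; module ≡-Reasoning)
open import Relation.Nullary using (¬_; Dec; yes; no)

-- Extended integers, prefix sums and sorted lists

-- Γ and Q are the number and the total of the entries of g still free, while the accepted entries
-- play the part of its tail; so Q ≤ P_e(Γ) is majorization by e, read from the tail. The obstacle
-- is that each rule refers to both sides at once and rule (a) is computed from an entry of the
-- other side accepted earlier. Counting and summing all of d eliminates the other side, after which
-- the two sides interact only through Γ and Q. Balanced values are the least in the majorization
-- order, so for the free block only the total has to be compared with e. The moment of stopping
-- places the mean Q/Γ above every processed entry and not above any unprocessed one, which is what
-- the termwise inequalities g_l ≤ d_{l-j+1} need; all entries being integers, rounding the mean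
-- does no harm.

lin : ∀ {x y u v} → x ℤ.≤ y → y ℤ.- x ≡ v ℤ.- u → u ℤ.≤ v
lin h eq = ℤₚ.0≤i-j⇒j≤i (subst (0ℤ ℤ.≤_) eq (ℤₚ.i≤j⇒0≤j-i h))

-- Linear arithmetic by certificate: the slack of the goal is the sum of the slacks of the
-- hypotheses, so that only a ring identity is left.
lin₂ : ∀ {x y x′ y′ u v} → x ℤ.≤ y → x′ ℤ.≤ y′ → (y ℤ.- x) ℤ.+ (y′ ℤ.- x′) ≡ v ℤ.- u → u ℤ.≤ v
lin₂ h h′ eq = ℤₚ.0≤i-j⇒j≤i (subst (0ℤ ℤ.≤_) eq (ℤₚ.+-mono-≤ (ℤₚ.i≤j⇒0≤j-i h) (ℤₚ.i≤j⇒0≤j-i h′)))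

_<∞_ : ℤ∞ → ℤ∞ → Set
x <∞ y = ¬ (y ≤∞ x)

≤∞-refl : ∀ {x} → x ≤∞ x
≤∞-refl { -∞}   = -∞≤
≤∞-refl {fin x} = fin≤ ℤₚ.≤-refl
≤∞-refl {+∞}    = ≤+∞

≤∞-trans : ∀ {x y z} → x ≤∞ y → y ≤∞ z → x ≤∞ z
≤∞-trans -∞≤      _        = -∞≤
≤∞-trans _        ≤+∞      = ≤+∞
≤∞-trans (fin≤ p) (fin≤ q) = fin≤ (ℤₚ.≤-trans p q)

≤∞-reflexive : ∀ {x y} → x ≡ y → x ≤∞ y
≤∞-reflexive refl = ≤∞-refl

fin≤⁻ : ∀ {x y} → fin x ≤∞ fin y → x ℤ.≤ y
fin≤⁻ (fin≤ p) = p

<∞⇒≤∞ : ∀ {x y} → x <∞ y → x ≤∞ y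
<∞⇒≤∞ { -∞}           p = -∞≤
<∞⇒≤∞ {fin x} { -∞}   p = ⊥-elim (p -∞≤)
<∞⇒≤∞ {fin x} {fin y} p = fin≤ (ℤₚ.<⇒≤ (ℤₚ.≰⇒> (p ∘ fin≤)))
<∞⇒≤∞ {fin x} {+∞}    p = ≤+∞
<∞⇒≤∞ {+∞}            p = ⊥-elim (p ≤+∞)

<∞-≤∞-trans : ∀ {x y z} → x <∞ y → y ≤∞ z → x <∞ z
<∞-≤∞-trans p q r = p (≤∞-trans q r)

≤∞-<∞-trans : ∀ {x y z} → x ≤∞ y → y <∞ z → x <∞ z
≤∞-<∞-trans p q r = q (≤∞-trans r p)

_≤∞?_ : ∀ x y → Dec (x ≤∞ y)
-∞    ≤∞? y     = yes -∞≤
fin x ≤∞? -∞    = no λ ()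
fin x ≤∞? fin y with x ℤ.≤? y
... | yes p = yes (fin≤ p)
... | no ¬p = no (¬p ∘ fin≤⁻)
fin x ≤∞? +∞    = yes ≤+∞
+∞    ≤∞? -∞    = no λ ()
+∞    ≤∞? fin y = no λ ()
+∞    ≤∞? +∞    = yes ≤+∞

¬<∞⇒≥∞ : ∀ {x y} → ¬ (x <∞ y) → y ≤∞ x
¬<∞⇒≥∞ {x} {y} p with y ≤∞? x
... | yes q = q
... | no q  = ⊥-elim (p q)

fin< : ∀ {x y} → x ℤ.< y → fin x <∞ fin y
fin< p q = ℤₚ.<⇒≱ p (fin≤⁻ q)

fin<⁻ : ∀ {x y} → fin x <∞ fin y → x ℤ.< y
fin<⁻ p = ℤₚ.≰⇒> (p ∘ fin≤)

P : List ℤ → ℕ → ℤ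
P = sumTo

-- `at∞` on natural indices. Index 0 keeps the value +∞, so "before the first entry" needs no case
-- of its own in the order hypotheses below.
at : List ℤ → ℕ → ℤ∞
at xs       zero          = +∞
at []       (suc i)       = -∞
at (x ∷ xs) (suc zero)    = fin x
at (x ∷ xs) (suc (suc i)) = at xs (suc i)

at∞≡at : ∀ xs i → at∞ xs (ℤ.+ i) ≡ at xs i
at∞≡at xs zero = refl
at∞≡at [] (suc i) = refl
at∞≡at (x ∷ xs) (suc zero) = refl
at∞≡at (x ∷ xs) (suc (suc i)) = at∞≡at xs (suc i)

at-fin : ∀ xs {i} → i < length xs → ∃[ v ] at xs (suc i) ≡ fin v × P xs (suc i) ≡ P xs i ℤ.+ v
at-fin (x ∷ xs) {zero}  _       = x , refl , ℤₚ.+-comm x 0ℤ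
at-fin (x ∷ xs) {suc i} (s≤s p) with at-fin xs p
... | v , e , f = v , e , trans (cong (ℤ._+_ x) f) (sym (ℤₚ.+-assoc x _ v))

P-suc : ∀ xs {i v} → at xs (suc i) ≡ fin v → P xs (suc i) ≡ P xs i ℤ.+ v
P-suc (x ∷ xs) {zero}  refl = ℤₚ.+-comm x 0ℤ
P-suc (x ∷ xs) {suc i} e    = trans (cong (ℤ._+_ x) (P-suc xs e)) (sym (ℤₚ.+-assoc x _ _))

at-out : ∀ xs {i} → length xs ≤ i → at xs (suc i) ≡ -∞
at-out []                 p       = refl
at-out (x ∷ xs) {suc i} (s≤s p) = at-out xs p

at-in : ∀ xs {i v} → fin v ≤∞ at xs (suc i) → i < length xs
at-in xs {i} h with i ℕₚ.<? length xs
... | yes p = p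
... | no ¬p with at xs (suc i) | at-out xs (ℕₚ.≮⇒≥ ¬p)
at-in xs {i} () | no ¬p | .-∞ | refl

at≢+∞ : ∀ xs {i} → ¬ (+∞ ≤∞ at xs (suc i))
at≢+∞ [] ()
at≢+∞ (x ∷ xs) {zero} ()
at≢+∞ (x ∷ xs) {suc i} h = at≢+∞ xs h

at-in′ : ∀ xs {i v} → at xs (suc i) ≡ fin v → i < length xs
at-in′ xs e = at-in xs (≤∞-reflexive (sym e))

at-length : ∀ xs → -∞ <∞ at xs (length xs)
at-length (x ∷ [])     ()
at-length (x ∷ y ∷ xs) h = at-length (y ∷ xs) h

P-all : ∀ xs → P xs (length xs) ≡ sumℤ xs
P-all []       = refl
P-all (x ∷ xs) = cong (ℤ._+_ x) (P-all xs)

-- Σ_{i<l≤i+n} xs_l ≤ Σ_{j<l≤j+n} ys_l, with the prefix sums moved so that no subtraction occurs.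
P-mono : ∀ xs ys n {i j} → i + n ≤ length xs →
         (∀ {t} → t < n → at xs (suc (i + t)) ≤∞ at ys (suc (j + t))) →
         P xs (i + n) ℤ.+ P ys j ℤ.≤ P xs i ℤ.+ P ys (j + n)
P-mono xs ys zero {i} {j} _ _ =
  ℤₚ.≤-reflexive (cong₂ (λ u v → P xs u ℤ.+ P ys v) (ℕₚ.+-identityʳ i) (sym (ℕₚ.+-identityʳ j)))
P-mono xs ys (suc n) {i} {j} r h
  with at-fin xs {i + n} (subst (_≤ length xs) (ℕₚ.+-suc i n) r)
... | v , e , f
  with at-fin ys {j + n} (at-in ys (≤∞-trans (≤∞-reflexive (sym e)) (h ℕₚ.≤-refl)))
... | w , e′ , f′ = lin₂
  (P-mono xs ys n (ℕₚ.≤-trans (ℕₚ.+-monoʳ-≤ i (ℕₚ.n≤1+n n)) r) (λ p → h (ℕₚ.m<n⇒m<1+n p)))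
  (fin≤⁻ (subst₂ _≤∞_ e e′ (h ℕₚ.≤-refl)))
  (trans (eq (P xs (i + n)) (P ys j) (P xs i) (P ys (j + n)) v w)
         (cong₂ (λ a b → (P xs i ℤ.+ a) ℤ.- (b ℤ.+ P ys j))
            (trans (sym f′) (cong (P ys) (sym (ℕₚ.+-suc j n))))
            (trans (sym f) (cong (P xs) (sym (ℕₚ.+-suc i n))))))
  where
  eq : ∀ a b c d v w → ((c ℤ.+ d) ℤ.- (a ℤ.+ b)) ℤ.+ (w ℤ.- v) ≡ (c ℤ.+ (d ℤ.+ w)) ℤ.- ((a ℤ.+ v) ℤ.+ b)
  eq = solve-∀

Sorted : List ℤ → Set
Sorted xs = ∀ i → at xs (suc i) ≤∞ at xs i

Sorted-tail : ∀ {x xs} → Sorted (x ∷ xs) → Sorted xs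
Sorted-tail s zero    = ≤+∞
Sorted-tail s (suc i) = s (suc (suc i))

at-anti : ∀ xs → Sorted xs → ∀ {i j} → i ≤ j → at xs j ≤∞ at xs i
at-anti xs s {i} {j} p with ℕₚ.≤⇒≤′ p
... | ℕ.≤′-refl = ≤∞-refl
... | ℕ.≤′-step {n} q = ≤∞-trans (s n) (at-anti xs s (ℕₚ.≤′⇒≤ q))

split-at : ∀ xs → Sorted xs → ∀ v → ∃[ q ] q ≤ length xs × fin v ≤∞ at xs q × at xs (suc q) <∞ fin v
split-at []       s v = 0 , z≤n , ≤+∞ , λ ()
split-at (x ∷ xs) s v with v ℤ.≤? x
... | no ¬p = 0 , z≤n , ≤+∞ , ¬p ∘ fin≤⁻
... | yes p with split-at xs (Sorted-tail s) v
... | zero  , a , b , c = 1 , s≤s z≤n , fin≤ p , c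
... | suc q , a , b , c = suc (suc q) , s≤s a , b , c

-- The last two hypotheses say that no exchange of an entry of d for one of a increases the sum.
split-opt : ∀ d a → Sorted d → Sorted a → ∀ {p₀ J₀ p J} →
            p₀ + J₀ ≡ p + J → p₀ ≤ length d → J₀ ≤ length a →
            p ≤ length d → J ≤ length a →
            at a (suc J) ≤∞ at d p → at d (suc p) ≤∞ at a J →
            P d p₀ ℤ.+ P a J₀ ℤ.≤ P d p ℤ.+ P a J
split-opt d a sd sa {p₀} {J₀} {p} {J} eq h₁ h₂ h₃ h₄ c₁ c₂ with ℕₚ.≤-total p₀ p
... | inj₁ q with ℕₚ.m≤n⇒∃[o]m+o≡n q
... | n , refl with ℕₚ.+-cancelˡ-≡ p₀ J₀ (n + J) (trans eq (ℕₚ.+-assoc p₀ n J))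
... | refl = subst₂ ℤ._≤_
      (trans (cong (λ k → P a k ℤ.+ P d p₀) (ℕₚ.+-comm J n)) (ℤₚ.+-comm _ (P d p₀)))
      (ℤₚ.+-comm (P a J) (P d (p₀ + n)))
      (P-mono a d n (subst (_≤ length a) (ℕₚ.+-comm n J) h₂) λ {t} t<n →
        ≤∞-trans (at-anti a sa (s≤s (ℕₚ.m≤m+n J t)))
        (≤∞-trans c₁ (at-anti d sd (subst (_≤ p₀ + n) (ℕₚ.+-suc p₀ t) (ℕₚ.+-monoʳ-≤ p₀ t<n)))))
split-opt d a sd sa {p₀} {J₀} {p} {J} eq h₁ h₂ h₃ h₄ c₁ c₂ | inj₂ q with ℕₚ.m≤n⇒∃[o]m+o≡n q
... | n , refl with ℕₚ.+-cancelˡ-≡ p (n + J₀) J (trans (sym (ℕₚ.+-assoc p n J₀)) eq)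
... | refl = subst (λ k → P d (p + n) ℤ.+ P a J₀ ℤ.≤ P d p ℤ.+ P a k) (ℕₚ.+-comm J₀ n)
      (P-mono d a n h₁ λ {t} t<n →
        ≤∞-trans (at-anti d sd (s≤s (ℕₚ.m≤m+n p t)))
        (≤∞-trans c₂ (at-anti a sa (subst (suc (J₀ + t) ≤_) (ℕₚ.+-comm J₀ n)
          (subst (_≤ J₀ + n) (ℕₚ.+-suc J₀ t) (ℕₚ.+-monoʳ-≤ J₀ t<n))))))

-- Generalized majorization, runs of the construction, and necessity

-- Dominated g d J i: no index l ≤ i satisfies d_{l-J+1} < g_l.
Dominated : (g d : List ℤ) → ℕ → ℕ → Set
Dominated g d J i = ∀ p → p + J ≤ i → at g (p + J) ≤∞ at d (suc p)

-- g ≺′ (d , a), with h_J written as p + J.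
record GM (g d a : List ℤ) : Set where
  field
    below : Dominated g d (suc (length a)) (length g)
    first : ∀ {J} → 1 ≤ J → J ≤ length a →
            ∃[ p ] p ≤ length d × at d (suc p) <∞ at g (p + J)
              × (∀ {p′} → p′ < p → at g (p′ + J) ≤∞ at d (suc p′))
              × P g (p + J) ℤ.≤ P d p ℤ.+ P a J

-- Without violations for J + 1 up to i, the entries of g from p + J + 1 to i lie termwise below
-- those of d from p + 1 on, which carries the inequality to i. These entries of d exist because g
-- is finite there and d is -∞ beyond its end.
extend : ∀ g d a {J i p} → p + J ≤ i → i ≤ length g → p ≤ length d →
         Dominated g d (suc J) i → P g (p + J) ℤ.≤ P d p ℤ.+ P a J →
         ∃[ q ] q + J ≡ i × q ≤ length d × P g i ℤ.≤ P d q ℤ.+ P a J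
extend g d a {J} {i} {p} h i≤ p≤ nv b with ℕₚ.m≤n⇒∃[o]m+o≡n h
... | n , refl = p + n , swap-+ n , in-range n h′ i≤ ,
    lin₂ (P-mono g d n i≤ λ t<n → h′ t<n) b
         (eq (P g (p + J + n)) (P d p) (P g (p + J)) (P d (p + n)) (P a J))
  where
  swap-+ : ∀ n → p + n + J ≡ p + J + n
  swap-+ n = trans (ℕₚ.+-assoc p n J) (trans (cong (p +_) (ℕₚ.+-comm n J)) (sym (ℕₚ.+-assoc p J n)))
  eq : ∀ a b c d e → ((c ℤ.+ d) ℤ.- (a ℤ.+ b)) ℤ.+ ((b ℤ.+ e) ℤ.- c) ≡ (d ℤ.+ e) ℤ.- a
  eq = solve-∀
  shift : ∀ t → p + t + suc J ≡ suc (p + J + t)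
  shift t = trans (ℕₚ.+-suc (p + t) J) (cong suc (swap-+ t))
  h′ : ∀ {t} → t < n → at g (suc (p + J + t)) ≤∞ at d (suc (p + t))
  h′ {t} t<n = subst (λ k → at g k ≤∞ at d (suc (p + t))) (shift t)
    (nv (p + t) (subst (_≤ p + J + n) (sym (shift t)) (subst (_≤ p + J + n) (ℕₚ.+-suc (p + J) t) (ℕₚ.+-monoʳ-≤ (p + J) t<n))))
  in-range : ∀ n → (∀ {t} → t < n → at g (suc (p + J + t)) ≤∞ at d (suc (p + t))) →
             p + J + n ≤ length g → p + n ≤ length d
  in-range zero    _ _ = subst (_≤ length d) (sym (ℕₚ.+-identityʳ p)) p≤
  in-range (suc n) k r with at-fin g (subst (_≤ length g) (ℕₚ.+-suc (p + J) n) r)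
  ... | v , e , _ = subst (_≤ length d) (sym (ℕₚ.+-suc p n))
                      (at-in d (≤∞-trans (≤∞-reflexive (sym e)) (k ℕₚ.≤-refl)))

module _ {g d a : List ℤ} (gm : GM g d a) where
  open GM gm

  -- J is the largest index with h_J ≤ i; between h_J and i no entry of g exceeds the
  -- corresponding entry of d, so the inequality at h_J propagates to i.
  best-split : ∀ {i} → i ≤ length g →
    ∃[ J ] ∃[ p ] p + J ≡ i × p ≤ length d × J ≤ length a × P g i ℤ.≤ P d p ℤ.+ P a J
      × (∀ {j q} → 1 ≤ j → j ≤ length a → q + j ≤ i → at d (suc q) <∞ at g (q + j) → j ≤ J)
  best-split {i} i≤ = go (length a) ℕₚ.≤-refl top
    where
    -- `below` acts as a value h_{s+1} lying beyond the end of g.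
    top : ∀ {j} → length a < j → j ≤ suc (length a) → Dominated g d j i
    top h₁ h₂ with ℕₚ.≤-antisym h₁ h₂
    ... | refl = λ p h → below p (ℕₚ.≤-trans h i≤)
    Result = ∃[ J ] ∃[ p ] p + J ≡ i × p ≤ length d × J ≤ length a × P g i ℤ.≤ P d p ℤ.+ P a J
      × (∀ {j q} → 1 ≤ j → j ≤ length a → q + j ≤ i → at d (suc q) <∞ at g (q + j) → j ≤ J)
    found : ∀ {J p} → J ≤ length a → (∀ {j} → J < j → j ≤ suc (length a) → Dominated g d j i) →
            p ≤ length d → p + J ≤ i → P g (p + J) ℤ.≤ P d p ℤ.+ P a J → Result
    found {J} {p} J≤ nv p≤ h b with extend g d a h i≤ p≤ (nv ℕₚ.≤-refl (s≤s J≤)) b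
    ... | q , e , q≤ , b′ = J , q , e , q≤ , J≤ , b′ , λ {j} {q} _ j≤ k v →
            ℕₚ.≮⇒≥ λ J<j → v (nv J<j (ℕₚ.m≤n⇒m≤1+n j≤) q k)
    go : ∀ J → J ≤ length a → (∀ {j} → J < j → j ≤ suc (length a) → Dominated g d j i) → Result
    go zero J≤ nv = found z≤n nv z≤n z≤n (ℤₚ.≤-reflexive refl)
    go (suc J) J≤ nv with first (s≤s z≤n) J≤
    ... | p , p≤ , _ , min , b with p + suc J ℕₚ.≤? i
    ... | yes h = found J≤ nv p≤ h b
    ... | no ¬h = go J (ℕₚ.<⇒≤ J≤) nv′
      where
      nv′ : ∀ {j} → J < j → j ≤ suc (length a) → Dominated g d j i
      nv′ {j} J<j j≤ with ℕₚ.m≤n⇒m<n∨m≡n J<j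
      ... | inj₁ h = nv h j≤
      ... | inj₂ refl = λ q h → min (ℕₚ.+-cancelʳ-< (suc J) q p (ℕₚ.≤-<-trans h (ℕₚ.≰⇒> ¬h)))

  -- If a_J ≤ d_{p+1} < g_{p+J}, then the maximal index of best-split is at least J, and moving
  -- back from it to J does not decrease the right-hand side.
  split-below : Sorted d → Sorted a → ∀ {p J} → p + J ≤ length g → 1 ≤ J → J ≤ length a → p ≤ length d →
    at a J ≤∞ at d (suc p) → at d (suc p) <∞ at g (p + J) →
    P g (p + J) ℤ.≤ P d p ℤ.+ P a J
  split-below sd sa {p} {J} i≤ 1≤J J≤ p≤ c v with best-split i≤
  ... | J′ , p′ , e , p′≤ , J′≤ , b , mx with ℕₚ.m≤n⇒∃[o]m+o≡n (mx 1≤J J≤ ℕₚ.≤-refl v)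
  ... | n , refl with ℕₚ.+-cancelʳ-≡ J (p′ + n) p (trans (trans (ℕₚ.+-assoc p′ n J) (cong (p′ +_) (ℕₚ.+-comm n J))) e)
  ... | refl = lin₂ b
      (P-mono a d n J′≤ λ {t} t<n →
        ≤∞-trans (at-anti a sa (ℕₚ.m≤n⇒m≤1+n (ℕₚ.m≤m+n J t)))
        (≤∞-trans c (at-anti d sd (s≤s (ℕₚ.+-monoʳ-≤ p′ (ℕₚ.<⇒≤ t<n))))))
      (eq (P g (p′ + n + J)) (P d p′) (P a (J + n)) (P a J) (P d (p′ + n)))
    where
    eq : ∀ g d a a₀ d₁ → ((d ℤ.+ a) ℤ.- g) ℤ.+ ((a₀ ℤ.+ d₁) ℤ.- (a ℤ.+ d)) ≡ (d₁ ℤ.+ a₀) ℤ.- g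
    eq = solve-∀

-- Here p counts the entries of d left after v, so Γ = p + 1 + w. The alternative Γ ≤ p of `Rej` is
-- rule (a) at an index w + 1 ≤ 0, where a is +∞. In `Acc` the case w = s is included: a_{s+1} = -∞
-- is below v, and the last clause is void.
Rej Acc : (d a : List ℤ) (p Γ : ℕ) (Q v : ℤ) → Set
Rej d a p Γ Q v = Γ ≤ p ⊎ ∃[ w ] Γ ≡ suc p + w × w < length a ×
  (fin v ≤∞ at a (suc w) ⊎ Q ℤ.≤ P d p ℤ.+ P a (suc w))
Acc d a p Γ Q v = ∃[ w ] Γ ≡ suc p + w × w ≤ length a × at a (suc w) <∞ fin v ×
  (w < length a → P d p ℤ.+ P a (suc w) ℤ.< Q)

-- Runs of the construction: p and p′ entries of d and c are still to be processed, acc lists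
-- the accepted entries (those in Δ ∪ S), Γ = N - |acc| and Q = M - Σ acc.
data Run (d a c b : List ℤ) (N : ℕ) (M : ℤ) :
         (dD dC : List Decision) (p p′ Γ : ℕ) (Q : ℤ) (acc : List ℤ) → Set where
  start : Run d a c b N M [] [] (length d) (length c) N M []
  rejD  : ∀ {dD dC p p′ Γ Q acc} v → Run d a c b N M dD dC (suc p) p′ Γ Q acc →
          at d (suc p) ≡ fin v → fin v <∞ at c p′ → Rej d a p Γ Q v →
          Run d a c b N M (dec (suc p) v false ∷ dD) dC p p′ Γ Q acc
  accD  : ∀ {dD dC p p′ Γ Q acc} v → Run d a c b N M dD dC (suc p) p′ (suc Γ) Q acc →
          at d (suc p) ≡ fin v → fin v <∞ at c p′ → Acc d a p (suc Γ) Q v →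
          Run d a c b N M (dec (suc p) v true ∷ dD) dC p p′ Γ (Q ℤ.- v) (v ∷ acc)
  rejC  : ∀ {dD dC p p′ Γ Q acc} v → Run d a c b N M dD dC p (suc p′) Γ Q acc →
          at c (suc p′) ≡ fin v → fin v <∞ at d p → Rej c b p′ Γ Q v →
          Run d a c b N M dD (dec (suc p′) v false ∷ dC) p p′ Γ Q acc
  accC  : ∀ {dD dC p p′ Γ Q acc} v → Run d a c b N M dD dC p (suc p′) (suc Γ) Q acc →
          at c (suc p′) ≡ fin v → fin v <∞ at d p → Acc c b p′ (suc Γ) Q v →
          Run d a c b N M dD (dec (suc p′) v true ∷ dC) p p′ Γ (Q ℤ.- v) (v ∷ acc)

-- The two sides enter a run symmetrically; statements are proved for d and a and transported to c
-- and b.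
swap : ∀ {d a c b N M dD dC p p′ Γ Q acc} → Run d a c b N M dD dC p p′ Γ Q acc →
       Run c b d a N M dC dD p′ p Γ Q acc
swap start            = start
swap (rejD v r e o x) = rejC v (swap r) e o x
swap (accD v r e o x) = accC v (swap r) e o x
swap (rejC v r e o x) = rejD v (swap r) e o x
swap (accC v r e o x) = accD v (swap r) e o x

module _ {d a c b : List ℤ} {N : ℕ} {M : ℤ} where
  p≤length : ∀ {dD dC p p′ Γ Q acc} → Run d a c b N M dD dC p p′ Γ Q acc → p ≤ length d
  p≤length start            = ℕₚ.≤-refl
  p≤length (rejD v r e o x) = ℕₚ.<⇒≤ (p≤length r)
  p≤length (accD v r e o x) = ℕₚ.<⇒≤ (p≤length r)
  p≤length (rejC v r e o x) = p≤length r
  p≤length (accC v r e o x) = p≤length r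

  Γ+length : ∀ {dD dC p p′ Γ Q acc} → Run d a c b N M dD dC p p′ Γ Q acc → Γ + length acc ≡ N
  Γ+length start            = ℕₚ.+-identityʳ N
  Γ+length (rejD v r e o x) = Γ+length r
  Γ+length (accD v r e o x) = trans (ℕₚ.+-suc _ _) (Γ+length r)
  Γ+length (rejC v r e o x) = Γ+length r
  Γ+length (accC v r e o x) = trans (ℕₚ.+-suc _ _) (Γ+length r)

  Γ≤N : ∀ {dD dC p p′ Γ Q acc} → Run d a c b N M dD dC p p′ Γ Q acc → Γ ≤ N
  Γ≤N {Γ = Γ} r = subst (Γ ≤_) (Γ+length r) (ℕₚ.m≤m+n Γ _)

  Q+sum : ∀ {dD dC p p′ Γ Q acc} → Run d a c b N M dD dC p p′ Γ Q acc → Q ℤ.+ sumℤ acc ≡ M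
  Q+sum start            = ℤₚ.+-identityʳ M
  Q+sum (rejD v r e o x) = Q+sum r
  Q+sum (accD {Q = Q} {acc} v r e o x) = trans (eq Q v (sumℤ acc)) (Q+sum r)
    where
    eq : ∀ Q v s → (Q ℤ.- v) ℤ.+ (v ℤ.+ s) ≡ Q ℤ.+ s
    eq = solve-∀
  Q+sum (rejC v r e o x) = Q+sum r
  Q+sum (accC {Q = Q} {acc} v r e o x) = trans (eq Q v (sumℤ acc)) (Q+sum r)
    where
    eq : ∀ Q v s → (Q ℤ.- v) ℤ.+ (v ℤ.+ s) ≡ Q ℤ.+ s
    eq = solve-∀

  -- Only the rejection of an entry of d lowers p without lowering Γ, and `Rej` grants the room for
  -- it: either Γ ≤ p or w < s.
  Γ≤p+s : N ≡ length d + length a →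
          ∀ {dD dC p p′ Γ Q acc} → Run d a c b N M dD dC p p′ Γ Q acc → Γ ≤ p + length a
  Γ≤p+s N≡ start = ℕₚ.≤-reflexive N≡
  Γ≤p+s N≡ (rejD v r e o (inj₁ Γ≤p)) = ℕₚ.≤-trans Γ≤p (ℕₚ.m≤m+n _ _)
  Γ≤p+s N≡ (rejD {p = p} v r e o (inj₂ (w , refl , w< , _))) =
    subst (_≤ p + length a) (ℕₚ.+-suc p w) (ℕₚ.+-monoʳ-≤ p w<)
  Γ≤p+s N≡ (accD v r e o x) = ℕₚ.≤-pred (Γ≤p+s N≡ r)
  Γ≤p+s N≡ (rejC v r e o x) = Γ≤p+s N≡ r
  Γ≤p+s N≡ (accC v r e o x) = ℕₚ.<⇒≤ (Γ≤p+s N≡ r)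

  d<c : Sorted c → ∀ {dD dC p p′ Γ Q acc} → Run d a c b N M dD dC p p′ Γ Q acc → at d (suc p) <∞ at c p′
  d<c sc start h = at-length c (subst (at c (length c) ≤∞_) (at-out d ℕₚ.≤-refl) h)
  d<c sc (rejD {p′ = p′} v r e o x) h = o (subst (at c p′ ≤∞_) e h)
  d<c sc (accD {p′ = p′} v r e o x) h = o (subst (at c p′ ≤∞_) e h)
  d<c sc (rejC v r e o x) h = d<c sc r (≤∞-trans (sc _) h)
  d<c sc (accC v r e o x) h = d<c sc r (≤∞-trans (sc _) h)

-- If g_{Γ+1} ≤ v, subtraction suffices. Otherwise g_l > d_{l-j+1} for l = Γ + 1 and j = w + 1,
-- which `below` forbids when w = s, and which contradicts the failure of rule (b) when w < s.
accept-bound : ∀ {g d a} → GM g d a → Sorted d → Sorted a →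
  ∀ {p Γ Q v} → at d (suc p) ≡ fin v → Acc d a p (suc Γ) Q v → suc Γ ≤ length g →
  Q ℤ.≤ P g (suc Γ) → Q ℤ.- v ℤ.≤ P g Γ
accept-bound {g} {d} {a} gm sd sa {p} {Γ} {Q} {v} e (w , eq , w≤ , a< , B) Γ≤ h with at-fin g Γ≤
... | u , ge , Pe with u ℤ.≤? v
... | yes u≤v = lin₂ h u≤v (trans (cong (λ x → (x ℤ.- Q) ℤ.+ (v ℤ.- u)) Pe) (eq′ (P g Γ) u Q v))
  where
  eq′ : ∀ P u Q v → ((P ℤ.+ u) ℤ.- Q) ℤ.+ (v ℤ.- u) ≡ P ℤ.- (Q ℤ.- v)
  eq′ = solve-∀
... | no u≰v = ⊥-elim impossible
  where
  eq₁ : p + suc w ≡ suc Γ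
  eq₁ = trans (ℕₚ.+-suc p w) (sym eq)
  viol : at d (suc p) <∞ at g (suc Γ)
  viol k = u≰v (fin≤⁻ (subst₂ _≤∞_ ge e k))
  impossible : ⊥
  impossible with ℕₚ.m≤n⇒m<n∨m≡n w≤
  ... | inj₂ refl = viol (subst (λ k → at g k ≤∞ at d (suc p)) eq₁
                      (GM.below gm p (subst (_≤ length g) (sym eq₁) Γ≤)))
  ... | inj₁ w< = ℤₚ.<⇒≱ (B w<) (ℤₚ.≤-trans h (subst (λ k → P g k ℤ.≤ P d p ℤ.+ P a (suc w)) eq₁
      (split-below gm sd sa (subst (_≤ length g) (sym eq₁) Γ≤) (s≤s z≤n) w<
        (ℕₚ.<⇒≤ (at-in′ d e))
        (subst (at a (suc w) ≤∞_) (sym e) (<∞⇒≤∞ a<))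
        (subst (λ k → at d (suc p) <∞ at g k) (sym eq₁) viol))))

Q≤Pg : ∀ {d a c b N M g} → GM g d a → GM g c b → Sorted d → Sorted a → Sorted c → Sorted b →
  length g ≡ N → sumℤ g ≡ M →
  ∀ {dD dC p p′ Γ Q acc} → Run d a c b N M dD dC p p′ Γ Q acc → Q ℤ.≤ P g Γ
Q≤Pg {g = g} G₁ G₂ sd sa sc sb refl refl start = ℤₚ.≤-reflexive (sym (P-all g))
Q≤Pg G₁ G₂ sd sa sc sb e₁ e₂ (rejD v r e o x) = Q≤Pg G₁ G₂ sd sa sc sb e₁ e₂ r
Q≤Pg G₁ G₂ sd sa sc sb refl e₂ (accD v r e o x) =
  accept-bound G₁ sd sa e x (Γ≤N r) (Q≤Pg G₁ G₂ sd sa sc sb refl e₂ r)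
Q≤Pg G₁ G₂ sd sa sc sb e₁ e₂ (rejC v r e o x) = Q≤Pg G₁ G₂ sd sa sc sb e₁ e₂ r
Q≤Pg G₁ G₂ sd sa sc sb refl e₂ (accC v r e o x) =
  accept-bound G₂ sc sb e x (Γ≤N r) (Q≤Pg G₁ G₂ sd sa sc sb refl e₂ r)

-- Slack along a run

-- The merge seen only through prefix sums: P e i is the largest P d p + P a J with p + J = i. The
-- order among equal entries is invisible here; it matters only for `posOf`.
record Merged (d a e : List ℤ) : Set where
  field
    length≡    : length e ≡ length d + length a
    some-split : ∀ {i} → i ≤ length d + length a →
                 ∃[ p ] ∃[ J ] p + J ≡ i × p ≤ length d × J ≤ length a × P e i ≡ P d p ℤ.+ P a J
    all-splits : ∀ {p J} → p ≤ length d → J ≤ length a → P d p ℤ.+ P a J ℤ.≤ P e (p + J)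

P-suc-≤ : ∀ xs {i v} → i < length xs → at xs (suc i) ≤∞ fin v → P xs (suc i) ℤ.≤ P xs i ℤ.+ v
P-suc-≤ xs {i} h k with at-fin xs h
... | u , e , f = subst (ℤ._≤ P xs i ℤ.+ _) (sym f) (ℤₚ.+-monoʳ-≤ (P xs i) (fin≤⁻ (subst (_≤∞ fin _) e k)))

P-suc-≥ : ∀ xs {i v} → fin v ≤∞ at xs (suc i) → P xs i ℤ.+ v ℤ.≤ P xs (suc i)
P-suc-≥ xs {i} k with at-fin xs (at-in xs k)
... | u , e , f = subst (P xs i ℤ.+ _ ℤ.≤_) (sym f) (ℤₚ.+-monoʳ-≤ (P xs i) (fin≤⁻ (subst (fin _ ≤∞_) e k)))

+-slide : ∀ x y z → (x ℤ.+ y) ℤ.+ z ≡ (x ℤ.+ z) ℤ.+ y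
+-slide = solve-∀

module _ {d a e : List ℤ} (mg : Merged d a e) where
  open Merged mg

  drop-left : ∀ {p J i v} → suc p + J ≡ suc i → suc p ≤ length d → J ≤ length a →
              at d (suc p) ≤∞ fin v → P d (suc p) ℤ.+ P a J ℤ.≤ P e i ℤ.+ v
  drop-left {p} {J} {v = v} refl p≤ J≤ h = ℤₚ.≤-trans (ℤₚ.+-monoˡ-≤ (P a J) (P-suc-≤ d p≤ h))
    (subst (ℤ._≤ P e (p + J) ℤ.+ v) (+-slide (P d p) (P a J) v)
      (ℤₚ.+-monoˡ-≤ v (all-splits (ℕₚ.<⇒≤ p≤) J≤)))

  drop-right : ∀ {p J i v} → p + suc J ≡ suc i → p ≤ length d → suc J ≤ length a →
               at a (suc J) ≤∞ fin v → P d p ℤ.+ P a (suc J) ℤ.≤ P e i ℤ.+ v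
  drop-right {p} {J} {i} {v} eq p≤ J≤ h with ℕₚ.suc-injective (trans (sym (ℕₚ.+-suc p J)) eq)
  ... | refl = ℤₚ.≤-trans (ℤₚ.+-monoʳ-≤ (P d p) (P-suc-≤ a J≤ h))
    (subst (ℤ._≤ P e (p + J) ℤ.+ v) (ℤₚ.+-assoc (P d p) (P a J) v)
      (ℤₚ.+-monoˡ-≤ v (all-splits p≤ (ℕₚ.<⇒≤ J≤))))

  -- In substance e_{i+1} ≤ v: a split of i + 1 > p + w reaches an entry of d beyond p or an entry
  -- of a beyond w, and taking out the last such entry costs at most v.
  e-drop : Sorted d → Sorted a → ∀ {p w i v} → suc i ≤ length d + length a → p + w ≤ i →
           at d (suc p) ≤∞ fin v → at a (suc w) ≤∞ fin v → P e (suc i) ℤ.≤ P e i ℤ.+ v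
  e-drop sd sa {p} {w} {i} i< h hd ha with some-split i<
  ... | zero , zero , () , _
  ... | zero , suc J , eq , p≤ , J≤ , f = subst (ℤ._≤ _) (sym f)
        (drop-right {zero} eq p≤ J≤ (≤∞-trans (at-anti a sa
          (ℕₚ.≤-trans (s≤s (ℕₚ.≤-trans (ℕₚ.m≤n+m w p) h)) (ℕₚ.≤-reflexive (sym eq)))) ha))
  ... | suc p₀ , J₀ , eq , p≤ , J≤ , f with p ℕₚ.≤? p₀
  ... | yes q = subst (ℤ._≤ _) (sym f) (drop-left eq p≤ J≤ (≤∞-trans (at-anti d sd (s≤s q)) hd))
  e-drop sd sa {p} {w} {i} i< h hd ha | suc p₀ , zero , eq , p≤ , J≤ , f | no ¬q =
    ⊥-elim (¬q (ℕₚ.≤-trans (ℕₚ.≤-trans (ℕₚ.m≤m+n p w) h)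
      (ℕₚ.≤-reflexive (sym (trans (sym (ℕₚ.+-identityʳ p₀)) (ℕₚ.suc-injective eq))))))
  e-drop sd sa {p} {w} {i} i< h hd ha | suc p₀ , suc J , eq , p≤ , J≤ , f | no ¬q =
    subst (ℤ._≤ _) (sym f) (drop-right eq p≤ J≤ (≤∞-trans (at-anti a sa (s≤s w≤J)) ha))
    where
    w≤J : w ≤ J
    w≤J = ℕₚ.+-cancelˡ-≤ p w J (ℕₚ.≤-trans h (ℕₚ.≤-trans
      (ℕₚ.≤-reflexive (trans (sym (ℕₚ.suc-injective eq)) (ℕₚ.+-suc p₀ J)))
      (ℕₚ.+-monoˡ-≤ J (ℕₚ.≰⇒> ¬q))))

-- Rejections change neither Γ nor Q, so only acceptances are recorded. The bound f is a parameter
-- because one run is measured against both `P e` and `P e′`.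
Valid : ∀ {d a c b N M dD dC p p′ Γ Q acc} → (ℕ → ℤ) → Run d a c b N M dD dC p p′ Γ Q acc → Set
Valid {N = N} {M} f start                      = M ℤ.≤ f N
Valid f (rejD v r e o x)                        = Valid f r
Valid f (accD {Γ = Γ} {Q} v r e o x)            = Q ℤ.- v ℤ.≤ f Γ × Valid f r
Valid f (rejC v r e o x)                        = Valid f r
Valid f (accC {Γ = Γ} {Q} v r e o x)            = Q ℤ.- v ℤ.≤ f Γ × Valid f r

valid : ∀ {d a c b N M dD dC p p′ Γ Q acc f} (r : Run d a c b N M dD dC p p′ Γ Q acc) →
        Valid f r → Q ℤ.≤ f Γ
valid start            V = V
valid (rejD v r e o x) V = valid r V
valid (accD v r e o x) V = proj₁ V
valid (rejC v r e o x) V = valid r V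
valid (accC v r e o x) V = proj₁ V

Valid-swap : ∀ {d a c b N M dD dC p p′ Γ Q acc f} (r : Run d a c b N M dD dC p p′ Γ Q acc) →
             Valid f (swap r) → Valid f r
Valid-swap start            V       = V
Valid-swap (rejD v r e o x) V       = Valid-swap r V
Valid-swap (accD v r e o x) (u , V) = u , Valid-swap r V
Valid-swap (rejC v r e o x) V       = Valid-swap r V
Valid-swap (accC v r e o x) (u , V) = u , Valid-swap r V

Valid-swap⁻ : ∀ {d a c b N M dD dC p p′ Γ Q acc f} (r : Run d a c b N M dD dC p p′ Γ Q acc) →
              Valid f r → Valid f (swap r)
Valid-swap⁻ start            V       = V
Valid-swap⁻ (rejD v r e o x) V       = Valid-swap⁻ r V
Valid-swap⁻ (accD v r e o x) (u , V) = u , Valid-swap⁻ r V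
Valid-swap⁻ (rejC v r e o x) V       = Valid-swap⁻ r V
Valid-swap⁻ (accC v r e o x) (u , V) = u , Valid-swap⁻ r V

-- Condition (i) at every event that puts an entry of c into S.
RunCond : ∀ {d a c b N M dD dC p p′ Γ Q acc} → List ℤ → Run d a c b N M dD dC p p′ Γ Q acc → Set
RunCond e start            = ⊤
RunCond e (rejD v r _ _ x) = RunCond e r
RunCond e (accD v r _ _ x) = RunCond e r
RunCond e (rejC v r _ _ x) = RunCond e r
RunCond {a = a} e (accC {p = p} {Γ = Γ} {Q} v r _ _ x) =
  ((∀ w → suc Γ ≡ p + w → fin v <∞ at a w) → Q ℤ.- v ℤ.≤ P e Γ) × RunCond e r

module _ {d a c b e : List ℤ} {N : ℕ} {M : ℤ} (mg : Merged d a e)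
         (sd : Sorted d) (sa : Sorted a) (sc : Sorted c) (N≡ : N ≡ length d + length a) where
  private
    step : ∀ {Q v Γ} → Q ℤ.≤ P e (suc Γ) → P e (suc Γ) ℤ.≤ P e Γ ℤ.+ v → Q ℤ.- v ℤ.≤ P e Γ
    step {Q} {v} {Γ} h k = lin (ℤₚ.≤-trans h k) (eq (P e Γ) v Q)
      where
      eq : ∀ x v Q → (x ℤ.+ v) ℤ.- Q ≡ x ℤ.- (Q ℤ.- v)
      eq = solve-∀

  -- An acceptance in d preserves Q ≤ P e Γ by itself, since d_{p+1} and a_{w+1} are at most v. So
  -- does an acceptance in c if a_w ≤ v, where Γ + 1 = p + w. The remaining acceptances in c are
  -- those with t_y ≤ m_y, for which condition (i) is available.
  RunCond⇒Valid : M ℤ.≤ P e N → ∀ {dD dC p p′ Γ Q acc} (r : Run d a c b N M dD dC p p′ Γ Q acc) →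
                  RunCond e r → Valid (P e) r
  RunCond⇒Valid M≤ start            C = M≤
  RunCond⇒Valid M≤ (rejD v r _ _ x) C = RunCond⇒Valid M≤ r C
  RunCond⇒Valid M≤ (accD v r eq _ (w , refl , w≤ , a< , _)) C =
    step (valid r V) (e-drop mg sd sa (subst (_ ≤_) N≡ (Γ≤N r)) ℕₚ.≤-refl (≤∞-reflexive eq) (<∞⇒≤∞ a<)) , V
    where V = RunCond⇒Valid M≤ r C
  RunCond⇒Valid M≤ (rejC v r _ _ x) C = RunCond⇒Valid M≤ r C
  RunCond⇒Valid M≤ (accC {p = p} {Γ = Γ} {Q} v r eq _ x) (B , C) = bound , V
    where
    V = RunCond⇒Valid M≤ r C
    bound : Q ℤ.- v ℤ.≤ P e Γ
    bound with p ℕₚ.≤? suc Γ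
    ... | no p≰ = B λ w eq′ → ⊥-elim (p≰ (subst (p ≤_) (sym eq′) (ℕₚ.m≤m+n p w)))
    ... | yes p≤ with ℕₚ.m≤n⇒∃[o]m+o≡n p≤
    ... | w , weq with at a w ≤∞? fin v
    ... | no h = B λ w′ eq′ → subst (λ k → fin v <∞ at a k) (ℕₚ.+-cancelˡ-≡ p w w′ (trans weq eq′)) h
    bound | yes p≤ | suc w , weq | yes h =
      step (valid r V) (e-drop mg sd sa (subst (_ ≤_) N≡ (Γ≤N r))
        (ℕₚ.≤-reflexive (ℕₚ.suc-injective (trans (sym (ℕₚ.+-suc p w)) weq)))
        (subst (at d (suc p) ≤∞_) eq (<∞⇒≤∞ (d<c sc r))) h)

  mutual
    -- If a_w < d_{p+1}, a rejection of d_{p+1} must come from rule (b), which is the claim. An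
    -- acceptance in d reduces to `slack′` one state earlier. An acceptance in c subtracts v >
    -- d_{p+1} > a_w ≥ a_{w+1}, while only a_{w+1} leaves the bound.
    slack : ∀ {dD dC p p′ Γ Q acc} (r : Run d a c b N M dD dC p p′ Γ Q acc) → Valid (P e) r →
            ∀ {w} → Γ ≡ p + w → at a w <∞ at d (suc p) → Q ℤ.≤ P d p ℤ.+ P a w
    slack start V {w} _ h = ⊥-elim (h (subst (_≤∞ at a w) (sym (at-out d ℕₚ.≤-refl)) -∞≤))
    slack (rejD v r eq o (inj₁ Γ≤p)) V {zero} _ h = ⊥-elim (h ≤+∞)
    slack (rejD {p = p} v r eq o (inj₁ Γ≤p)) V {suc w} refl h = ⊥-elim (ℕₚ.m+1+n≰m p Γ≤p)
    slack (rejD {p = p} v r eq o (inj₂ (w₀ , refl , w< , alt))) V {w} Γ≡ h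
      with ℕₚ.+-cancelˡ-≡ p (suc w₀) w (trans (ℕₚ.+-suc p w₀) Γ≡)
    slack (rejD v r eq o (inj₂ (w₀ , refl , w< , inj₁ k))) V Γ≡ h | refl = ⊥-elim (h (subst (_≤∞ at a (suc w₀)) (sym eq) k))
    slack (rejD v r eq o (inj₂ (w₀ , refl , w< , inj₂ k))) V Γ≡ h | refl = k
    slack (accD {p = p} {Q = Q} v r eq o (w₀ , refl , w≤ , a< , _)) (_ , V) {w} Γ≡ h
      with ℕₚ.+-cancelˡ-≡ p w₀ w Γ≡
    ... | refl = lin (slack′ r V refl (subst (at a (suc w₀) ≤∞_) (sym eq) (<∞⇒≤∞ a<)))
                   (trans (cong (λ z → (z ℤ.+ P a w₀) ℤ.- Q) (P-suc d eq)) (arith (P d p) v (P a w₀) Q))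
      where
      arith : ∀ x v y Q → ((x ℤ.+ v) ℤ.+ y) ℤ.- Q ≡ (x ℤ.+ y) ℤ.- (Q ℤ.- v)
      arith = solve-∀
    slack (rejC v r eq o x) V Γ≡ h = slack r V Γ≡ h
    slack (accC {p = p} {Q = Q} v r eq o x) (_ , V) {w} Γ≡ h =
      lin₂ (slack r V sΓ≡ (≤∞-<∞-trans (sa w) h)) (P-suc-≤ a {w} {v} w< a≤) (arith (P d p) (P a w) (P a (suc w)) v Q)
      where
      sΓ≡ = trans (cong suc Γ≡) (sym (ℕₚ.+-suc p w))
      w< : w < length a
      w< = ℕₚ.+-cancelˡ-≤ p (suc w) (length a) (subst (_≤ p + length a) sΓ≡ (Γ≤p+s N≡ r))
      a≤ : at a (suc w) ≤∞ fin v
      a≤ = ≤∞-trans (sa w) (≤∞-trans (<∞⇒≤∞ h) (subst (at d (suc p) ≤∞_) eq (<∞⇒≤∞ (d<c sc r))))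
      arith : ∀ x y z v Q → ((x ℤ.+ z) ℤ.- Q) ℤ.+ ((y ℤ.+ v) ℤ.- z) ≡ (x ℤ.+ y) ℤ.- (Q ℤ.- v)
      arith = solve-∀

    -- When `slack` does not apply, d_{p+1} ≤ a_w and a_{w+1} ≤ d_p make (p, w) an optimal split, so
    -- that P d p + P a w is P e Γ and validity is enough.
    slack′ : ∀ {dD dC p p′ Γ Q acc} (r : Run d a c b N M dD dC p p′ Γ Q acc) → Valid (P e) r →
             ∀ {w} → Γ ≡ p + w → at a (suc w) ≤∞ at d p → Q ℤ.≤ P d p ℤ.+ P a w
    slack′ {p = p} r V {w} Γ≡ h with at d (suc p) ≤∞? at a w
    ... | no k = slack r V Γ≡ k
    ... | yes k with Merged.some-split mg (subst (_ ≤_) N≡ (Γ≤N r))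
    ... | p₀ , J₀ , eq , p₀≤ , J₀≤ , f = ℤₚ.≤-trans (valid r V) (ℤₚ.≤-trans (ℤₚ.≤-reflexive f)
          (split-opt d a sd sa (trans eq Γ≡) p₀≤ J₀≤ (p≤length r)
            (ℕₚ.+-cancelˡ-≤ p w (length a) (subst (_≤ p + length a) Γ≡ (Γ≤p+s N≡ r))) h k))

-- Balanced blocks

-- A sufficient form of ≺′: the index p + J need not be the first violation h_J.
record Crit (g d a : List ℤ) : Set where
  field
    below   : Dominated g d (suc (length a)) (length g)
    witness : ∀ {J} → 1 ≤ J → J ≤ length a →
              ∃[ p ] p ≤ length d × (∀ {p′} → p′ < p → at g (p′ + J) ≤∞ at d (suc p′))
                × P g (p + J) ℤ.≤ P d p ℤ.+ P a J

Sorted-∷ : ∀ {x xs} → at xs 1 ≤∞ fin x → Sorted xs → Sorted (x ∷ xs)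
Sorted-∷ h s zero          = ≤+∞
Sorted-∷ h s (suc zero)    = h
Sorted-∷ h s (suc (suc i)) = s (suc i)

Sorted-replicate : ∀ n {x xs} → at xs 1 ≤∞ fin x → Sorted xs → Sorted (replicate n x ++ xs)
Sorted-replicate zero          h s = s
Sorted-replicate (suc zero)    h s = Sorted-∷ h s
Sorted-replicate (suc (suc n)) h s = Sorted-∷ ≤∞-refl (Sorted-replicate (suc n) h s)

at-replicate : ∀ n {x} xs {i} → i < n → at (replicate n x ++ xs) (suc i) ≡ fin x
at-replicate (suc n) xs {zero}  _       = refl
at-replicate (suc n) xs {suc i} (s≤s h) = at-replicate n xs h

at-++ : ∀ xs ys i → at (xs ++ ys) (suc (length xs + i)) ≡ at ys (suc i)
at-++ []       ys i = refl
at-++ (x ∷ xs) ys i = at-++ xs ys i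

sum-++ : ∀ xs ys → sumℤ (xs ++ ys) ≡ sumℤ xs ℤ.+ sumℤ ys
sum-++ []       ys = sym (ℤₚ.+-identityˡ _)
sum-++ (x ∷ xs) ys = trans (cong (ℤ._+_ x) (sum-++ xs ys)) (sym (ℤₚ.+-assoc x _ _))

sum-replicate : ∀ n x → sumℤ (replicate n x) ≡ x ℤ.* ℤ.+ n
sum-replicate zero    x = sym (ℤₚ.*-zeroʳ x)
sum-replicate (suc n) x = trans (cong (ℤ._+_ x) (sum-replicate n x)) (eq x (ℤ.+ n))
  where
  eq : ∀ x n → x ℤ.+ x ℤ.* n ≡ x ℤ.* (1ℤ ℤ.+ n)
  eq = solve-∀

drop-all : ∀ (xs ys : List ℤ) → drop (length xs) (xs ++ ys) ≡ ys
drop-all []       ys = refl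
drop-all (x ∷ xs) ys = drop-all xs ys

drop-suc : ∀ (xs : List ℤ) {n y ys} → drop n xs ≡ y ∷ ys → drop (suc n) xs ≡ ys × at xs (suc n) ≡ fin y
drop-suc (x ∷ xs) {zero}  refl = refl , refl
drop-suc (x ∷ xs) {suc n} e    = drop-suc xs e

P+drop : ∀ n xs → P xs n ℤ.+ sumℤ (drop n xs) ≡ sumℤ xs
P+drop zero    xs       = ℤₚ.+-identityˡ _
P+drop (suc n) []       = refl
P+drop (suc n) (x ∷ xs) = trans (ℤₚ.+-assoc x _ _) (cong (ℤ._+_ x) (P+drop n xs))

-- `cap` and `floor` compare the mean Q/n with integers: one that is at least the mean is at least
-- `top`, and one below the mean is at most `f`.
record Balanced (n : ℕ) (Q : ℤ) (acc g : List ℤ) : Set where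
  field
    {f top} : ℤ
    length≡ : length g ≡ n + length acc
    drop≡   : drop n g ≡ acc
    sum≡    : sumℤ g ≡ Q ℤ.+ sumℤ acc
    sorted  : Sorted g
    lower   : ∀ {i} → i < n → fin f ≤∞ at g (suc i)
    upper   : ∀ {i} → i < n → at g (suc i) ≤∞ fin top
    top≤    : top ℤ.≤ 1ℤ ℤ.+ f
    cap     : ∀ {v} → Q ℤ.≤ v ℤ.* ℤ.+ n → top ℤ.≤ v
    floor   : ∀ {x} → x ℤ.* ℤ.+ n ℤ.< Q → x ℤ.≤ f

*-cancel-< : ∀ {x y} n → x ℤ.* ℤ.+ n ℤ.< y ℤ.* ℤ.+ n → x ℤ.< y
*-cancel-< {x} {y} n h = ℤₚ.≰⇒> λ y≤x → ℤₚ.<⇒≱ h (ℤₚ.*-monoʳ-≤-nonNeg (ℤ.+ n) y≤x)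

<⇒1+≤ : ∀ {x y} → x ℤ.< y → 1ℤ ℤ.+ x ℤ.≤ y
<⇒1+≤ = ℤₚ.i<j⇒suc[i]≤j

1+≤⇒< : ∀ {x y} → 1ℤ ℤ.+ x ℤ.≤ y → x ℤ.< y
1+≤⇒< = ℤₚ.suc[i]≤j⇒i<j

-- Division with remainder, Q = r + f n: the block has r entries f + 1 and n - r entries f. The head
-- of `acc` is an integer below the mean, hence at most f.
balance : ∀ n Q acc → 1 ≤ n → Sorted acc →
          (∀ {x} → fin x ≤∞ at acc 1 → x ℤ.* ℤ.+ n ℤ.< Q) → ∃[ g ] Balanced n Q acc g
balance n@(suc n-1) Q acc _ sacc hd = g , record
  { f = f ; top = top r
  ; length≡ = len ; drop≡ = drp ; sum≡ = sm ; sorted = srt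
  ; lower = low ; upper = upp r refl ; top≤ = top≤ r ; cap = cap r refl ; floor = flr }
  where
  f = Q /ℕ n
  r = Q %ℕ n
  k = n ∸ r
  r+k : r + k ≡ n
  r+k = ℕₚ.m+[n∸m]≡n (ℕₚ.<⇒≤ (n%ℕd<d Q n))
  Q≡ : Q ≡ ℤ.+ r ℤ.+ f ℤ.* ℤ.+ n
  Q≡ = a≡a%ℕn+[a/ℕn]*n Q n
  B₁ = replicate r (1ℤ ℤ.+ f)
  B₂ = replicate k f
  g = B₁ ++ (B₂ ++ acc)
  len : length g ≡ n + length acc
  len = begin
    length g                            ≡⟨ Lₚ.length-++ B₁ ⟩
    length B₁ + length (B₂ ++ acc)      ≡⟨ cong₂ _+_ (Lₚ.length-replicate r) (Lₚ.length-++ B₂) ⟩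
    r + (length B₂ + length acc)        ≡⟨ cong (λ z → r + (z + length acc)) (Lₚ.length-replicate k) ⟩
    r + (k + length acc)                ≡⟨ sym (ℕₚ.+-assoc r k _) ⟩
    r + k + length acc                  ≡⟨ cong (_+ length acc) r+k ⟩
    n + length acc                      ∎ where open ≡-Reasoning
  len-B : length (B₁ ++ B₂) ≡ n
  len-B = trans (Lₚ.length-++ B₁) (trans (cong₂ _+_ (Lₚ.length-replicate r) (Lₚ.length-replicate k)) r+k)
  drp : drop n g ≡ acc
  drp = trans (cong₂ drop (sym len-B) (sym (Lₚ.++-assoc B₁ B₂ acc))) (drop-all (B₁ ++ B₂) acc)
  n≡ : ℤ.+ n ≡ ℤ.+ r ℤ.+ ℤ.+ k
  n≡ = cong ℤ.+_ (sym r+k)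
  sm : sumℤ g ≡ Q ℤ.+ sumℤ acc
  sm = begin
    sumℤ g
      ≡⟨ trans (sum-++ B₁ _) (cong (ℤ._+_ (sumℤ B₁)) (sum-++ B₂ acc)) ⟩
    sumℤ B₁ ℤ.+ (sumℤ B₂ ℤ.+ sumℤ acc)
      ≡⟨ cong₂ (λ x y → x ℤ.+ (y ℤ.+ sumℤ acc)) (sum-replicate r _) (sum-replicate k f) ⟩
    (1ℤ ℤ.+ f) ℤ.* ℤ.+ r ℤ.+ (f ℤ.* ℤ.+ k ℤ.+ sumℤ acc)
      ≡⟨ arith f (ℤ.+ r) (ℤ.+ k) (sumℤ acc) ⟩
    (ℤ.+ r ℤ.+ f ℤ.* (ℤ.+ r ℤ.+ ℤ.+ k)) ℤ.+ sumℤ acc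
      ≡⟨ cong (ℤ._+ sumℤ acc) (sym (trans Q≡ (cong (λ z → ℤ.+ r ℤ.+ f ℤ.* z) n≡))) ⟩
    Q ℤ.+ sumℤ acc ∎
    where
    open ≡-Reasoning
    arith : ∀ f r k s → (1ℤ ℤ.+ f) ℤ.* r ℤ.+ (f ℤ.* k ℤ.+ s) ≡ (r ℤ.+ f ℤ.* (r ℤ.+ k)) ℤ.+ s
    arith = solve-∀
  flr : ∀ {x} → x ℤ.* ℤ.+ n ℤ.< Q → x ℤ.≤ f
  flr {x} h = ℤₚ.≮⇒≥ λ f<x → ℤₚ.<⇒≱ h (ℤₚ.≤-trans
    (ℤₚ.≤-trans (ℤₚ.≤-reflexive Q≡) (ℤₚ.≤-trans
      (ℤₚ.+-monoˡ-≤ (f ℤ.* ℤ.+ n) (ℤ.+≤+ (ℕₚ.<⇒≤ (n%ℕd<d Q n))))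
      (ℤₚ.≤-reflexive (sym (arith f (ℤ.+ n))))))
    (ℤₚ.*-monoʳ-≤-nonNeg (ℤ.+ n) (<⇒1+≤ f<x)))
    where
    arith : ∀ f n → (1ℤ ℤ.+ f) ℤ.* n ≡ n ℤ.+ f ℤ.* n
    arith = solve-∀
  acc≤f : at acc 1 ≤∞ fin f
  acc≤f = head acc hd
    where
    head : ∀ acc → (∀ {x} → fin x ≤∞ at acc 1 → x ℤ.* ℤ.+ n ℤ.< Q) → at acc 1 ≤∞ fin f
    head []      _ = -∞≤
    head (x ∷ _) h = fin≤ (flr (h ≤∞-refl))
  f≤1+f : f ℤ.≤ 1ℤ ℤ.+ f
  f≤1+f = ℤₚ.<⇒≤ (1+≤⇒< ℤₚ.≤-refl)
  inner : Sorted (B₂ ++ acc)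
  inner = Sorted-replicate k acc≤f sacc
  inner≤ : at (B₂ ++ acc) 1 ≤∞ fin f
  inner≤ with k
  ... | zero  = acc≤f
  ... | suc _ = ≤∞-refl
  srt : Sorted g
  srt = Sorted-replicate r (≤∞-trans inner≤ (fin≤ f≤1+f)) inner
  value : ∀ {i} → i < n → (i < r × at g (suc i) ≡ fin (1ℤ ℤ.+ f)) ⊎ at g (suc i) ≡ fin f
  value {i} i<n with i ℕₚ.<? r
  ... | yes h = inj₁ (h , at-replicate r _ h)
  ... | no ¬h with ℕₚ.m≤n⇒∃[o]m+o≡n (ℕₚ.≮⇒≥ ¬h)
  ... | j , refl = inj₂ (trans
        (trans (cong (λ z → at g (suc (z + j))) (sym (Lₚ.length-replicate r))) (at-++ B₁ (B₂ ++ acc) j))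
        (at-replicate k acc (ℕₚ.+-cancelˡ-< r j k (subst (r + j <_) (sym r+k) i<n))))
  low : ∀ {i} → i < n → fin f ≤∞ at g (suc i)
  low h with value h
  ... | inj₁ (_ , e) = subst (fin f ≤∞_) (sym e) (fin≤ f≤1+f)
  ... | inj₂ e       = ≤∞-reflexive (sym e)
  -- If n divides Q, all values are f; taking f + 1 here would break `cap` for Q = v n.
  top : ℕ → ℤ
  top zero    = f
  top (suc _) = 1ℤ ℤ.+ f
  top≤ : ∀ r → top r ℤ.≤ 1ℤ ℤ.+ f
  top≤ zero    = f≤1+f
  top≤ (suc _) = ℤₚ.≤-refl
  upp : ∀ r′ → r ≡ r′ → ∀ {i} → i < n → at g (suc i) ≤∞ fin (top r′)
  upp r′ e {i} h with value h
  upp zero    e h | inj₁ (i<r , _) with subst (_ <_) e i<r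
  ... | ()
  upp (suc _) e h | inj₁ (_ , eq)  = ≤∞-reflexive eq
  upp zero    e h | inj₂ eq        = ≤∞-reflexive eq
  upp (suc _) e h | inj₂ eq        = ≤∞-trans (≤∞-reflexive eq) (fin≤ f≤1+f)
  cap : ∀ r′ → r ≡ r′ → ∀ {v} → Q ℤ.≤ v ℤ.* ℤ.+ n → top r′ ℤ.≤ v
  cap zero e {v} h = ℤₚ.*-cancelʳ-≤-pos f v (ℤ.+ n) (ℤₚ.≤-trans (ℤₚ.≤-reflexive
    (trans (sym (ℤₚ.+-identityˡ _)) (trans (cong (λ z → ℤ.+ z ℤ.+ f ℤ.* ℤ.+ n) (sym e)) (sym Q≡)))) h)
  cap (suc r′) e {v} h = <⇒1+≤ (*-cancel-< {f} {v} n (ℤₚ.<-≤-trans lt h))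
    where
    lt : f ℤ.* ℤ.+ n ℤ.< Q
    lt = subst (f ℤ.* ℤ.+ n ℤ.<_) (sym (trans Q≡ (cong (λ z → ℤ.+ z ℤ.+ f ℤ.* ℤ.+ n) e)))
           (subst (ℤ._< ℤ.+ suc r′ ℤ.+ f ℤ.* ℤ.+ n) (ℤₚ.+-identityˡ _)
             (ℤₚ.+-monoˡ-< (f ℤ.* ℤ.+ n) (ℤ.+<+ (s≤s z≤n))))

-- Verification of the truncated sequence

module _ {d a c b : List ℤ} {N : ℕ} {M : ℤ} (sd : Sorted d) (sc : Sorted c) where
  acc-head : ∀ {dD dC p p′ Γ Q acc} → Run d a c b N M dD dC p p′ Γ Q acc →
             at acc 1 ≤∞ at d (suc p) ⊎ at acc 1 ≤∞ at c (suc p′)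
  acc-head start = inj₁ -∞≤
  acc-head (rejD v r e o x) with acc-head r
  ... | inj₁ h = inj₁ (≤∞-trans h (sd _))
  ... | inj₂ h = inj₂ h
  acc-head (accD v r e o x) = inj₁ (≤∞-reflexive (sym e))
  acc-head (rejC v r e o x) with acc-head r
  ... | inj₁ h = inj₁ h
  ... | inj₂ h = inj₂ (≤∞-trans h (sc _))
  acc-head (accC v r e o x) = inj₂ (≤∞-reflexive (sym e))

  acc-sorted : ∀ {dD dC p p′ Γ Q acc} → Run d a c b N M dD dC p p′ Γ Q acc → Sorted acc
  acc-sorted start zero    = ≤+∞
  acc-sorted start (suc i) = -∞≤
  acc-sorted (rejD v r e o x) = acc-sorted r
  acc-sorted (accD {p = p} {p′} {acc = acc} v r e o x) =
    Sorted-∷ (subst (at acc 1 ≤∞_) e (head (acc-head r))) (acc-sorted r)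
    where
    head : at acc 1 ≤∞ at d (suc (suc p)) ⊎ at acc 1 ≤∞ at c (suc p′) → at acc 1 ≤∞ at d (suc p)
    head (inj₁ h) = ≤∞-trans h (sd (suc p))
    head (inj₂ h) = ≤∞-trans h (<∞⇒≤∞ (d<c sd (swap r)))
  acc-sorted (rejC v r e o x) = acc-sorted r
  acc-sorted (accC {p = p} {p′} {acc = acc} v r e o x) =
    Sorted-∷ (subst (at acc 1 ≤∞_) e (head (acc-head r))) (acc-sorted r)
    where
    head : at acc 1 ≤∞ at d (suc p) ⊎ at acc 1 ≤∞ at c (suc (suc p′)) → at acc 1 ≤∞ at c (suc p′)
    head (inj₁ h) = ≤∞-trans h (<∞⇒≤∞ (d<c sc r))
    head (inj₂ h) = ≤∞-trans h (sc (suc p′))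

-- One side of the verification; the other is its instance after `swap`. By `above` and `floor` the
-- processed entries of d are at most f; by `cap₀`, `cap` and `v₀≤d` the unprocessed ones are at
-- least `top`.
module Verify {d a c b e : List ℤ} {N : ℕ} {M : ℤ} (mg : Merged d a e)
    (sd : Sorted d) (sa : Sorted a) (sc : Sorted c) (N≡ : N ≡ length d + length a)
    {dD₀ dC₀ : List Decision} {p₀ p′₀ Γ₀ : ℕ} {Q₀ : ℤ} {acc₀ g : List ℤ}
    (r₀ : Run d a c b N M dD₀ dC₀ p₀ p′₀ Γ₀ Q₀ acc₀) (V₀ : Valid (P e) r₀)
    (bal : Balanced Γ₀ Q₀ acc₀ g)
    (above : ∀ {x} → fin x ≤∞ at d (suc p₀) → x ℤ.* ℤ.+ Γ₀ ℤ.< Q₀)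
    {v₀ : ℤ} (cap₀ : Q₀ ℤ.≤ v₀ ℤ.* ℤ.+ Γ₀) (v₀≤d : fin v₀ ≤∞ at d p₀) where
  open Balanced bal

  length-g : length g ≡ N
  length-g = trans length≡ (Γ+length r₀)

  -- Q + Σ acc is the total of g at every state; where the tail of g after Γ is `acc`, what remains
  -- for the first Γ entries is Q.
  Pg≡Q : ∀ {dD dC p p′ Γ Q acc} → Run d a c b N M dD dC p p′ Γ Q acc → drop Γ g ≡ acc → P g Γ ≡ Q
  Pg≡Q {Γ = Γ} {Q} {acc} r refl = ∸-cancel (trans (P+drop Γ g)
    (trans sum≡ (trans (Q+sum r₀) (sym (Q+sum r)))))
    where
    arith : ∀ x s → (x ℤ.+ s) ℤ.- s ≡ x
    arith = solve-∀
    ∸-cancel : ∀ {x y s} → x ℤ.+ s ≡ y ℤ.+ s → x ≡ y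
    ∸-cancel {x} {y} {s} h = trans (sym (arith x s)) (trans (cong (ℤ._- s) h) (arith y s))

  Pg≤Pe-tail : ∀ {dD dC p p′ Γ Q acc} (r : Run d a c b N M dD dC p p′ Γ Q acc) → Valid (P e) r →
               drop Γ g ≡ acc → ∀ {i} → Γ ≤ i → i ≤ N → P g i ℤ.≤ P e i
  Pg≤Pe-tail start V eq h k with ℕₚ.≤-antisym h k
  ... | refl = subst (ℤ._≤ P e N) (sym (Pg≡Q start eq)) V
  Pg≤Pe-tail (rejD v r _ _ x) V eq h k = Pg≤Pe-tail r V eq h k
  Pg≤Pe-tail (rejC v r _ _ x) V eq h k = Pg≤Pe-tail r V eq h k
  Pg≤Pe-tail {Γ = Γ} r@(accD v r′ _ _ x) V eq h k with ℕₚ.m≤n⇒m<n∨m≡n h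
  ... | inj₁ h′   = Pg≤Pe-tail r′ (proj₂ V) (proj₁ (drop-suc g eq)) h′ k
  ... | inj₂ refl = subst (ℤ._≤ P e Γ) (sym (Pg≡Q r eq)) (proj₁ V)
  Pg≤Pe-tail {Γ = Γ} r@(accC v r′ _ _ x) V eq h k with ℕₚ.m≤n⇒m<n∨m≡n h
  ... | inj₁ h′   = Pg≤Pe-tail r′ (proj₂ V) (proj₁ (drop-suc g eq)) h′ k
  ... | inj₂ refl = subst (ℤ._≤ P e Γ) (sym (Pg≡Q r eq)) (proj₁ V)

  -- Integrality absorbs the rounding: nothing lies strictly between f and `top`.
  top≰f : ∀ {x} → fin f <∞ x → fin top ≤∞ x
  top≰f { -∞}   h = ⊥-elim (h -∞≤)
  top≰f {fin x} h = fin≤ (ℤₚ.≤-trans top≤ (<⇒1+≤ (fin<⁻ h)))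
  top≰f {+∞}    h = ≤+∞

  all-top : ∀ p J → p + J ≤ Γ₀ → fin top ≤∞ at d p → fin top ≤∞ at a J →
            P g (p + J) ℤ.≤ P d p ℤ.+ P a J
  all-top p J h hd ha = lin₂
    (P-mono g a J {p} {0} (ℕₚ.≤-trans h Γ≤) λ {t} t<J → ≤∞-trans (upper (ℕₚ.<-≤-trans (ℕₚ.+-monoʳ-< p t<J) h))
      (≤∞-trans ha (at-anti a sa t<J)))
    (P-mono g d p {0} {0} (ℕₚ.≤-trans (ℕₚ.m≤m+n p J) (ℕₚ.≤-trans h Γ≤)) λ {t} t<p →
      ≤∞-trans (upper (ℕₚ.<-≤-trans t<p (ℕₚ.≤-trans (ℕₚ.m≤m+n p J) h))) (≤∞-trans hd (at-anti d sd t<p)))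
    (arith (P g (p + J)) (P g p) (P a J) (P d p))
    where
    Γ≤ : Γ₀ ≤ length g
    Γ≤ = subst (Γ₀ ≤_) (sym length≡) (ℕₚ.m≤m+n Γ₀ _)
    arith : ∀ x y z u → ((y ℤ.+ z) ℤ.- (x ℤ.+ 0ℤ)) ℤ.+ ((0ℤ ℤ.+ u) ℤ.- (y ℤ.+ 0ℤ)) ≡ (u ℤ.+ z) ℤ.- x
    arith = solve-∀

  -- A balanced block is majorized as soon as its total is: going down from Γ₀, either an entry
  -- of e that is at most f is removed, or all the remaining entries of e are at least top.
  Pg≤Pe-head : ∀ n i → i + n ≡ Γ₀ → P g i ℤ.≤ P e i
  Pg≤Pe-head zero i eq = Pg≤Pe-tail r₀ V₀ drop≡ (ℕₚ.≤-reflexive (sym (trans (sym (ℕₚ.+-identityʳ i)) eq)))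
    (ℕₚ.≤-trans (ℕₚ.≤-reflexive (trans (sym (ℕₚ.+-identityʳ i)) eq)) (Γ≤N r₀))
  Pg≤Pe-head (suc n) i eq = result (Merged.some-split mg (subst (suc i ≤_) N≡ (ℕₚ.≤-trans i< (Γ≤N r₀))))
    where
    i< : i < Γ₀
    i< = subst (suc i ≤_) (trans (sym (ℕₚ.+-suc i n)) eq) (ℕₚ.m≤m+n (suc i) n)
    IH : P g (suc i) ℤ.≤ P e (suc i)
    IH = Pg≤Pe-head n (suc i) (trans (sym (ℕₚ.+-suc i n)) eq)
    finish : P e (suc i) ℤ.≤ P e i ℤ.+ f → P g i ℤ.≤ P e i
    finish h = lin₂ (ℤₚ.≤-trans (P-suc-≥ g (lower i<)) IH) h (arith (P g i) f (P e (suc i)) (P e i))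
      where
      arith : ∀ x f y z → (y ℤ.- (x ℤ.+ f)) ℤ.+ ((z ℤ.+ f) ℤ.- y) ≡ z ℤ.- x
      arith = solve-∀
    big : ∀ p J → p + J ≡ i → p ≤ length d → J ≤ length a → fin top ≤∞ at d p → fin top ≤∞ at a J →
          P g i ℤ.≤ P e i
    big p J refl p≤ J≤ hd ha = ℤₚ.≤-trans (all-top p J (ℕₚ.<⇒≤ i<) hd ha) (Merged.all-splits mg p≤ J≤)
    result : ∃[ p ] ∃[ J ] p + J ≡ suc i × p ≤ length d × J ≤ length a × P e (suc i) ≡ P d p ℤ.+ P a J →
             P g i ℤ.≤ P e i
    result (p , J , eq , p≤ , J≤ , s) with at d p ≤∞? fin f | at a J ≤∞? fin f
    result (suc p , J , eq , p≤ , J≤ , s) | yes h | _ = finish (subst (ℤ._≤ _) (sym s) (drop-left mg eq p≤ J≤ h))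
    result (p , suc J , eq , p≤ , J≤ , s) | _ | yes h = finish (subst (ℤ._≤ _) (sym s) (drop-right mg eq p≤ J≤ h))
    result (zero , suc J , eq , p≤ , J≤ , s) | no h | no k =
      big 0 J (ℕₚ.suc-injective eq) z≤n (ℕₚ.<⇒≤ J≤) ≤+∞ (≤∞-trans (top≰f k) (sa J))
    result (suc p , J , eq , p≤ , J≤ , s) | no h | no k =
      big p J (ℕₚ.suc-injective eq) (ℕₚ.<⇒≤ p≤) J≤ (≤∞-trans (top≰f h) (sd p)) (top≰f k)

  Pg≤Pe : ∀ {i} → i ≤ N → P g i ℤ.≤ P e i
  Pg≤Pe {i} i≤ with ℕₚ.≤-total Γ₀ i
  ... | inj₁ h = Pg≤Pe-tail r₀ V₀ drop≡ h i≤
  ... | inj₂ h with ℕₚ.m≤n⇒∃[o]m+o≡n h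
  ... | n , eq = Pg≤Pe-head n i eq

  -- Let q be the number of entries of d that are at least a_{J+1}. If p < q, `slack′` bounds P g Γ,
  -- and the n entries of g up to Γ outweigh the n entries of a after a_{J+1}, so both can be
  -- cancelled. If q ≤ p, then (q, J + 1) is an optimal split, P g ≤ P e gives the claim at q, and
  -- the absence of violations before p carries it from q to p.
  bound : ∀ {dD dC p p′ Γ Q acc} (r : Run d a c b N M dD dC p p′ Γ Q acc) → Valid (P e) r →
          drop Γ g ≡ acc → ∀ {J n} → Γ ≡ p + (suc J + n) →
          (∀ {q} → q < p → at g (q + suc J) ≤∞ at d (suc q)) →
          (∀ {t} → t < n → at d (suc p) ≤∞ at g (suc (p + suc J + t))) →
          P g (p + suc J) ℤ.≤ P d p ℤ.+ P a (suc J)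
  bound {p = p} {Γ = Γ} {Q} r V dr {J} {n} Γ≡ nv low = result (at-fin a J<)
    where
    w≤ : suc J + n ≤ length a
    w≤ = ℕₚ.+-cancelˡ-≤ p _ (length a) (subst (_≤ p + length a) Γ≡ (Γ≤p+s N≡ r))
    J< : J < length a
    J< = ℕₚ.≤-trans (ℕₚ.m≤m+n (suc J) n) w≤
    p+J≤N : p + suc J ≤ N
    p+J≤N = ℕₚ.≤-trans (ℕₚ.+-monoʳ-≤ p (ℕₚ.m≤m+n (suc J) n)) (subst (_≤ N) Γ≡ (Γ≤N r))
    shift : ∀ q t → q + suc J + t ≡ q + t + suc J
    shift q t = trans (ℕₚ.+-assoc q (suc J) t) (trans (cong (q +_) (ℕₚ.+-comm (suc J) t)) (sym (ℕₚ.+-assoc q t (suc J))))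
    result : ∃[ α ] at a (suc J) ≡ fin α × P a (suc J) ≡ P a J ℤ.+ α → P g (p + suc J) ℤ.≤ P d p ℤ.+ P a (suc J)
    result (α , ae , _) with split-at d sd α
    ... | q , q≤ , dq , dq′ with ℕₚ.<-≤-connex p q
    ... | inj₁ p<q = lin₂ (slack′ mg sd sa sc N≡ r V Γ≡
            (≤∞-trans (at-anti a sa (s≤s (ℕₚ.≤-trans (ℕₚ.n≤1+n J) (ℕₚ.m≤m+n (suc J) n))))
              (≤∞-trans α≤ (sd p))))
          (P-mono a g n {suc J} {p + suc J} w≤ λ {t} t<n →
            ≤∞-trans (at-anti a sa (ℕₚ.m≤n⇒m≤1+n (ℕₚ.m≤m+n (suc J) t))) (≤∞-trans α≤ (low t<n)))
          (trans (cong (λ z → (((P d p ℤ.+ P a (suc J + n)) ℤ.- Q) ℤ.+ ((P a (suc J) ℤ.+ z) ℤ.- (P a (suc J + n) ℤ.+ P g (p + suc J)))))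
                   (trans (cong (P g) (trans (ℕₚ.+-assoc p (suc J) n) (sym Γ≡))) (Pg≡Q r dr)))
                 (arith (P d p) (P a (suc J + n)) Q (P a (suc J)) (P g (p + suc J))))
      where
      α≤ : at a (suc J) ≤∞ at d (suc p)
      α≤ = ≤∞-trans (≤∞-reflexive ae) (≤∞-trans dq (at-anti d sd p<q))
      arith : ∀ x y Q z u → ((x ℤ.+ y) ℤ.- Q) ℤ.+ ((z ℤ.+ Q) ℤ.- (y ℤ.+ u)) ≡ (x ℤ.+ z) ℤ.- u
      arith = solve-∀
    ... | inj₂ q≤p with ℕₚ.m≤n⇒∃[o]m+o≡n q≤p
    ... | n′ , refl = subst (λ k → P g k ℤ.≤ P d (q + n′) ℤ.+ P a (suc J)) (shift q n′)
          (lin₂ (P-mono g d n′ {q + suc J} {q} (subst (_≤ length g) (sym (shift q n′)) (subst (q + n′ + suc J ≤_) (sym length-g) p+J≤N))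
              -- `nv` bounds the entry of g one index earlier; sortedness closes the gap.
              λ {t} t<n → ≤∞-trans (subst (λ k → at g (suc (q + suc J + t)) ≤∞ at g k) (shift q t) (sorted _))
                            (nv (ℕₚ.+-monoʳ-< q t<n)))
            at-q (arith (P g (q + suc J + n′)) (P d q) (P g (q + suc J)) (P d (q + n′)) (P a (suc J))))
      where
      arith : ∀ x y z u α → ((z ℤ.+ u) ℤ.- (x ℤ.+ y)) ℤ.+ ((y ℤ.+ α) ℤ.- z) ≡ (u ℤ.+ α) ℤ.- x
      arith = solve-∀
      q+J≤ : q + suc J ≤ N
      q+J≤ = ℕₚ.≤-trans (ℕₚ.+-monoˡ-≤ (suc J) (ℕₚ.m≤m+n q n′)) p+J≤N
      at-q : P g (q + suc J) ℤ.≤ P d q ℤ.+ P a (suc J)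
      at-q with Merged.some-split mg (subst (q + suc J ≤_) N≡ q+J≤)
      ... | p₁ , J₁ , eq , p₁≤ , J₁≤ , s = ℤₚ.≤-trans (Pg≤Pe q+J≤) (ℤₚ.≤-trans (ℤₚ.≤-reflexive s)
            (split-opt d a sd sa eq p₁≤ J₁≤ q≤ J<
              (≤∞-trans (sa (suc J)) (≤∞-trans (≤∞-reflexive ae) dq))
              (≤∞-trans (<∞⇒≤∞ dq′) (≤∞-reflexive (sym ae)))))

  Witness : ℕ → Set
  Witness J = ∃[ p ] p ≤ length d × (∀ {q} → q < p → at g (q + J) ≤∞ at d (suc q))
                × P g (p + J) ℤ.≤ P d p ℤ.+ P a J

  -- Serves both fields of `Crit`: J = s + 1 can only end in the first alternative, J ≤ s only in
  -- the second.
  Outcome : ℕ → Set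
  Outcome J = (length a < J × Dominated g d J N) ⊎ (J ≤ length a × Witness J)

  -- Walking back from the stopping state to the start, Γ - p is first below J, and the
  -- witness for J is found at the step where it reaches J.
  down : ∀ {J dD dC p p′ Γ Q acc} (r : Run d a c b N M dD dC p p′ Γ Q acc) → Valid (P e) r →
         drop Γ g ≡ acc → Γ < p + suc J → Dominated g d (suc J) Γ → Outcome (suc J)
  down start V dr h nv = inj₁ (ℕₚ.+-cancelˡ-< (length d) (length a) _ (subst (_< length d + _) N≡ h) , nv)
  down (rejD v r eq o x) V dr h nv = down r V dr (ℕₚ.m<n⇒m<1+n h) nv
  down {J} (accD {p = p} {Γ = Γ} v r eq o x) V dr h nv with drop-suc g dr
  ... | dr′ , ge = down r (proj₂ V) dr′ (s≤s h) nv′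
    where
    nv′ : Dominated g d (suc J) (suc Γ)
    nv′ q k with ℕₚ.m≤n⇒m<n∨m≡n k
    ... | inj₁ (s≤s k′) = nv q k′
    ... | inj₂ k′ = ≤∞-trans (≤∞-reflexive (trans (cong (at g) k′) (trans ge (sym eq))))
          (at-anti d sd (s≤s (ℕₚ.+-cancelʳ-≤ (suc J) q p (ℕₚ.≤-trans (ℕₚ.≤-reflexive k′) h))))
  down (rejC v r eq o x) V dr h nv = down r V dr h nv
  down {J} (accC {p = p} {Γ = Γ} v r eq o x) V dr h nv with drop-suc g dr | ℕₚ.m≤n⇒m<n∨m≡n h
  ... | dr′ , ge | inj₁ h′ = down r (proj₂ V) dr′ h′ nv′
    where
    nv′ : Dominated g d (suc J) (suc Γ)
    nv′ q k with ℕₚ.m≤n⇒m<n∨m≡n k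
    ... | inj₁ (s≤s k′) = nv q k′
    ... | inj₂ k′ = ≤∞-trans (≤∞-reflexive (trans (cong (at g) k′) ge))
          (≤∞-trans (<∞⇒≤∞ o) (at-anti d sd (ℕₚ.+-cancelʳ-< (suc J) q p (subst (_< p + suc J) (sym k′) h′))))
  ... | dr′ , ge | inj₂ h′ = inj₂ (ℕₚ.+-cancelˡ-≤ p _ _ (subst (_≤ p + length a) h′ (Γ≤p+s N≡ r)) , p , p≤length r ,
        nv′ , bound r (proj₂ V) dr′ {J} {0} (trans h′ (cong (p +_) (sym (ℕₚ.+-identityʳ (suc J))))) nv′ λ ())
    where
    nv′ : ∀ {q} → q < p → at g (q + suc J) ≤∞ at d (suc q)
    nv′ {q} q<p = nv q (ℕₚ.≤-pred (subst (q + suc J <_) (sym h′) (ℕₚ.+-monoˡ-< (suc J) q<p)))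

  -- If Γ₀ < p₀ + J + 1, the walk back starts from domination on the block, whose values are at most
  -- `top` and so at most every unprocessed entry of d. Otherwise p₀ itself is the witness, because
  -- the block is at least f and so at least d_{p₀+1}.
  outcome : ∀ J → Outcome (suc J)
  outcome J with ℕₚ.<-≤-connex Γ₀ (p₀ + suc J)
  ... | inj₁ h = down r₀ V₀ drop≡ h (λ q k → capped q k (ℕₚ.+-cancelʳ-< (suc J) q p₀ (ℕₚ.≤-<-trans k h)))
    where
    capped : ∀ q → q + suc J ≤ Γ₀ → q < p₀ → at g (q + suc J) ≤∞ at d (suc q)
    capped q k q< = ≤∞-trans (subst (λ z → at g z ≤∞ fin top) (sym (ℕₚ.+-suc q J)) (upper (subst (_≤ Γ₀) (ℕₚ.+-suc q J) k)))
      (≤∞-trans (fin≤ (cap cap₀)) (≤∞-trans v₀≤d (at-anti d sd q<)))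
  ... | inj₂ h with ℕₚ.m≤n⇒∃[o]m+o≡n h
  ... | n , eq = inj₂ (J≤ , p₀ , p≤length r₀ , nv , bound r₀ V₀ drop≡ {J} {n} Γ≡ nv low)
    where
    Γ≡ : Γ₀ ≡ p₀ + (suc J + n)
    Γ≡ = trans (sym eq) (ℕₚ.+-assoc p₀ (suc J) n)
    J≤ : suc J ≤ length a
    J≤ = ℕₚ.+-cancelˡ-≤ p₀ _ _ (ℕₚ.≤-trans h (Γ≤p+s N≡ r₀))
    nv : ∀ {q} → q < p₀ → at g (q + suc J) ≤∞ at d (suc q)
    nv {q} q< = ≤∞-trans (subst (λ z → at g z ≤∞ fin top) (sym (ℕₚ.+-suc q J))
        (upper (subst (_≤ Γ₀) (ℕₚ.+-suc q J) (ℕₚ.≤-trans (ℕₚ.+-monoˡ-≤ (suc J) (ℕₚ.<⇒≤ q<)) h))))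
      (≤∞-trans (fin≤ (cap cap₀)) (≤∞-trans v₀≤d (at-anti d sd q<)))
    d≤f : at d (suc p₀) ≤∞ fin f
    d≤f with p₀ ℕₚ.<? length d
    ... | no ¬h = subst (_≤∞ fin f) (sym (at-out d (ℕₚ.≮⇒≥ ¬h))) -∞≤
    ... | yes p< with at-fin d p<
    ... | x , xe , _ = subst (_≤∞ fin f) (sym xe) (fin≤ (floor (above (≤∞-reflexive (sym xe)))))
    low : ∀ {t} → t < n → at d (suc p₀) ≤∞ at g (suc (p₀ + suc J + t))
    low t<n = ≤∞-trans d≤f (lower (subst (_ <_) eq (ℕₚ.+-monoʳ-< (p₀ + suc J) t<n)))

  crit : Crit g d a
  crit = record { below = blw (outcome (length a)) ; witness = λ { {suc J} _ J≤ → wit J≤ (outcome J) } }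
    where
    blw : Outcome (suc (length a)) → Dominated g d (suc (length a)) (length g)
    blw (inj₁ (_ , D)) = subst (Dominated g d (suc (length a))) (sym length-g) D
    blw (inj₂ (h , _)) = ⊥-elim (ℕₚ.1+n≰n h)
    wit : ∀ {J} → J ≤ length a → Outcome J → Witness J
    wit J≤ (inj₁ (h , _)) = ⊥-elim (ℕₚ.<⇒≱ h J≤)
    wit J≤ (inj₂ (_ , w)) = w

-- The stopping state and sufficiency

Above : (d c : List ℤ) (p p′ Γ : ℕ) (Q : ℤ) → Set
Above d c p p′ Γ Q = ∀ {x} → fin x ≤∞ at d (suc p) ⊎ fin x ≤∞ at c (suc p′) → x ℤ.* ℤ.+ Γ ℤ.< Q

-- A state whose Γ unassigned entries of g, of total Q, can be given balanced values lying
-- strictly above all processed entries (up to rounding) and below all unprocessed ones.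
record Stop (d a c b : List ℤ) (N : ℕ) (M : ℤ) (f f′ : ℕ → ℤ) : Set where
  field
    {dD dC} : List Decision
    {p p′ Γ} : ℕ
    {Q}      : ℤ
    {acc}    : List ℤ
    run      : Run d a c b N M dD dC p p′ Γ Q acc
    validᵈ   : Valid f run
    validᶜ   : Valid f′ run
    positive : 1 ≤ Γ
    above    : Above d c p p′ Γ Q
    bound    : ℤ
    Q≤       : Q ℤ.≤ bound ℤ.* ℤ.+ Γ
    ≤d       : fin bound ≤∞ at d p
    ≤c       : fin bound ≤∞ at c p′

scale-≤ : ∀ {x v Q} Γ → x ℤ.≤ v → v ℤ.* ℤ.+ Γ ℤ.< Q → x ℤ.* ℤ.+ Γ ℤ.< Q
scale-≤ Γ x≤v h = ℤₚ.≤-<-trans (ℤₚ.*-monoʳ-≤-nonNeg (ℤ.+ Γ) x≤v) h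

accept-< : ∀ {x v Q} Γ → x ℤ.≤ v → v ℤ.* ℤ.+ suc Γ ℤ.< Q → x ℤ.* ℤ.+ Γ ℤ.< Q ℤ.- v
accept-< {x} {v} {Q} Γ x≤v h = scale-≤ Γ x≤v (subst₂ ℤ._<_ (eq v (ℤ.+ Γ)) refl (ℤₚ.+-monoˡ-< (ℤ.- v) h))
  where
  eq : ∀ v n → v ℤ.* (1ℤ ℤ.+ n) ℤ.+ ℤ.- v ≡ v ℤ.* n
  eq = solve-∀

-- The free block never becomes empty: Γ = 0 would leave Q - v > 0, whereas validity bounds it by an
-- empty prefix sum.
accept-positive : ∀ {v Q} Γ → v ℤ.* ℤ.+ suc Γ ℤ.< Q → (Γ ≡ 0 → Q ℤ.- v ℤ.≤ 0ℤ) → 1 ≤ Γ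
accept-positive (suc Γ) _ _ = s≤s z≤n
accept-positive {v} {Q} zero h k = ⊥-elim (ℤₚ.<⇒≱ (subst (ℤ._< Q ℤ.- v) (ℤₚ.*-zeroʳ v) (accept-< {v} {v} zero ℤₚ.≤-refl h)) (k refl))

module _ {d a c b : List ℤ} {N : ℕ} {M : ℤ} (sd : Sorted d) (sc : Sorted c) {f f′ : ℕ → ℤ}
         (f0 : f 0 ≡ 0ℤ) (1≤N : 1 ≤ N) where
  private
    processedD : ∀ {dD dC p p′ Γ Q acc v x} → Run d a c b N M dD dC (suc p) p′ Γ Q acc → at d (suc p) ≡ fin v →
                 fin x ≤∞ at d (suc p) ⊎ fin x ≤∞ at c (suc p′) → x ℤ.≤ v
    processedD r e (inj₁ h) = fin≤⁻ (subst (_ ≤∞_) e h)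
    processedD r e (inj₂ h) = fin≤⁻ (subst (_ ≤∞_) e (≤∞-trans h (<∞⇒≤∞ (d<c sd (swap r)))))

    processedC : ∀ {dD dC p p′ Γ Q acc v x} → Run d a c b N M dD dC p (suc p′) Γ Q acc → at c (suc p′) ≡ fin v →
                 fin x ≤∞ at d (suc p) ⊎ fin x ≤∞ at c (suc p′) → x ℤ.≤ v
    processedC r e (inj₁ h) = fin≤⁻ (subst (_ ≤∞_) e (≤∞-trans h (<∞⇒≤∞ (d<c sc r))))
    processedC r e (inj₂ h) = fin≤⁻ (subst (_ ≤∞_) e h)

    at-zero : ∀ {q} Γ → Γ ≡ 0 → q ℤ.≤ f Γ → q ℤ.≤ 0ℤ
    at-zero Γ refl h = subst (_ ℤ.≤_) f0 h

  -- As long as no v with Q ≤ vΓ is met, the mean stays above all processed entries: on acceptance,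
  -- Q > v(Γ + 1) gives Q - v > vΓ.
  find : ∀ {dD dC p p′ Γ Q acc} (r : Run d a c b N M dD dC p p′ Γ Q acc) → Valid f r → Valid f′ r →
         (1 ≤ Γ × Above d c p p′ Γ Q) ⊎ Stop d a c b N M f f′
  find start V V′ = inj₁ (1≤N , λ
    { {x} (inj₁ h) → ⊥-elim (absurd (subst (fin x ≤∞_) (at-out d ℕₚ.≤-refl) h))
    ; {x} (inj₂ h) → ⊥-elim (absurd (subst (fin x ≤∞_) (at-out c ℕₚ.≤-refl) h)) })
    where
    absurd : ∀ {x} → ¬ (fin x ≤∞ -∞)
    absurd ()
  find (rejD {Γ = Γ} {Q} v r e o x) V V′ with find r V V′
  ... | inj₂ s = inj₂ s
  ... | inj₁ (pos , ab) with Q ℤ.≤? v ℤ.* ℤ.+ Γ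
  ... | yes h = inj₂ (record { run = r ; validᵈ = V ; validᶜ = V′ ; positive = pos ; above = ab
                             ; bound = v ; Q≤ = h ; ≤d = ≤∞-reflexive (sym e) ; ≤c = <∞⇒≤∞ o })
  ... | no h = inj₁ (pos , λ k → scale-≤ Γ (processedD r e k) (ℤₚ.≰⇒> h))
  find (accD {Γ = Γ} {Q} v r e o x) (u , V) (_ , V′) with find r V V′
  ... | inj₂ s = inj₂ s
  ... | inj₁ (pos , ab) with Q ℤ.≤? v ℤ.* ℤ.+ suc Γ
  ... | yes h = inj₂ (record { run = r ; validᵈ = V ; validᶜ = V′ ; positive = pos ; above = ab
                             ; bound = v ; Q≤ = h ; ≤d = ≤∞-reflexive (sym e) ; ≤c = <∞⇒≤∞ o })
  ... | no h = inj₁ (accept-positive Γ (ℤₚ.≰⇒> h) (λ z → at-zero Γ z u) ,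
                     λ k → accept-< Γ (processedD r e k) (ℤₚ.≰⇒> h))
  find (rejC {Γ = Γ} {Q} v r e o x) V V′ with find r V V′
  ... | inj₂ s = inj₂ s
  ... | inj₁ (pos , ab) with Q ℤ.≤? v ℤ.* ℤ.+ Γ
  ... | yes h = inj₂ (record { run = r ; validᵈ = V ; validᶜ = V′ ; positive = pos ; above = ab
                             ; bound = v ; Q≤ = h ; ≤d = <∞⇒≤∞ o ; ≤c = ≤∞-reflexive (sym e) })
  ... | no h = inj₁ (pos , λ k → scale-≤ Γ (processedC r e k) (ℤₚ.≰⇒> h))
  find (accC {Γ = Γ} {Q} v r e o x) (u , V) (_ , V′) with find r V V′
  ... | inj₂ s = inj₂ s
  ... | inj₁ (pos , ab) with Q ℤ.≤? v ℤ.* ℤ.+ suc Γ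
  ... | yes h = inj₂ (record { run = r ; validᵈ = V ; validᶜ = V′ ; positive = pos ; above = ab
                             ; bound = v ; Q≤ = h ; ≤d = <∞⇒≤∞ o ; ≤c = ≤∞-reflexive (sym e) })
  ... | no h = inj₁ (accept-positive Γ (ℤₚ.≰⇒> h) (λ z → at-zero Γ z u) ,
                     λ k → accept-< Γ (processedC r e k) (ℤₚ.≰⇒> h))

  stop : ∀ {dD dC Γ Q acc} (r : Run d a c b N M dD dC 0 0 Γ Q acc) → Valid f r → Valid f′ r →
         Stop d a c b N M f f′
  stop {Γ = Γ} {Q} r V V′ with find r V V′
  ... | inj₂ s = s
  ... | inj₁ (pos , ab) = record { run = r ; validᵈ = V ; validᶜ = V′ ; positive = pos ; above = ab
                                 -- Nothing is left to process, so the next entry on either side is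
                                 -- +∞ and any upper bound for the mean will do.
                                 ; bound = ℤ.+ ℤ.∣ Q ∣ ; Q≤ = big Γ pos Q ; ≤d = ≤+∞ ; ≤c = ≤+∞ }
    where
    ≤∣∣ : ∀ Q → Q ℤ.≤ ℤ.+ ℤ.∣ Q ∣
    ≤∣∣ (ℤ.+ n)    = ℤₚ.≤-refl
    ≤∣∣ ℤ.-[1+ n ] = ℤ.-≤+
    big : ∀ Γ → 1 ≤ Γ → ∀ Q → Q ℤ.≤ ℤ.+ ℤ.∣ Q ∣ ℤ.* ℤ.+ Γ
    big (suc Γ) _ Q = ℤₚ.≤-trans (≤∣∣ Q) (ℤₚ.≤-trans (ℤ.+≤+ (ℕₚ.m≤m*n ℤ.∣ Q ∣ (suc Γ)))
                        (ℤₚ.≤-reflexive (ℤₚ.pos-* ℤ.∣ Q ∣ (suc Γ))))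

sufficiency : ∀ {d a c b e e′ N M} → Merged d a e → Merged c b e′ →
  Sorted d → Sorted a → Sorted c → Sorted b →
  N ≡ length d + length a → N ≡ length c + length b → 1 ≤ N →
  M ≡ sumℤ d ℤ.+ sumℤ a → M ≡ sumℤ c ℤ.+ sumℤ b →
  ∀ {dD dC Γ Q acc} (r : Run d a c b N M dD dC 0 0 Γ Q acc) →
  RunCond e r → RunCond e′ (swap r) →
  ∃[ g ] length g ≡ N × Sorted g × sumℤ g ≡ M × Crit g d a × Crit g c b
sufficiency {d} {a} {c} {b} {e} {e′} {N} {M} mg mg′ sd sa sc sb N≡ N≡′ 1≤N M≡ M≡′ r C C′ =
  let g , bal = balance Γ Q acc positive (acc-sorted sd sc run) (λ h → above (hd (acc-head sd sc run) h))
      module D = Verify mg sd sa sc N≡ run validᵈ bal (λ h → above (inj₁ h)) Q≤ ≤d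
      module C = Verify mg′ sc sb sd N≡′ (swap run) (Valid-swap⁻ run validᶜ) bal (λ h → above (inj₂ h)) Q≤ ≤c
  in g , D.length-g , Balanced.sorted bal , trans (Balanced.sum≡ bal) (Q+sum run) , D.crit , C.crit
  where
  total : ∀ {d a e} → Merged d a e → N ≡ length d + length a → M ≡ sumℤ d ℤ.+ sumℤ a → M ℤ.≤ P e N
  total {d} {a} {e} mg refl refl = subst (ℤ._≤ P e (length d + length a)) (cong₂ ℤ._+_ (P-all d) (P-all a))
    (Merged.all-splits mg ℕₚ.≤-refl ℕₚ.≤-refl)
  s : Stop d a c b N M (P e) (P e′)
  s = stop sd sc refl 1≤N r (RunCond⇒Valid mg sd sa sc N≡ (total mg N≡ M≡) r C)
        (Valid-swap r (RunCond⇒Valid mg′ sc sb sd N≡′ (total mg′ N≡′ M≡′) (swap r) C′))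
  open Stop s
  hd : at acc 1 ≤∞ at d (suc p) ⊎ at acc 1 ≤∞ at c (suc p′) → ∀ {x} → fin x ≤∞ at acc 1 →
       fin x ≤∞ at d (suc p) ⊎ fin x ≤∞ at c (suc p′)
  hd (inj₁ k) h = inj₁ (≤∞-trans h k)
  hd (inj₂ k) h = inj₂ (≤∞-trans h k)

-- The search for h_J

<ᵇ-true : ∀ {x y} → (x <ᵇ y) ≡ true → x ℤ.< y
<ᵇ-true {x} {y} e with y ℤ.≤ᵇ x in eq
<ᵇ-true {x} {y} () | true
... | false = ℤₚ.≰⇒> λ h → subst T eq (ℤₚ.≤⇒≤ᵇ h)

<ᵇ-false : ∀ {x y} → (x <ᵇ y) ≡ false → y ℤ.≤ x
<ᵇ-false {x} {y} e with y ℤ.≤ᵇ x in eq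
... | true = ℤₚ.≤ᵇ⇒≤ (subst T (sym eq) tt)
<ᵇ-false {x} {y} () | false

<ᵇ⇐< : ∀ {x y} → x ℤ.< y → (x <ᵇ y) ≡ true
<ᵇ⇐< {x} {y} h with x <ᵇ y in eq
... | true  = refl
... | false = ⊥-elim (ℤₚ.<⇒≱ h (<ᵇ-false eq))

<ᵇ⇐≥ : ∀ {x y} → y ℤ.≤ x → (x <ᵇ y) ≡ false
<ᵇ⇐≥ {x} {y} h with x <ᵇ y in eq
... | false = refl
... | true  = ⊥-elim (ℤₚ.<⇒≱ (<ᵇ-true eq) h)

≤∞ᵇ-true : ∀ x y → (x ≤∞ᵇ y) ≡ true → x ≤∞ y
≤∞ᵇ-true -∞      y       _ = -∞≤
≤∞ᵇ-true (fin x) +∞      _ = ≤+∞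
≤∞ᵇ-true +∞      +∞      _ = ≤+∞
≤∞ᵇ-true (fin x) (fin y) e = fin≤ (ℤₚ.≤ᵇ⇒≤ (subst T (sym e) tt))
≤∞ᵇ-true (fin x) -∞      ()
≤∞ᵇ-true +∞      -∞      ()
≤∞ᵇ-true +∞      (fin x) ()

≤∞ᵇ-false : ∀ x y → (x ≤∞ᵇ y) ≡ false → y <∞ x
≤∞ᵇ-false (fin x) (fin y) e h         = subst T e (ℤₚ.≤⇒≤ᵇ (fin≤⁻ h))
≤∞ᵇ-false (fin x) -∞      e ()
≤∞ᵇ-false +∞      -∞      e ()
≤∞ᵇ-false +∞      (fin x) e ()
≤∞ᵇ-false -∞      y       ()
≤∞ᵇ-false (fin x) +∞      ()
≤∞ᵇ-false +∞      +∞      ()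

violates : (g d : List ℤ) → ℕ → ℕ → Bool
violates g d j i = at∞ d ((ℤ.+ i) ℤ.- (ℤ.+ j) ℤ.+ 1ℤ) <∞ᵇ at∞ g (ℤ.+ i)

search : (g d : List ℤ) (j i r : ℕ) → ℕ
search g d j i zero    = i
search g d j i (suc r) = if violates g d j i then i else search g d j (suc i) r

-- The left-hand side of search-go is the local search function of hIdx; it is found by
-- unification in hIdx≡, whose with makes its arguments variables.
mutual
  search-go : ∀ g d a j i r → _ ≡ search g d j i r
  hIdx≡ : ∀ g d a j → hIdx g d a j ≡ search g d j 1 (length d + length a)
  hIdx≡ g d a j with 1 | length d + length a
  ... | i | r = search-go g d a j i r
  search-go g d a j i zero = refl
  search-go g d a j i (suc r) with violates g d j i
  ... | true  = refl
  ... | false = search-go g d a j (suc i) r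

search-spec : ∀ g d j i r {l} → i ≤ l → l < i + r → violates g d j l ≡ true →
              search g d j i r ≤ l × violates g d j (search g d j i r) ≡ true ×
              (∀ {l′} → i ≤ l′ → l′ < search g d j i r → violates g d j l′ ≡ false)
search-spec g d j i zero i≤l l< v = ⊥-elim (ℕₚ.<⇒≱ (subst (_ <_) (ℕₚ.+-identityʳ i) l<) i≤l)
search-spec g d j i (suc r) {l} i≤l l< v with violates g d j i in eq
... | true = i≤l , eq , λ h k → ⊥-elim (ℕₚ.<⇒≱ k h)
... | false with ℕₚ.m≤n⇒m<n∨m≡n i≤l
... | inj₂ refl with trans (sym v) eq
... | ()
search-spec g d j i (suc r) {l} i≤l l< v | false | inj₁ i<l
  with search-spec g d j (suc i) r i<l (subst (l <_) (ℕₚ.+-suc i r) l<) v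
... | b , vt , mn = b , vt , λ {l′} h k → lower h k
  where
  lower : ∀ {l′} → i ≤ l′ → l′ < search g d j (suc i) r → violates g d j l′ ≡ false
  lower h k with ℕₚ.m≤n⇒m<n∨m≡n h
  ... | inj₁ h′   = mn h′ k
  ... | inj₂ refl = eq

at∞-shift : ∀ d p J → at∞ d ((ℤ.+ (p + J)) ℤ.- (ℤ.+ J) ℤ.+ 1ℤ) ≡ at d (suc p)
at∞-shift d p J = trans (cong (at∞ d) (eq (ℤ.+ p) (ℤ.+ J))) (at∞≡at d (suc p))
  where
  eq : ∀ p J → (p ℤ.+ J) ℤ.- J ℤ.+ 1ℤ ≡ 1ℤ ℤ.+ p
  eq = solve-∀

at∞-early : ∀ d l k → at∞ d ((ℤ.+ l) ℤ.- (ℤ.+ (suc l + k)) ℤ.+ 1ℤ) ≡ +∞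
at∞-early d l k = trans (cong (at∞ d) (eq (ℤ.+ l) (ℤ.+ k))) (neg k)
  where
  eq : ∀ l k → l ℤ.- (1ℤ ℤ.+ l ℤ.+ k) ℤ.+ 1ℤ ≡ ℤ.- k
  eq = solve-∀
  neg : ∀ k → at∞ d (ℤ.- (ℤ.+ k)) ≡ +∞
  neg zero    = refl
  neg (suc k) = refl

not-true : ∀ {x} → not x ≡ true → x ≡ false
not-true {false} _ = refl

not-false : ∀ {x} → not x ≡ false → x ≡ true
not-false {true} _ = refl

violates⇒ : ∀ g d p J → violates g d J (p + J) ≡ true → at d (suc p) <∞ at g (p + J)
violates⇒ g d p J h = subst₂ _<∞_ (at∞-shift d p J) (at∞≡at g (p + J)) (≤∞ᵇ-false (at∞ g (ℤ.+ (p + J))) _ (not-true h))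

violates⇐ : ∀ g d p J → at d (suc p) <∞ at g (p + J) → violates g d J (p + J) ≡ true
violates⇐ g d p J h with violates g d J (p + J) in eq
... | true  = refl
... | false = ⊥-elim (h (subst₂ _≤∞_ (at∞≡at g (p + J)) (at∞-shift d p J) (≤∞ᵇ-true _ _ (not-false eq))))

¬violates⇒ : ∀ g d p J → violates g d J (p + J) ≡ false → at g (p + J) ≤∞ at d (suc p)
¬violates⇒ g d p J h = subst₂ _≤∞_ (at∞≡at g (p + J)) (at∞-shift d p J) (≤∞ᵇ-true _ _ (not-false h))

-- For l < j the index l - j + 1 is at most 0, where d is +∞. Hence h_j can be written as p + j.
violates-late : ∀ g d j l → violates g d j l ≡ true → j ≤ l
violates-late g d j l h = ℕₚ.≮⇒≥ λ l<j → early l<j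
  where
  early : l < j → ⊥
  early l<j with ℕₚ.m≤n⇒∃[o]m+o≡n l<j
  ... | k , refl = ≤∞ᵇ-false (at∞ g (ℤ.+ l)) _ (not-true h)
                     (subst (at∞ g (ℤ.+ l) ≤∞_) (sym (at∞-early d l k)) ≤+∞)

module _ {g d a : List ℤ} (len : length g ≡ length d + length a) where
  -- The search succeeds within its range: d is -∞ just beyond its end, below the finite entry of g
  -- at `length d + J`.
  hIdx-spec : ∀ {J} → 1 ≤ J → J ≤ length a →
    ∃[ p ] hIdx g d a J ≡ p + J × p ≤ length d × at d (suc p) <∞ at g (p + J)
      × (∀ {p′} → p′ < p → at g (p′ + J) ≤∞ at d (suc p′))
  hIdx-spec {J@(suc J-1)} 1≤J J≤ with search-spec g d J 1 (length d + length a) {length d + J}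
      (ℕₚ.≤-trans 1≤J (ℕₚ.m≤n+m J (length d))) (s≤s (ℕₚ.+-monoʳ-≤ (length d) J≤))
      (violates⇐ g d (length d) J last)
    where
    last : at d (suc (length d)) <∞ at g (length d + J)
    last h with at-fin g {length d + J-1} (subst (_≤ length g) (ℕₚ.+-suc (length d) J-1)
                  (subst (length d + J ≤_) (sym len) (ℕₚ.+-monoʳ-≤ (length d) J≤)))
    ... | u , e , _ with subst₂ _≤∞_ (trans (cong (at g) (ℕₚ.+-suc (length d) J-1)) e) (at-out d ℕₚ.≤-refl) h
    ... | ()
  ... | h≤ , v , mn with ℕₚ.m≤n⇒∃[o]m+o≡n (violates-late g d J _ v)
  ... | p , eq = p , trans (hIdx≡ g d a J) eq′ ,
        ℕₚ.+-cancelʳ-≤ J p (length d) (subst (_≤ length d + J) eq′ h≤) ,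
        violates⇒ g d p J (subst (λ z → violates g d J z ≡ true) eq′ v) ,
        λ {p′} p′<p → ¬violates⇒ g d p′ J (mn (ℕₚ.≤-trans 1≤J (ℕₚ.m≤n+m J p′))
          (subst (p′ + J <_) (sym eq′) (ℕₚ.+-monoˡ-< J p′<p)))
    where
    eq′ : search g d J 1 (length d + length a) ≡ p + J
    eq′ = trans (sym eq) (ℕₚ.+-comm J p)

  GMaj⇒GM : GMaj g d a → GM g d a
  GMaj⇒GM gm = record { below = below ; first = first }
    where
    open GMaj gm
    below : Dominated g d (suc (length a)) (length g)
    below p h = subst₂ _≤∞_ (trans (at∞≡at g (suc p + length a)) (cong (at g) (sym (ℕₚ.+-suc p (length a)))))
      (at∞≡at d (suc p)) (cond-d (suc p) (s≤s z≤n)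
        (ℕₚ.+-cancelʳ-≤ (length a) (suc p) (length d) (subst₂ _≤_ (ℕₚ.+-suc p (length a)) len h)))
    first : ∀ {J} → 1 ≤ J → J ≤ length a →
            ∃[ p ] p ≤ length d × at d (suc p) <∞ at g (p + J)
              × (∀ {p′} → p′ < p → at g (p′ + J) ≤∞ at d (suc p′))
              × P g (p + J) ℤ.≤ P d p ℤ.+ P a J
    first {J} 1≤J J≤ with hIdx-spec 1≤J J≤ | cond-h J 1≤J J≤
    ... | p , eq , p≤ , v , mn | ch = p , p≤ , v , mn ,
          lin (subst (λ k → P g k ℤ.- P d (k ∸ J) ℤ.≤ P a J) eq ch)
              (trans (cong (λ k → P a J ℤ.- (P g (p + J) ℤ.- P d k)) (ℕₚ.m+n∸n≡m p J))
                     (arith (P a J) (P g (p + J)) (P d p)))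
      where
      arith : ∀ x y z → x ℤ.- (y ℤ.- z) ≡ (z ℤ.+ x) ℤ.- y
      arith = solve-∀

  Crit⇒GMaj : Sorted g → sumℤ g ≡ sumℤ d ℤ.+ sumℤ a → Crit g d a → GMaj g d a
  Crit⇒GMaj sg sum cr = record { cond-d = cd ; cond-h = ch ; cond-sum = sum }
    where
    open Crit cr
    cd : ∀ i → 1 ≤ i → i ≤ length d → at∞ g (ℤ.+ (i + length a)) ≤∞ at∞ d (ℤ.+ i)
    cd (suc p) _ i≤ = subst₂ _≤∞_ (sym (at∞≡at g (suc p + length a))) (sym (at∞≡at d (suc p)))
      (subst (λ k → at g k ≤∞ at d (suc p)) (ℕₚ.+-suc p (length a))
        (below p (subst₂ _≤_ (sym (ℕₚ.+-suc p (length a))) (sym len) (ℕₚ.+-monoˡ-≤ (length a) i≤))))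
    ch : ∀ j → 1 ≤ j → j ≤ length a → sumTo g (hIdx g d a j) ℤ.- sumTo d (hIdx g d a j ∸ j) ℤ.≤ sumTo a j
    ch J 1≤J J≤ with hIdx-spec 1≤J J≤ | witness 1≤J J≤
    -- No violation precedes the witness, so h_J is not before it. From the witness to h_J each new
    -- entry of g is at most the preceding one, which an entry of d bounds, so the inequality
    -- persists.
    ... | p , eq , p≤ , v , mn | p₀ , p₀≤ , mn₀ , b₀ with ℕₚ.m≤n⇒∃[o]m+o≡n {p₀} {p} (ℕₚ.≮⇒≥ λ k → v (mn₀ k))
    ... | n , refl = subst (λ k → P g k ℤ.- P d (k ∸ J) ℤ.≤ P a J) (sym eq)
          (subst (λ k → P g (p₀ + n + J) ℤ.- P d k ℤ.≤ P a J) (sym (ℕₚ.m+n∸n≡m (p₀ + n) J))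
            (subst (λ k → P g k ℤ.- P d (p₀ + n) ℤ.≤ P a J) (shift n)
              (lin₂ (P-mono g d n {p₀ + J} {p₀} r λ {t} t<n →
                        ≤∞-trans (sg (p₀ + J + t)) (subst (λ k → at g k ≤∞ at d (suc (p₀ + t))) (sym (shift t)) (mn (ℕₚ.+-monoʳ-< p₀ t<n))))
                    b₀ (arith (P g (p₀ + J + n)) (P d p₀) (P g (p₀ + J)) (P d (p₀ + n)) (P a J)))))
      where
      shift : ∀ n → p₀ + J + n ≡ p₀ + n + J
      shift n = trans (ℕₚ.+-assoc p₀ J n) (trans (cong (p₀ +_) (ℕₚ.+-comm J n)) (sym (ℕₚ.+-assoc p₀ n J)))
      r : p₀ + J + n ≤ length g
      r = subst₂ _≤_ (sym (shift n)) (sym len) (ℕₚ.+-mono-≤ p≤ J≤)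
      arith : ∀ x y z u α → ((z ℤ.+ u) ℤ.- (x ℤ.+ y)) ℤ.+ ((y ℤ.+ α) ℤ.- z) ≡ α ℤ.- (x ℤ.- u)
      arith = solve-∀

-- The merged sequence e

enum : ℕ → List ℤ → List (ℕ × ℤ)
enum i []       = []
enum i (x ∷ xs) = (i , x) ∷ enum (suc i) xs

mutual
  enum-go : ∀ i xs → _ ≡ enum i xs
  indexed≡ : ∀ xs → indexed xs ≡ enum 1 xs
  indexed≡ xs with 1
  ... | i = enum-go i xs
  enum-go i []       = refl
  enum-go i (x ∷ xs) = cong ((i , x) ∷_) (enum-go (suc i) xs)

tags : Bool → ℕ → List ℤ → List Tag
tags t i xs = L.map (λ q → tag t (proj₁ q) (proj₂ q)) (enum i xs)

tagList≡ : ∀ t xs → tagList t xs ≡ tags t 1 xs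
tagList≡ t xs = cong (L.map _) (indexed≡ xs)

vals-tags : ∀ t i xs → valsOf (tags t i xs) ≡ xs
vals-tags t i []       = refl
vals-tags t i (x ∷ xs) = cong (x ∷_) (vals-tags t (suc i) xs)

at-head≥ : ∀ {y ys} → Sorted (y ∷ ys) → ∀ i → at (y ∷ ys) (suc i) ≤∞ fin y
at-head≥ {y} {ys} s i = at-anti (y ∷ ys) s {1} {suc i} (s≤s z≤n)

-- A split that leaves x out can trade its last entry of d for x, which is no smaller.
cons-right : ∀ {d a e x} → (∀ i → at d (suc i) ≤∞ fin x) → Merged d a e → Merged d (x ∷ a) (x ∷ e)
cons-right {d} {a} {e} {x} d≤x m = record { length≡ = len ; some-split = split ; all-splits = λ {p} {J} → splits p J }
  where
  open Merged m
  swap-+ : ∀ x y z → x ℤ.+ (y ℤ.+ z) ≡ y ℤ.+ (x ℤ.+ z)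
  swap-+ = solve-∀
  len : suc (length e) ≡ length d + suc (length a)
  len = trans (cong suc length≡) (sym (ℕₚ.+-suc (length d) (length a)))
  split : ∀ {i} → i ≤ length d + suc (length a) → ∃[ p ] ∃[ J ] p + J ≡ i × p ≤ length d ×
          J ≤ suc (length a) × P (x ∷ e) i ≡ P d p ℤ.+ P (x ∷ a) J
  split {zero}  _ = 0 , 0 , refl , z≤n , z≤n , refl
  split {suc i} h with some-split {i} (ℕₚ.≤-pred (subst (suc i ≤_) (ℕₚ.+-suc (length d) (length a)) h))
  ... | p , J , eq , p≤ , J≤ , f = p , suc J , trans (ℕₚ.+-suc p J) (cong suc eq) , p≤ , s≤s J≤ ,
        trans (cong (ℤ._+_ x) f) (swap-+ x (P d p) (P a J))
  splits : ∀ p J → p ≤ length d → J ≤ suc (length a) → P d p ℤ.+ P (x ∷ a) J ℤ.≤ P (x ∷ e) (p + J)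
  splits p (suc J) p≤ (s≤s J≤) = subst₂ ℤ._≤_ (swap-+ x (P d p) (P a J)) (cong (P (x ∷ e)) (sym (ℕₚ.+-suc p J)))
    (ℤₚ.+-monoʳ-≤ x (all-splits p≤ J≤))
  splits zero    zero _  _ = ℤₚ.≤-refl
  splits (suc p) zero p≤ _ = ℤₚ.≤-trans
    (ℤₚ.+-monoˡ-≤ 0ℤ (P-suc-≤ d {p} {x} p≤ (d≤x p)))
    (ℤₚ.≤-trans (ℤₚ.≤-reflexive (arith (P d p) x)) (ℤₚ.+-monoʳ-≤ x (all-splits (ℕₚ.<⇒≤ p≤) z≤n)))
    where
    arith : ∀ p x → (p ℤ.+ x) ℤ.+ 0ℤ ≡ x ℤ.+ (p ℤ.+ 0ℤ)
    arith = solve-∀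

cons-left : ∀ {d a e y} → (∀ i → at a (suc i) ≤∞ fin y) → Merged d a e → Merged (y ∷ d) a (y ∷ e)
cons-left {d} {a} {e} {y} a≤y m = record { length≡ = cong suc length≡ ; some-split = split ; all-splits = λ {p} {J} → splits p J }
  where
  open Merged m
  split : ∀ {i} → i ≤ suc (length d + length a) → ∃[ p ] ∃[ J ] p + J ≡ i × p ≤ suc (length d) ×
          J ≤ length a × P (y ∷ e) i ≡ P (y ∷ d) p ℤ.+ P a J
  split {zero}  _ = 0 , 0 , refl , z≤n , z≤n , refl
  split {suc i} (s≤s h) with some-split {i} h
  ... | p , J , eq , p≤ , J≤ , f = suc p , J , cong suc eq , s≤s p≤ , J≤ ,
        trans (cong (ℤ._+_ y) f) (sym (ℤₚ.+-assoc y (P d p) (P a J)))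
  splits : ∀ p J → p ≤ suc (length d) → J ≤ length a → P (y ∷ d) p ℤ.+ P a J ℤ.≤ P (y ∷ e) (p + J)
  splits (suc p) J (s≤s p≤) J≤ = ℤₚ.≤-trans (ℤₚ.≤-reflexive (ℤₚ.+-assoc y (P d p) (P a J)))
    (ℤₚ.+-monoʳ-≤ y (all-splits p≤ J≤))
  splits zero zero    _ _  = ℤₚ.≤-refl
  splits zero (suc J) _ J≤ = ℤₚ.≤-trans
    (ℤₚ.+-monoʳ-≤ 0ℤ (P-suc-≤ a {J} {y} J≤ (a≤y J)))
    (ℤₚ.≤-trans (ℤₚ.≤-reflexive (arith (P a J) y)) (ℤₚ.+-monoʳ-≤ y (all-splits z≤n (ℕₚ.<⇒≤ J≤))))
    where
    arith : ∀ p x → 0ℤ ℤ.+ (p ℤ.+ x) ≡ x ℤ.+ (0ℤ ℤ.+ p)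
    arith = solve-∀

merge-[] : ∀ xs → mergeT xs [] ≡ xs
merge-[] []       = refl
merge-[] (x ∷ xs) = refl

Merged-map : ∀ xs ys → Sorted (valsOf xs) → Sorted (valsOf ys) →
             Merged (valsOf ys) (valsOf xs) (valsOf (mergeT xs ys))
Merged-map [] ys _ _ = record
  { length≡    = sym (ℕₚ.+-identityʳ _)
  ; some-split = λ {i} h → i , 0 , ℕₚ.+-identityʳ i , subst (i ≤_) (ℕₚ.+-identityʳ _) h , z≤n , sym (ℤₚ.+-identityʳ _)
  ; all-splits = λ { {p} {zero} _ _ → ℤₚ.≤-reflexive (trans (ℤₚ.+-identityʳ _) (cong (P (valsOf ys)) (sym (ℕₚ.+-identityʳ p)))) } }
Merged-map (x ∷ xs) ys sx = inner ys
  where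
  inner : ∀ ys → Sorted (valsOf ys) → Merged (valsOf ys) (valsOf (x ∷ xs)) (valsOf (mergeT (x ∷ xs) ys))
  inner [] _ = record
    { length≡    = refl
    ; some-split = λ {i} h → 0 , i , refl , z≤n , h , sym (ℤₚ.+-identityˡ _)
    ; all-splits = λ { {zero} _ _ → ℤₚ.≤-reflexive (ℤₚ.+-identityˡ _) } }
  inner (y ∷ ys) sy with val y ℤ.≤ᵇ val x in eq
  ... | true  = cons-right (λ i → ≤∞-trans (at-head≥ sy i) (fin≤ (ℤₚ.≤ᵇ⇒≤ (subst T (sym eq) tt))))
                  (Merged-map xs (y ∷ ys) (Sorted-tail sx) sy)
  ... | false = cons-left (λ i → ≤∞-trans (at-head≥ sx i) (fin≤ (ℤₚ.<⇒≤ (ℤₚ.≰⇒> λ h → subst T eq (ℤₚ.≤⇒≤ᵇ h)))))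
                  (inner ys (Sorted-tail sy))

eTagged≡ : ∀ d a → eTagged d a ≡ mergeT (tags true 1 a) (tags false 1 d)
eTagged≡ d a = cong₂ mergeT (tagList≡ true a) (tagList≡ false d)

merged : ∀ {d a} → Sorted d → Sorted a → Merged d a (valsOf (eTagged d a))
merged {d} {a} sd sa = subst (λ z → Merged d a (valsOf z)) (sym (eTagged≡ d a))
  (subst₂ (λ u v → Merged u v (valsOf (mergeT (tags true 1 a) (tags false 1 d)))) (vals-tags false 1 d) (vals-tags true 1 a)
    (Merged-map (tags true 1 a) (tags false 1 d)
      (subst Sorted (sym (vals-tags true 1 a)) sa) (subst Sorted (sym (vals-tags false 1 d)) sd)))

position : Bool → ℕ → ℕ → List Tag → ℕ
position b j i []       = 0
position b j i (t ∷ ts) =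
  if (left t ∧ b) ∨ (not (left t) ∧ not b) then
    (if Tag.idx t ℕ.≡ᵇ j then i else position b j (suc i) ts)
  else position b j (suc i) ts

mutual
  position-go : ∀ b j i ts → _ ≡ position b j i ts
  posOf≡ : ∀ ts b j → posOf ts b j ≡ position b j 1 ts
  posOf≡ ts b j with 1
  ... | i = position-go b j i ts
  position-go b j i [] = refl
  position-go b j i (t ∷ ts) with (left t ∧ b) ∨ (not (left t) ∧ not b)
  ... | false = position-go b j (suc i) ts
  ... | true with Tag.idx t ℕ.≡ᵇ j
  ... | true  = refl
  ... | false = position-go b j (suc i) ts

if-true : ∀ {A : Set} {b} {x y : A} → b ≡ true → (if b then x else y) ≡ x
if-true refl = refl

if-false : ∀ {A : Set} {b} {x y : A} → b ≡ false → (if b then x else y) ≡ y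
if-false refl = refl

≡ᵇ-refl : ∀ n → (n ℕ.≡ᵇ n) ≡ true
≡ᵇ-refl zero    = refl
≡ᵇ-refl (suc n) = ≡ᵇ-refl n

≡ᵇ-+suc : ∀ n k → (n ℕ.≡ᵇ (n + suc k)) ≡ false
≡ᵇ-+suc zero    k = refl
≡ᵇ-+suc (suc n) k = ≡ᵇ-+suc n k

module _ {v : ℤ} where
  Rank : List ℤ → ℕ → Set
  Rank a k = k ≤ length a × fin v ≤∞ at a k × at a (suc k) <∞ fin v

  -- Entries of a stand before equal entries of d, so the k entries of a ahead of v are those that
  -- are at least v. This is why rule (a) turns into a weak inequality.
  position-merge : ∀ q₀ a q d p i → Sorted d → at d (suc p) ≡ fin v →
    ∃[ k ] Rank a k × position false (q + p) i (mergeT (tags true q₀ a) (tags false q d)) ≡ i + p + k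
  position-merge q₀ a       q []      p       i sd ()
  position-merge q₀ []      q (y ∷ d) zero    i sd refl = 0 , (z≤n , ≤+∞ , λ ()) ,
    trans (if-true (trans (cong (q ℕ.≡ᵇ_) (ℕₚ.+-identityʳ q)) (≡ᵇ-refl q)))
          (sym (trans (ℕₚ.+-identityʳ _) (ℕₚ.+-identityʳ i)))
  position-merge q₀ []      q (y ∷ d) (suc p) i sd e with position-merge q₀ [] (suc q) d p (suc i) (Sorted-tail sd) e
  ... | k , rk , eq = k , rk ,
        trans (if-false (≡ᵇ-+suc q p))
          (trans (cong (λ z → position false z (suc i) (tags false (suc q) d)) (ℕₚ.+-suc q p))
            (trans eq (cong (_+ k) (sym (ℕₚ.+-suc i p)))))
  position-merge q₀ (x ∷ a) q (y ∷ d) p i sd e with y ℤ.≤ᵇ x in le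
  ... | true with position-merge (suc q₀) a q (y ∷ d) p (suc i) sd e
  ... | k , (k≤ , lo , hi) , eq = suc k , (s≤s k≤ , low k lo , hi) , trans eq (sym (ℕₚ.+-suc (i + p) k))
    where
    low : ∀ k → fin v ≤∞ at a k → fin v ≤∞ at (x ∷ a) (suc k)
    low zero    _ = ≤∞-trans (≤∞-reflexive (sym e)) (≤∞-trans (at-head≥ sd p) (fin≤ (ℤₚ.≤ᵇ⇒≤ (subst T (sym le) tt))))
    low (suc k) h = h
  position-merge q₀ (x ∷ a) q (y ∷ d) zero i sd refl | false = 0 , (z≤n , ≤+∞ , λ h → subst T le (ℤₚ.≤⇒≤ᵇ (fin≤⁻ h))) ,
    trans (if-true (trans (cong (q ℕ.≡ᵇ_) (ℕₚ.+-identityʳ q)) (≡ᵇ-refl q)))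
          (sym (trans (ℕₚ.+-identityʳ _) (ℕₚ.+-identityʳ i)))
  position-merge q₀ (x ∷ a) q (y ∷ d) (suc p) i sd e | false
    with position-merge q₀ (x ∷ a) (suc q) d p (suc i) (Sorted-tail sd) e
  ... | k , rk , eq = k , rk ,
        trans (if-false (≡ᵇ-+suc q p))
          (trans (cong (λ z → position false z (suc i) (mergeT (tags true q₀ (x ∷ a)) (tags false (suc q) d))) (ℕₚ.+-suc q p))
            (trans eq (cong (_+ k) (sym (ℕₚ.+-suc i p)))))

  posOf-e : ∀ {d a p} → Sorted d → at d (suc p) ≡ fin v →
            ∃[ k ] Rank a k × posOf (eTagged d a) false (suc p) ≡ suc p + k
  posOf-e {d} {a} {p} sd e with position-merge 1 a 1 d p 1 sd e
  ... | k , rk , eq = k , rk , trans (posOf≡ (eTagged d a) false (suc p))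
        (trans (cong (position false (suc p) 1) (eTagged≡ d a)) eq)

count-merge : ∀ v xs ys → countᵇ (λ t → v <ᵇ val t) (mergeT xs ys) ≡
              countᵇ (v <ᵇ_) (valsOf ys) + countᵇ (v <ᵇ_) (valsOf xs)
count-merge v [] ys = trans (map-count ys) (sym (ℕₚ.+-identityʳ _))
  where
  map-count : ∀ ys → countᵇ (λ t → v <ᵇ val t) ys ≡ countᵇ (v <ᵇ_) (valsOf ys)
  map-count []       = refl
  map-count (y ∷ ys) with v <ᵇ val y
  ... | true  = cong suc (map-count ys)
  ... | false = map-count ys
count-merge v (x ∷ xs) = inner
  where
  inner : ∀ ys → countᵇ (λ t → v <ᵇ val t) (mergeT (x ∷ xs) ys) ≡
          countᵇ (v <ᵇ_) (valsOf ys) + countᵇ (v <ᵇ_) (val x ∷ valsOf xs)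
  inner [] with v <ᵇ val x
  ... | true  = cong suc (trans (cong (countᵇ _) (sym (merge-[] xs))) (count-merge v xs []))
  ... | false = trans (cong (countᵇ _) (sym (merge-[] xs))) (count-merge v xs [])
  inner (y ∷ ys) with val y ℤ.≤ᵇ val x
  ... | true with v <ᵇ val x
  ... | true  = trans (cong suc (count-merge v xs (y ∷ ys))) (sym (ℕₚ.+-suc _ _))
  ... | false = count-merge v xs (y ∷ ys)
  inner (y ∷ ys) | false with v <ᵇ val y
  ... | true  = cong suc (inner ys)
  ... | false = inner ys

count-e : ∀ v d a → countᵇ (λ t → v <ᵇ val t) (eTagged d a) ≡ countᵇ (v <ᵇ_) d + countᵇ (v <ᵇ_) a
count-e v d a = trans (cong (countᵇ _) (eTagged≡ d a))
  (trans (count-merge v (tags true 1 a) (tags false 1 d))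
    (cong₂ (λ x y → countᵇ (v <ᵇ_) x + countᵇ (v <ᵇ_) y) (vals-tags false 1 d) (vals-tags true 1 a)))

count-≤ : ∀ v xs → countᵇ (v <ᵇ_) xs ≤ length xs
count-≤ v []       = z≤n
count-≤ v (x ∷ xs) with v <ᵇ x
... | true  = s≤s (count-≤ v xs)
... | false = ℕₚ.m≤n⇒m≤1+n (count-≤ v xs)

count-at : ∀ {v} xs → Sorted xs → ∀ k → fin v <∞ at xs k → k ≤ countᵇ (v <ᵇ_) xs
count-at xs       s zero    h = z≤n
count-at []       s (suc k) h = ⊥-elim (h -∞≤)
count-at {v} (x ∷ xs) s (suc k) h with v <ᵇ x in eq
... | false = ⊥-elim (h (≤∞-trans (at-head≥ s k) (fin≤ (<ᵇ-false eq))))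
count-at (x ∷ xs) s (suc zero)    h | true = s≤s z≤n
count-at (x ∷ xs) s (suc (suc k)) h | true = s≤s (count-at xs (Sorted-tail s) (suc k) h)

at-count : ∀ {v} xs → Sorted xs → ∀ k → k ≤ countᵇ (v <ᵇ_) xs → fin v <∞ at xs k
at-count xs       s zero    h ()
at-count {v} (x ∷ xs) s (suc k) h with v <ᵇ x in eq
... | false = λ _ → at-count xs (Sorted-tail s) (suc k) h (≤∞-trans (s (suc k)) (≤∞-trans (at-head≥ s k) (fin≤ (<ᵇ-false eq))))
at-count (x ∷ xs) s (suc zero)    h       | true = fin< (<ᵇ-true eq)
at-count (x ∷ xs) s (suc (suc k)) (s≤s h) | true = at-count xs (Sorted-tail s) (suc k) h

count-unique : ∀ {v} xs → Sorted xs → ∀ {k} → fin v <∞ at xs k → at xs (suc k) ≤∞ fin v →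
               countᵇ (v <ᵇ_) xs ≡ k
count-unique xs s {k} h h′ = ℕₚ.≤-antisym (ℕₚ.≮⇒≥ λ k< → at-count xs s (suc k) k< h′) (count-at xs s k h)

-- From the construction to runs

isIn isOut : Decision → Bool
isIn  = inSet
isOut = λ x → not (inSet x)

count-cong : ∀ {A : Set} {f g : A → Bool} {xs} → All (λ x → f x ≡ g x) xs → countᵇ f xs ≡ countᵇ g xs
count-cong []                                  = refl
count-cong {f = f} {g} {x ∷ xs} (e ∷ es) rewrite e with g x
... | true  = cong suc (count-cong es)
... | false = count-cong es

filter-cong : ∀ {A : Set} {f g : A → Bool} {xs} → All (λ x → f x ≡ g x) xs → L.filterᵇ f xs ≡ L.filterᵇ g xs
filter-cong []                                  = refl
filter-cong {f = f} {g} {x ∷ xs} (e ∷ es) rewrite e with g x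
... | true  = cong (x ∷_) (filter-cong es)
... | false = filter-cong es

All-filter : ∀ {R : Decision → Set} (f : Decision → Bool) {xs} → All R xs → All R (L.filterᵇ f xs)
All-filter f []                       = []
All-filter f {x ∷ xs} (r ∷ rs) with f x
... | true  = r ∷ All-filter f rs
... | false = All-filter f rs

∧-true : ∀ {x y} → y ≡ true → x ∧ y ≡ x
∧-true {true}  e = e
∧-true {false} e = refl

∧-false : ∀ {x y} → y ≡ false → x ∧ y ≡ false
∧-false {true}  e = e
∧-false {false} e = refl

<ℕᵇ-true : ∀ {i j} → i < j → (i <ℕᵇ j) ≡ true
<ℕᵇ-true {i} {j} h with j ℕ.≤ᵇ i in eq
... | false = refl
... | true  = ⊥-elim (ℕₚ.<⇒≱ h (ℕₚ.≤ᵇ⇒≤ j i (subst T (sym eq) tt)))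

<ℕᵇ-false : ∀ {i j} → j ≤ i → (i <ℕᵇ j) ≡ false
<ℕᵇ-false {i} {j} h with j ℕ.≤ᵇ i in eq
... | true  = refl
... | false = ⊥-elim (subst T eq (ℕₚ.≤⇒≤ᵇ h))

T⇒≡ : ∀ {b} → T b → b ≡ true
T⇒≡ {true} _ = refl

-- Larger indices are processed first, so the minimal index belongs to the latest decision, at the
-- head.
minIdx-head : ∀ {l v b ds} → All (λ x → l ≤ dIdx x) ds → minIdx (dec l v b ∷ ds) ≡ just (l , v)
minIdx-head {ds = ds} h with minIdx ds in eq
... | nothing = refl
... | just (i , u) = if-true (T⇒≡ (ℕₚ.≤⇒≤ᵇ (min≥ h eq)))
  where
  min≥ : ∀ {l i u ds} → All (λ x → l ≤ dIdx x) ds → minIdx ds ≡ just (i , u) → l ≤ i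
  min≥ {ds = x ∷ ds} (h ∷ hs) e with minIdx ds in eq
  min≥ {ds = x ∷ ds} (h ∷ hs) refl | nothing = h
  min≥ {ds = x ∷ ds} (h ∷ hs) e    | just (i , v) with dIdx x ℕ.≤ᵇ i
  min≥ {ds = x ∷ ds} (h ∷ hs) refl | just (i , v) | true  = h
  min≥ {ds = x ∷ ds} (h ∷ hs) refl | just (i , v) | false = min≥ hs eq

module _ {d a c b : List ℤ} {N : ℕ} {M : ℤ} where
  idx> : ∀ {dD dC p p′ Γ Q acc} → Run d a c b N M dD dC p p′ Γ Q acc → All (λ x → p < dIdx x) dD
  idx> start            = []
  idx> (rejD v r e o x) = ℕₚ.≤-refl ∷ All.map (ℕₚ.≤-trans (ℕₚ.n≤1+n _)) (idx> r)
  idx> (accD v r e o x) = ℕₚ.≤-refl ∷ All.map (ℕₚ.≤-trans (ℕₚ.n≤1+n _)) (idx> r)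
  idx> (rejC v r e o x) = idx> r
  idx> (accC v r e o x) = idx> r

  val≤ : Sorted d → ∀ {dD dC p p′ Γ Q acc} → Run d a c b N M dD dC p p′ Γ Q acc →
         All (λ x → fin (dVal x) ≤∞ at d (suc p)) dD
  val≤ sd start            = []
  val≤ sd (rejD v r e o x) = ≤∞-reflexive (sym e) ∷ All.map (λ h → ≤∞-trans h (sd _)) (val≤ sd r)
  val≤ sd (accD v r e o x) = ≤∞-reflexive (sym e) ∷ All.map (λ h → ≤∞-trans h (sd _)) (val≤ sd r)
  val≤ sd (rejC v r e o x) = val≤ sd r
  val≤ sd (accC v r e o x) = val≤ sd r

  -- Every entry of d is still to come, in Δ, or rejected; this eliminates |Δ| from Γ = N - |Δ| -
  -- |S|. Before d_{p+1} is processed, with Γ = p + 1 + w, the identity says q = w + 1.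
  count-balance : N ≡ length d + length a → ∀ {dD dC p p′ Γ Q acc} → Run d a c b N M dD dC p p′ Γ Q acc →
    Γ + countᵇ isIn dC ≡ p + length a + countᵇ isOut dD
  count-balance N≡ start            = cong (_+ 0) N≡
  count-balance N≡ (rejD v r e o x) = trans (count-balance N≡ r) (sym (ℕₚ.+-suc _ _))
  count-balance N≡ (accD v r e o x) = ℕₚ.suc-injective (count-balance N≡ r)
  count-balance N≡ (rejC v r e o x) = count-balance N≡ r
  count-balance N≡ (accC v r e o x) = trans (ℕₚ.+-suc _ _) (count-balance N≡ r)

  -- The same elimination with values in place of counts; it turns rule (b) into an inequality about
  -- Q.
  sum-balance : M ≡ sumℤ d ℤ.+ sumℤ a → ∀ {dD dC p p′ Γ Q acc} → Run d a c b N M dD dC p p′ Γ Q acc →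
    Q ℤ.+ sumVals (L.filterᵇ isIn dC) ≡ P d p ℤ.+ sumVals (L.filterᵇ isOut dD) ℤ.+ sumℤ a
  sum-balance M≡ start = trans (ℤₚ.+-identityʳ M) (trans M≡
    (cong (ℤ._+ sumℤ a) (sym (trans (ℤₚ.+-identityʳ _) (P-all d)))))
  sum-balance M≡ (rejD {dD = dD} {p = p} v r e o x) = trans (sum-balance M≡ r)
    (trans (cong (λ z → z ℤ.+ sumVals (L.filterᵇ isOut dD) ℤ.+ sumℤ a) (P-suc d e))
      (cong (ℤ._+ sumℤ a) (ℤₚ.+-assoc (P d p) v _)))
  sum-balance M≡ (accD {dD = dD} {dC} {p = p} {Q = Q} v r e o x) =
    trans (arith₁ Q v _) (trans (cong (ℤ._- v) (trans (sum-balance M≡ r)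
      (cong (λ z → z ℤ.+ sumVals (L.filterᵇ isOut dD) ℤ.+ sumℤ a) (P-suc d e)))) (arith₂ (P d p) v _ _))
    where
    arith₁ : ∀ Q v s → (Q ℤ.- v) ℤ.+ s ≡ (Q ℤ.+ s) ℤ.- v
    arith₁ = solve-∀
    arith₂ : ∀ p v s t → (((p ℤ.+ v) ℤ.+ s) ℤ.+ t) ℤ.- v ≡ (p ℤ.+ s) ℤ.+ t
    arith₂ = solve-∀
  sum-balance M≡ (rejC v r e o x) = sum-balance M≡ r
  sum-balance M≡ (accC {dC = dC} {Q = Q} v r e o x) = trans (arith Q v _) (sum-balance M≡ r)
    where
    arith : ∀ Q v s → (Q ℤ.- v) ℤ.+ (v ℤ.+ s) ≡ Q ℤ.+ s
    arith = solve-∀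

dC<d : ∀ {d a c b N M dD dC p p′ Γ Q acc} → Sorted d → Sorted c → Run d a c b N M dD dC p p′ Γ Q acc →
       All (λ x → fin (dVal x) <∞ at d p) dC
dC<d sd sc r = All.map (λ h → ≤∞-<∞-trans h (d<c sd (swap r))) (val≤ sc (swap r))

-- The last accepted entry of c, with g the value of Γ just after its acceptance.  The
-- quantities K and N of rule (a) satisfy K - N = g; and if some entry of d has been accepted
-- since, then no further entry of d can satisfy rule (a).
LastC : (d a : List ℤ) (dD dC : List Decision) (p Γ : ℕ) → Set
LastC d a dD dC p Γ = ∃[ l ] ∃[ v ] ∃[ g ]
    minIdx (L.filterᵇ isIn dC) ≡ just (l , v)
  × g + suc (countᵇ (λ x → inSet x ∧ (l <ℕᵇ dIdx x)) dC) ≡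
      countᵇ (v <ᵇ_) d + length a + countᵇ (λ x → not (inSet x) ∧ (dVal x <ᵇ v)) dD
  × fin v <∞ at d p × Γ ≤ g
  × (g ≡ Γ ⊎ ∃[ w ] p + w ≤ Γ × at a (suc w) <∞ at d (suc p))

module _ {d a c b : List ℤ} {N : ℕ} {M : ℤ} (sd : Sorted d) (sc : Sorted c)
         (N≡ : N ≡ length d + length a) where
  -- Entries of d processed after c_l exceed it, so the counts defining g stay fixed until c has its
  -- next acceptance. An acceptance in d makes Γ fall below g, but its condition a_{w+1} < v stays
  -- true for the later entries of d, which are no smaller.
  lastC : ∀ {dD dC p p′ Γ Q acc} → Run d a c b N M dD dC p p′ Γ Q acc →
          countᵇ isIn dC ≡ 0 ⊎ LastC d a dD dC p Γ
  lastC start = inj₁ refl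
  lastC (rejD {dD = dD} {p = p} {Γ = Γ} u r e o x) with lastC r
  ... | inj₁ z = inj₁ z
  ... | inj₂ (l , v , g , mi , eq , v< , Γ≤ , alt) =
        inj₂ (l , v , g , mi , trans eq (cong (λ t → countᵇ (v <ᵇ_) d + length a + t) (sym skip)) ,
              <∞-≤∞-trans v< (sd p) , Γ≤ , alt′ alt)
    where
    skip : countᵇ (λ x → not (inSet x) ∧ (dVal x <ᵇ v)) (dec (suc p) u false ∷ dD) ≡
           countᵇ (λ x → not (inSet x) ∧ (dVal x <ᵇ v)) dD
    skip = if-false (<ᵇ⇐≥ (fin≤⁻ (subst (fin v ≤∞_) e (<∞⇒≤∞ v<))))
    alt′ : g ≡ Γ ⊎ ∃[ w ] suc p + w ≤ Γ × at a (suc w) <∞ at d (suc (suc p)) →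
           g ≡ Γ ⊎ ∃[ w ] p + w ≤ Γ × at a (suc w) <∞ at d (suc p)
    alt′ (inj₁ z) = inj₁ z
    alt′ (inj₂ (w , w≤ , a<)) = inj₂ (w , ℕₚ.<⇒≤ w≤ , <∞-≤∞-trans a< (sd (suc p)))
  lastC (accD {p = p} u r e o (w , Γ≡ , w≤ , a< , _)) with lastC r
  ... | inj₁ z = inj₁ z
  ... | inj₂ (l , v , g , mi , eq , v< , Γ≤ , alt) =
        inj₂ (l , v , g , mi , eq , <∞-≤∞-trans v< (sd p) , ℕₚ.<⇒≤ Γ≤ ,
              inj₂ (w , ℕₚ.≤-reflexive (sym (ℕₚ.suc-injective Γ≡)) , subst (at a (suc w) <∞_) (sym e) a<))
  lastC (rejC u r e o x) = lastC r
  lastC {dC = dec l _ true ∷ dC} (accC {dD = dD} {p = p} {Γ = Γ} v r e o x) =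
    inj₂ (l , v , Γ , minIdx-head (All-filter isIn (All.map ℕₚ.<⇒≤ (idx> (swap r)))) ,
          trans (cong (λ t → Γ + suc t) (trans (if-false (<ℕᵇ-false (ℕₚ.≤-refl {l}))) cnt-in))
            (trans (ℕₚ.+-suc Γ (countᵇ isIn dC))
              (trans (count-balance N≡ r) (cong₂ (λ x y → x + length a + y) (sym cnt-d) (sym cnt-out)))) ,
          o , ℕₚ.≤-refl , inj₁ refl)
    where
    cnt-in : countᵇ (λ x → inSet x ∧ (l <ℕᵇ dIdx x)) dC ≡ countᵇ isIn dC
    cnt-in = count-cong (All.map (λ h → ∧-true (<ℕᵇ-true h)) (idx> (swap r)))
    d<v : at d (suc p) <∞ fin v
    d<v = subst (at d (suc p) <∞_) e (d<c sc r)
    cnt-d : countᵇ (v <ᵇ_) d ≡ p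
    cnt-d = count-unique d sd o (<∞⇒≤∞ d<v)
    cnt-out : countᵇ (λ x → not (inSet x) ∧ (dVal x <ᵇ v)) dD ≡ countᵇ isOut dD
    cnt-out = count-cong (All.map (λ h → ∧-true (<ᵇ⇐< (fin<⁻ (≤∞-<∞-trans h d<v)))) (val≤ sd r))

sum-take : ∀ (xs : List ℤ) lo n → sumℤ (L.take n (drop lo xs)) ≡ P xs (lo + n) ℤ.- P xs lo
sum-take xs       zero     n       = sym (ℤₚ.+-identityʳ _)
sum-take []       (suc lo) zero    = refl
sum-take []       (suc lo) (suc n) = refl
sum-take (x ∷ xs) (suc lo) n       = trans (sum-take xs lo n) (arith x (P xs (lo + n)) (P xs lo))
  where
  arith : ∀ x y z → y ℤ.- z ≡ (x ℤ.+ y) ℤ.- (x ℤ.+ z)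
  arith = solve-∀

rangeSum : ∀ xs lo n → lo + n ≤ length xs →
           rangeSum∞ xs (ℤ.+ suc lo) (ℤ.+ (lo + n)) ≡ fin (P xs (lo + n) ℤ.- P xs lo)
rangeSum xs lo zero h = trans (if-true (<ᵇ⇐< {ℤ.+ (lo + 0)} {ℤ.+ suc lo} (ℤ.+<+ (s≤s (ℕₚ.≤-reflexive (ℕₚ.+-identityʳ lo))))))
  (cong fin (sym (trans (cong (λ k → P xs k ℤ.- P xs lo) (ℕₚ.+-identityʳ lo)) (ℤₚ.+-inverseʳ (P xs lo)))))
rangeSum xs lo (suc n) h =
  trans (if-false (<ᵇ⇐≥ {ℤ.+ (lo + suc n)} {ℤ.+ suc lo} (ℤ.+≤+ (ℕₚ.≤-trans (s≤s (ℕₚ.m≤m+n lo n)) (ℕₚ.≤-reflexive (sym (ℕₚ.+-suc lo n)))))))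
  (trans (if-false (<ᵇ⇐≥ {ℤ.+ length xs} {ℤ.+ (lo + suc n)} (ℤ.+≤+ h)))
  (cong fin (trans (cong₂ (λ i j → sumℤ (L.take ℤ.∣ i ∣ (drop ℤ.∣ j ∣ xs))) (eq₁ (ℤ.+ lo) (ℤ.+ n)) (eq₂ (ℤ.+ lo)))
    (sum-take xs lo (suc n)))))
  where
  eq₁ : ∀ lo n → lo ℤ.+ (1ℤ ℤ.+ n) ℤ.- (1ℤ ℤ.+ lo) ℤ.+ 1ℤ ≡ 1ℤ ℤ.+ n
  eq₁ = solve-∀
  eq₂ : ∀ lo → (1ℤ ℤ.+ lo) ℤ.- 1ℤ ≡ lo
  eq₂ = solve-∀

-- Restates the quantities local to `decide`, so that lemmas can speak of them.
module Rule (s : ℕ) (a : List ℤ) (e : List Tag) (j : ℕ) (v : ℤ) (own other : List Decision) where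
  cands outs : List Decision
  cands = L.filterᵇ (λ x → inSet x ∧ (dVal x <ᵇ v)) other
  outs  = L.filterᵇ (λ x → not (inSet x) ∧ (j <ℕᵇ dIdx x)) own
  q : ℤ
  q = (ℤ.+ s) ℤ.- (ℤ.+ countᵇ (λ x → inSet x ∧ (dVal x <ᵇ v)) other)
        ℤ.+ (ℤ.+ countᵇ (λ x → not (inSet x) ∧ (j <ℕᵇ dIdx x)) own) ℤ.+ 1ℤ
  ruleB : Bool
  ruleB = not (addFin (sumVals outs ℤ.+ v) (rangeSum∞ a (q ℤ.+ 1ℤ) (ℤ.+ s)) ≤∞ᵇ fin (sumVals cands))
  module _ (l : ℕ) (cl : ℤ) where
    Nₗ : ℤ
    Nₗ = (ℤ.+ countᵇ (λ x → cl <ᵇ x) a) ℤ.- (ℤ.+ s)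
          ℤ.+ (ℤ.+ countᵇ (λ x → inSet x ∧ (l <ℕᵇ dIdx x)) other)
          ℤ.- (ℤ.+ countᵇ (λ x → not (inSet x) ∧ (dVal x <ᵇ cl)) own) ℤ.+ 1ℤ
    K : ℕ
    K = countᵇ (λ t → cl <ᵇ val t) e
    ruleA : Bool
    ruleA = (1ℤ ℤ.≤ᵇ Nₗ) ∧ (cl <ᵇ v) ∧ (((ℤ.+ K) ℤ.- Nₗ) <ᵇ (ℤ.+ posOf e false j))

  decide-full : ((ℤ.+ s) <ᵇ q) ≡ true → decide s a e j v own other ≡ true
  decide-full h = if-true h

  decide-cand : ∀ {l cl} → ((ℤ.+ s) <ᵇ q) ≡ false → minIdx cands ≡ just (l , cl) →
                decide s a e j v own other ≡ (if ruleA l cl then false else ruleB)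
  decide-cand h m with minIdx cands
  decide-cand h refl | just _ = if-false h

bool-cases : ∀ b → b ≡ true ⊎ b ≡ false
bool-cases true  = inj₁ refl
bool-cases false = inj₂ refl

∧-elimʳ : ∀ {x y} → x ∧ y ≡ true → y ≡ true
∧-elimʳ {true} e = e

module DecideStep {d a c b : List ℤ} {N : ℕ} {M : ℤ} (sd : Sorted d) (sa : Sorted a) (sc : Sorted c)
    (N≡ : N ≡ length d + length a) (M≡ : M ≡ sumℤ d ℤ.+ sumℤ a)
    {dD dC : List Decision} {p p′ Γ : ℕ} {Q : ℤ} {acc : List ℤ}
    (r : Run d a c b N M dD dC (suc p) p′ Γ Q acc) {v : ℤ} (e : at d (suc p) ≡ fin v) where
  open Rule (length a) a (eTagged d a) (suc p) v dD dC
  s A B : ℕ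
  s = length a
  A = countᵇ isIn dC
  B = countᵇ isOut dD
  I O : ℤ
  I = sumVals (L.filterᵇ isIn dC)
  O = sumVals (L.filterᵇ isOut dD)

  own-all : All (λ x → not (inSet x) ∧ (suc p <ℕᵇ dIdx x) ≡ isOut x) dD
  own-all = All.map (λ h → ∧-true (<ℕᵇ-true h)) (idx> r)

  other-all : All (λ x → inSet x ∧ (dVal x <ᵇ v) ≡ isIn x) dC
  other-all = All.map (λ h → ∧-true (<ᵇ⇐< (fin<⁻ (subst (_ <∞_) e h)))) (dC<d sd sc r)

  cands≡ : cands ≡ L.filterᵇ isIn dC
  cands≡ = filter-cong other-all

  q≡ : q ≡ (ℤ.+ s) ℤ.- (ℤ.+ A) ℤ.+ (ℤ.+ B) ℤ.+ 1ℤ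
  q≡ = cong₂ (λ x y → (ℤ.+ s) ℤ.- (ℤ.+ x) ℤ.+ (ℤ.+ y) ℤ.+ 1ℤ) (count-cong other-all) (count-cong own-all)

  balance≡ : Γ + A ≡ suc p + s + B
  balance≡ = count-balance N≡ r

  -- Since q = w + 1 and w ≤ s, the test q > s leaves only w = s.
  full : ((ℤ.+ s) <ᵇ q) ≡ true → Γ ≡ suc p + s
  full h = ℕₚ.≤-antisym (Γ≤p+s N≡ r) (ℕₚ.+-cancelʳ-≤ A (suc p + s) Γ
    (ℕₚ.≤-trans (ℕₚ.+-monoʳ-≤ (suc p + s) A≤B) (ℕₚ.≤-reflexive (sym balance≡))))
    where
    arith : ∀ s A B → ((s ℤ.- A) ℤ.+ B ℤ.+ 1ℤ) ℤ.- (1ℤ ℤ.+ s) ≡ B ℤ.- A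
    arith = solve-∀
    A≤B : A ≤ B
    A≤B = ℤₚ.drop‿+≤+ (lin (<⇒1+≤ (subst (ℤ.+ s ℤ.<_) q≡ (<ᵇ-true h))) (arith (ℤ.+ s) (ℤ.+ A) (ℤ.+ B)))

  not-full : ((ℤ.+ s) <ᵇ q) ≡ false → suc B ≤ A
  not-full h = ℤₚ.drop‿+≤+ (lin (subst (ℤ._≤ ℤ.+ s) q≡ (<ᵇ-false h)) (arith (ℤ.+ s) (ℤ.+ A) (ℤ.+ B)))
    where
    arith : ∀ s A B → s ℤ.- ((s ℤ.- A) ℤ.+ B ℤ.+ 1ℤ) ≡ A ℤ.- (1ℤ ℤ.+ B)
    arith = solve-∀

  w<s : ((ℤ.+ s) <ᵇ q) ≡ false → ∀ {w} → Γ ≡ suc p + w → w < s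
  w<s h {w} refl = ℕₚ.+-cancelˡ-≤ (suc p) (suc w) s (ℕₚ.+-cancelʳ-≤ B _ _ (ℕₚ.≤-trans
    (ℕₚ.≤-reflexive (trans (cong (_+ B) (ℕₚ.+-suc (suc p) w)) (sym (ℕₚ.+-suc (suc p + w) B))))
    (ℕₚ.≤-trans (ℕₚ.+-monoʳ-≤ (suc p + w) (not-full h)) (ℕₚ.≤-reflexive balance≡))))

  module _ {w : ℕ} (Γ≡ : Γ ≡ suc p + w) (w< : w < s) where
    q≡w : q ℤ.+ 1ℤ ≡ ℤ.+ suc (suc w)
    q≡w = trans (cong (ℤ._+ 1ℤ) q≡) (trans (arith₁ (ℤ.+ s) (ℤ.+ A) (ℤ.+ B))
            (trans (cong (λ z → z ℤ.- (ℤ.+ A) ℤ.+ (1ℤ ℤ.+ 1ℤ)) (sym (cong ℤ.+_ w+A))) (arith₂ (ℤ.+ w) (ℤ.+ A))))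
      where
      w+A : w + A ≡ s + B
      w+A = ℕₚ.+-cancelˡ-≡ (suc p) _ _ (trans (sym (ℕₚ.+-assoc (suc p) w A))
              (trans (cong (_+ A) (sym Γ≡)) (trans balance≡ (ℕₚ.+-assoc (suc p) s B))))
      arith₁ : ∀ s A B → ((s ℤ.- A) ℤ.+ B ℤ.+ 1ℤ) ℤ.+ 1ℤ ≡ (s ℤ.+ B) ℤ.- A ℤ.+ (1ℤ ℤ.+ 1ℤ)
      arith₁ = solve-∀
      arith₂ : ∀ w A → (w ℤ.+ A) ℤ.- A ℤ.+ (1ℤ ℤ.+ 1ℤ) ≡ 1ℤ ℤ.+ (1ℤ ℤ.+ w)
      arith₂ = solve-∀

    rhs : ℤ
    rhs = (O ℤ.+ v) ℤ.+ (P a s ℤ.- P a (suc w))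

    ruleB≡ : ruleB ≡ not (rhs ℤ.≤ᵇ I)
    ruleB≡ with ℕₚ.m≤n⇒∃[o]m+o≡n w<
    ... | n , eq = cong₂ (λ x y → not (x ≤∞ᵇ fin y))
      (trans (cong₂ (λ o i → addFin (sumVals o ℤ.+ v) (rangeSum∞ a i (ℤ.+ s))) (filter-cong own-all) q≡w)
        (cong (addFin (O ℤ.+ v)) (trans (cong (λ z → rangeSum∞ a (ℤ.+ suc (suc w)) (ℤ.+ z)) (sym eq))
          (trans (rangeSum a (suc w) n (ℕₚ.≤-reflexive eq)) (cong (λ z → fin (P a z ℤ.- P a (suc w))) eq)))))
      (cong sumVals cands≡)

    sum≡ : Q ℤ.+ I ≡ (P d p ℤ.+ v) ℤ.+ O ℤ.+ P a s
    sum≡ = trans (sum-balance M≡ r) (cong₂ (λ x y → x ℤ.+ O ℤ.+ y) (P-suc d e) (sym (P-all a)))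

    B⇒ : rhs ℤ.≤ I → Q ℤ.≤ P d p ℤ.+ P a (suc w)
    B⇒ h = lin h (trans (arith₁ O v (P a s) (P a (suc w)) I Q)
             (trans (cong (λ z → (z ℤ.+ P a (suc w)) ℤ.- (O ℤ.+ v ℤ.+ P a s) ℤ.- Q) sum≡)
                    (arith₂ (P d p) v O (P a s) (P a (suc w)) Q)))
      where
      arith₁ : ∀ O v S x I Q → I ℤ.- ((O ℤ.+ v) ℤ.+ (S ℤ.- x)) ≡ ((Q ℤ.+ I) ℤ.+ x) ℤ.- (O ℤ.+ v ℤ.+ S) ℤ.- Q
      arith₁ = solve-∀
      arith₂ : ∀ p v O S x Q → (((p ℤ.+ v) ℤ.+ O ℤ.+ S) ℤ.+ x) ℤ.- (O ℤ.+ v ℤ.+ S) ℤ.- Q ≡ (p ℤ.+ x) ℤ.- Q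
      arith₂ = solve-∀

    B⇐ : Q ℤ.≤ P d p ℤ.+ P a (suc w) → rhs ℤ.≤ I
    B⇐ h = lin h (trans (arith₂ (P d p) v O (P a s) (P a (suc w)) Q)
             (trans (cong (λ z → (z ℤ.+ P a (suc w)) ℤ.- (O ℤ.+ v ℤ.+ P a s) ℤ.- Q) (sym sum≡))
                    (arith₁ O v (P a s) (P a (suc w)) I Q)))
      where
      arith₁ : ∀ O v S x I Q → ((Q ℤ.+ I) ℤ.+ x) ℤ.- (O ℤ.+ v ℤ.+ S) ℤ.- Q ≡ I ℤ.- ((O ℤ.+ v) ℤ.+ (S ℤ.- x))
      arith₁ = solve-∀
      arith₂ : ∀ p v O S x Q → (p ℤ.+ x) ℤ.- Q ≡ (((p ℤ.+ v) ℤ.+ O ℤ.+ S) ℤ.+ x) ℤ.- (O ℤ.+ v ℤ.+ S) ℤ.- Q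
      arith₂ = solve-∀

    ruleB-true : ruleB ≡ true → P d p ℤ.+ P a (suc w) ℤ.< Q
    ruleB-true h = ℤₚ.≰⇒> λ k → <ᵇ-absurd (trans (sym ruleB≡) h) (B⇐ k)
      where
      <ᵇ-absurd : ∀ {x y} → not (x ℤ.≤ᵇ y) ≡ true → x ℤ.≤ y → ⊥
      <ᵇ-absurd h k = ℤₚ.<⇒≱ (<ᵇ-true h) k

    ruleB-false : ruleB ≡ false → Q ℤ.≤ P d p ℤ.+ P a (suc w)
    ruleB-false h = B⇒ (<ᵇ-false (trans (sym ruleB≡) h))

  module _ (lc : LastC d a dD dC (suc p) Γ) where
    l = proj₁ lc
    cl = proj₁ (proj₂ lc)
    g = proj₁ (proj₂ (proj₂ lc))
    private
      rest = proj₂ (proj₂ (proj₂ lc))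
      g≡ = proj₁ (proj₂ rest)
      cl< = proj₁ (proj₂ (proj₂ rest))
      Γ≤g = proj₁ (proj₂ (proj₂ (proj₂ rest)))
      alt = proj₂ (proj₂ (proj₂ (proj₂ rest)))
      z = countᵇ (cl <ᵇ_) d
      cA = countᵇ (cl <ᵇ_) a
      u = countᵇ (λ x → inSet x ∧ (l <ℕᵇ dIdx x)) dC
      t = countᵇ (λ x → not (inSet x) ∧ (dVal x <ᵇ cl)) dD
      k = proj₁ (posOf-e {v} {d} {a} {p} sd e)
      rank = proj₁ (proj₂ (posOf-e {v} {d} {a} {p} sd e))
      pos≡ = proj₂ (proj₂ (posOf-e {v} {d} {a} {p} sd e))
      K≡ : K l cl ≡ z + cA
      K≡ = count-e cl d a

    minIdx≡ : minIdx cands ≡ just (l , cl)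
    minIdx≡ = trans (cong minIdx cands≡) (proj₁ rest)

    K-N : (ℤ.+ K l cl) ℤ.- Nₗ l cl ≡ ℤ.+ g
    K-N = trans (cong (λ x → (ℤ.+ x) ℤ.- Nₗ l cl) K≡) (trans (arith₁ (ℤ.+ z) (ℤ.+ cA) (ℤ.+ s) (ℤ.+ u) (ℤ.+ t))
            (trans (cong (λ x → x ℤ.- (1ℤ ℤ.+ (ℤ.+ u))) (cong ℤ.+_ (sym g≡))) (arith₂ (ℤ.+ g) (ℤ.+ u))))
      where
      arith₁ : ∀ z c s u t → (z ℤ.+ c) ℤ.- (c ℤ.- s ℤ.+ u ℤ.- t ℤ.+ 1ℤ) ≡ (z ℤ.+ s ℤ.+ t) ℤ.- (1ℤ ℤ.+ u)
      arith₁ = solve-∀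
      arith₂ : ∀ g u → (g ℤ.+ (1ℤ ℤ.+ u)) ℤ.- (1ℤ ℤ.+ u) ≡ g
      arith₂ = solve-∀

    ruleA-true : ruleA l cl ≡ true → g < suc p + k
    ruleA-true h = ℤₚ.drop‿+<+ (subst₂ ℤ._<_ K-N (cong ℤ.+_ pos≡)
      (<ᵇ-true (∧-elimʳ {cl <ᵇ v} (∧-elimʳ {1ℤ ℤ.≤ᵇ Nₗ l cl} h))))

    -- The other two tests of rule (a) follow from the position test: d_j exceeds c_l, so its
    -- position is at most K, and g < K with K - N = g gives N ≥ 1.
    ruleA-false : ruleA l cl ≡ false → suc p + k ≤ g
    ruleA-false h = ℕₚ.≮⇒≥ λ g< → true≢false (trans (sym (all-true g<)) h)
      where
      true≢false : true ≢ false
      true≢false ()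
      cl<v : cl ℤ.< v
      cl<v = fin<⁻ (subst (fin cl <∞_) e cl<)
      pos≤K : suc p + k ≤ K l cl
      pos≤K = subst (suc p + k ≤_) (sym K≡) (ℕₚ.+-mono-≤ (count-at d sd (suc p) cl<)
        (count-at a sa k (<∞-≤∞-trans (fin< cl<v) (proj₁ (proj₂ rank)))))
      all-true : g < suc p + k → ruleA l cl ≡ true
      all-true g< = trans (cong₂ _∧_ (T⇒≡ (ℤₚ.≤⇒≤ᵇ N≥1)) (cong₂ _∧_ (<ᵇ⇐< cl<v)
          (<ᵇ⇐< (subst₂ ℤ._<_ (sym K-N) (cong ℤ.+_ (sym pos≡)) (ℤ.+<+ g<))))) refl
        where
        arith : ∀ K N g → K ℤ.- N ≡ g → K ℤ.- (1ℤ ℤ.+ g) ≡ N ℤ.- 1ℤ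
        arith K N g refl = lem K N
          where
          lem : ∀ K N → K ℤ.- (1ℤ ℤ.+ (K ℤ.- N)) ≡ N ℤ.- 1ℤ
          lem = solve-∀
        N≥1 : 1ℤ ℤ.≤ Nₗ l cl
        N≥1 = lin (ℤ.+≤+ (ℕₚ.≤-trans g< pos≤K)) (arith (ℤ.+ K l cl) (Nₗ l cl) (ℤ.+ g) K-N)

    -- Rule (a) tests g, the claim concerns Γ. If they agree, at most w entries of a are at least v;
    -- if not, an earlier acceptance in d already supplies an entry of a below v at a small enough
    -- index.
    accept-w : ruleA l cl ≡ false → ∃[ w ] Γ ≡ suc p + w × at a (suc w) <∞ fin v
    accept-w h = result alt
      where
      from : ∀ k → suc p + k ≤ Γ → at a (suc k) <∞ fin v → ∃[ w ] Γ ≡ suc p + w × at a (suc w) <∞ fin v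
      from k k≤ a< with ℕₚ.m≤n⇒∃[o]m+o≡n k≤
      ... | n , eq = k + n , trans (sym eq) (ℕₚ.+-assoc (suc p) k n) ,
            ≤∞-<∞-trans (at-anti a sa (s≤s (ℕₚ.m≤m+n k n))) a<
      result : g ≡ Γ ⊎ ∃[ w ] suc p + w ≤ Γ × at a (suc w) <∞ at d (suc (suc p)) →
               ∃[ w ] Γ ≡ suc p + w × at a (suc w) <∞ fin v
      result (inj₁ g≡Γ)        = from k (subst (suc p + k ≤_) g≡Γ (ruleA-false h)) (proj₂ (proj₂ rank))
      result (inj₂ (w , h , a<)) = from w h (<∞-≤∞-trans a< (≤∞-trans (sd (suc p)) (≤∞-reflexive e)))

    reject-w : ruleA l cl ≡ true → ∀ {w} → Γ ≡ suc p + w → fin v ≤∞ at a (suc w)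
    reject-w h {w} refl = ≤∞-trans (proj₁ (proj₂ rank)) (at-anti a sa
      (ℕₚ.+-cancelˡ-≤ (suc p) (suc w) k (subst (_≤ suc p + k) (sym (ℕₚ.+-suc (suc p) w)) (ℕₚ.≤-trans (s≤s Γ≤g) (ruleA-true h)))))

  decision : Bool
  decision = decide (length a) a (eTagged d a) (suc p) v dD dC

  Accepted : Set
  Accepted = ∃[ Γ′ ] Γ ≡ suc Γ′ × Acc d a p Γ Q v

  decide-spec : (decision ≡ true × Accepted) ⊎ (decision ≡ false × Rej d a p Γ Q v)
  decide-spec with bool-cases ((ℤ.+ s) <ᵇ q)
  ... | inj₁ full? = inj₁ (decide-full full? , p + s , full full? , s , full full? , ℕₚ.≤-refl ,
               (λ h → ≤∞-absurd (subst (fin v ≤∞_) (at-out a ℕₚ.≤-refl) h)) , λ h → ⊥-elim (ℕₚ.<-irrefl refl h))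
    where
    ≤∞-absurd : ∀ {x} → fin x ≤∞ -∞ → ⊥
    ≤∞-absurd ()
  ... | inj₂ full? with lastC sd sc N≡ r
  -- q ≤ s forces S to be nonempty, so l exists.
  ... | inj₁ A≡0 = ⊥-elim (ℕₚ.<⇒≱ (not-full full?) (subst (_≤ B) (sym A≡0) z≤n))
  ... | inj₂ lc with bool-cases (ruleA (l lc) (cl lc))
  ... | inj₁ A? = inj₂ (trans (decide-cand full? (minIdx≡ lc)) (if-true A?) , reject)
    where
    reject : Rej d a p Γ Q v
    reject with ℕₚ.≤-<-connex Γ p
    ... | inj₁ h = inj₁ h
    ... | inj₂ h with ℕₚ.m≤n⇒∃[o]m+o≡n h
    ... | w , eq = inj₂ (w , sym eq , w<s full? (sym eq) , inj₁ (reject-w lc A? (sym eq)))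
  ... | inj₂ A? with accept-w lc A?
  ... | w , Γ≡ , a< with bool-cases ruleB
  ... | inj₁ B? = inj₁ (trans (decide-cand full? (minIdx≡ lc)) (trans (if-false A?) B?) ,
               p + w , Γ≡ , w , Γ≡ , ℕₚ.<⇒≤ (w<s full? Γ≡) , a< , λ w< → ruleB-true Γ≡ w< B?)
  ... | inj₂ B? = inj₂ (trans (decide-cand full? (minIdx≡ lc)) (trans (if-false A?) B?) ,
                inj₂ (w , Γ≡ , w<s full? Γ≡ , inj₂ (ruleB-false Γ≡ (w<s full? Γ≡) B?)))

AnyRun : (d a c b : List ℤ) (N : ℕ) (M : ℤ) (dD dC : List Decision) (p p′ : ℕ) → Set
AnyRun d a c b N M dD dC p p′ = ∃[ Γ ] ∃[ Q ] ∃[ acc ] Run d a c b N M dD dC p p′ Γ Q acc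

processD : ∀ {d a c b N M dD dC p p′ v} → Sorted d → Sorted a → Sorted c →
  N ≡ length d + length a → M ≡ sumℤ d ℤ.+ sumℤ a →
  AnyRun d a c b N M dD dC (suc p) p′ → at d (suc p) ≡ fin v → fin v <∞ at c p′ →
  AnyRun d a c b N M (dec (suc p) v (decide (length a) a (eTagged d a) (suc p) v dD dC) ∷ dD) dC p p′
processD {d} {a} {c} {b} {N} {M} {dD} {dC} {p} {p′} {v} sd sa sc N≡ M≡ (Γ , Q , acc , r) e o
  with DecideStep.decide-spec sd sa sc N≡ M≡ r e
... | inj₁ (eq , Γ′ , refl , ac) = Γ′ , Q ℤ.- v , v ∷ acc ,
      subst (λ z → Run d a c b N M (dec (suc p) v z ∷ dD) dC p p′ Γ′ (Q ℤ.- v) (v ∷ acc)) (sym eq) (accD v r e o ac)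
... | inj₂ (eq , rj) = Γ , Q , acc ,
      subst (λ z → Run d a c b N M (dec (suc p) v z ∷ dD) dC p p′ Γ Q acc) (sym eq) (rejD v r e o rj)

AnyRun-swap : ∀ {d a c b N M dD dC p p′} → AnyRun d a c b N M dD dC p p′ → AnyRun c b d a N M dC dD p′ p
AnyRun-swap (Γ , Q , acc , r) = Γ , Q , acc , swap r

-- The left fold over the reversed order is a right fold over the merge. The state with p and p′
-- entries to come is thus the fold over a suffix, and a run is built by induction on the lists.
module Construct (a d b c : List ℤ) where
  step : Tag → List Decision × List Decision → List Decision × List Decision
  step t (dD , dC) =
    if left t
    then (dD , dec (idx t) (val t) (decide (length b) b (eTagged c b) (idx t) (val t) dC dD) ∷ dC)
    else (dec (idx t) (val t) (decide (length a) a (eTagged d a) (idx t) (val t) dD dC) ∷ dD , dC)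

  result : List Tag → List Decision × List Decision
  result = L.foldr step ([] , [])

  order : List Tag
  order = mergeT (tagList true c) (tagList false d)

  construct≡ : construct a d b c ≡ result (mergeT (tags true 1 c) (tags false 1 d))
  construct≡ = trans (Lₚ.foldl-cong {f = _} {g = λ st t → step t st} (λ { (dD , dC) t → refl }) ([] , []) (L.reverse order))
    (trans (Lₚ.reverse-foldl (λ st t → step t st) ([] , []) order)
           (cong₂ (λ u v → result (mergeT u v)) (tagList≡ true c) (tagList≡ false d)))

  module _ (sd : Sorted d) (sa : Sorted a) (sc : Sorted c) (sb : Sorted b) {N : ℕ} {M : ℤ}
           (N≡ : N ≡ length d + length a) (N≡′ : N ≡ length c + length b)
           (M≡ : M ≡ sumℤ d ℤ.+ sumℤ a) (M≡′ : M ≡ sumℤ c ℤ.+ sumℤ b)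
           (d≠c : ∀ {i j x} → at c (suc i) ≡ fin x → at d (suc j) ≡ fin x → ⊥) where
    Good : (p p′ : ℕ) → List Decision × List Decision → Set
    Good p p′ (dD , dC) = AnyRun d a c b N M dD dC p p′

    stepD : ∀ {p p′ v} st → Good (suc p) p′ st → at d (suc p) ≡ fin v → fin v <∞ at c p′ →
            Good p p′ (step (tag false (suc p) v) st)
    stepD (dD , dC) G e o = processD sd sa sc N≡ M≡ G e o

    stepC : ∀ {p p′ v} st → Good p (suc p′) st → at c (suc p′) ≡ fin v → fin v <∞ at d p →
            Good p p′ (step (tag true (suc p′) v) st)
    stepC (dD , dC) G e o = AnyRun-swap (processD sc sb sd N≡′ M≡′ (AnyRun-swap G) e o)

    drop-length : ∀ (xs : List ℤ) {n} → n ≤ length xs → drop n xs ≡ [] → n ≡ length xs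
    drop-length []       {zero}  _       _ = refl
    drop-length (x ∷ xs) {suc n} (s≤s h) e = cong suc (drop-length xs h e)

    run-[] : ∀ ds {p p′} → drop p d ≡ ds → drop p′ c ≡ [] → p ≤ length d → p′ ≤ length c →
             at d (suc p) <∞ at c p′ → Good p p′ (result (tags false (suc p) ds))
    run-[] [] ed ec hd hc _ with drop-length d hd ed | drop-length c hc ec
    ... | refl | refl = N , M , [] , start
    run-[] (y ∷ ds) {p} {p′} ed ec hd hc h₂ with drop-suc d ed
    ... | ed′ , e = stepD (result (tags false (suc (suc p)) ds))
            (run-[] ds ed′ ec (at-in′ d e) hc (≤∞-<∞-trans (sd (suc p)) h₂)) e (subst (_<∞ at c p′) e h₂)

    run : ∀ cs ds {p p′} → drop p d ≡ ds → drop p′ c ≡ cs → p ≤ length d → p′ ≤ length c →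
          at c (suc p′) <∞ at d p → at d (suc p) <∞ at c p′ →
          Good p p′ (result (mergeT (tags true (suc p′) cs) (tags false (suc p) ds)))
    run [] ds ed ec hd hc h₁ h₂ = run-[] ds ed ec hd hc h₂
    run (x ∷ cs) ds {p} {p′} ed ec hd hc h₁ h₂ = inner ds ed hd h₁ h₂
      where
      ec′ : drop (suc p′) c ≡ cs
      ec′ = proj₁ (drop-suc c ec)
      e : at c (suc p′) ≡ fin x
      e = proj₂ (drop-suc c ec)
      inner : ∀ ds {p} → drop p d ≡ ds → p ≤ length d → at c (suc p′) <∞ at d p → at d (suc p) <∞ at c p′ →
              Good p p′ (result (mergeT (tags true (suc p′) (x ∷ cs)) (tags false (suc p) ds)))
      inner [] {p} ed hd h₁ h₂ = stepC (result (tags true (suc (suc p′)) cs))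
        (subst (Good p (suc p′)) (cong result (merge-[] (tags true (suc (suc p′)) cs)))
          (run cs [] ed ec′ hd (at-in′ c e) (≤∞-<∞-trans (sc (suc p′)) h₁)
            (subst₂ _<∞_ (sym (at-out d (ℕₚ.≤-reflexive (sym (drop-length d hd ed))))) (sym e) (λ ()))))
        e (subst (_<∞ at d p) e h₁)
      inner (y ∷ ds) {p} ed hd h₁ h₂ with y ℤ.≤ᵇ x in le
      ... | true = stepC (result (mergeT (tags true (suc (suc p′)) cs) (tags false (suc p) (y ∷ ds))))
              (run cs (y ∷ ds) ed ec′ hd (at-in′ c e) (≤∞-<∞-trans (sc (suc p′)) h₁)
              -- The merge only yields y ≤ x; strictness comes from c_i ≠ d_j.
              (subst₂ _<∞_ (sym (proj₂ (drop-suc d {p} ed))) (sym e) λ k → d≠c e (trans (proj₂ (drop-suc d {p} ed))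
                (cong fin (ℤₚ.≤-antisym (ℤₚ.≤ᵇ⇒≤ (subst T (sym le) tt)) (fin≤⁻ k))))))
              e (subst (_<∞ at d p) e h₁)
      ... | false = stepD (result (mergeT (tags true (suc p′) (x ∷ cs)) (tags false (suc (suc p)) ds)))
              (inner ds (proj₁ (drop-suc d ed)) (at-in′ d e′)
              (subst₂ _<∞_ (sym e) (sym e′) λ k → subst T le (ℤₚ.≤⇒≤ᵇ (fin≤⁻ k)))
              (≤∞-<∞-trans (sd (suc p)) h₂)) e′ (subst (_<∞ at c p′) e′ h₂)
        where
        e′ : at d (suc p) ≡ fin y
        e′ = proj₂ (drop-suc d ed)

    construct-run : AnyRun d a c b N M (proj₁ (construct a d b c)) (proj₂ (construct a d b c)) 0 0
    construct-run = subst (Good 0 0) (sym construct≡)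
      (run c d refl refl z≤n z≤n (λ h → at≢+∞ c h) (λ h → at≢+∞ d h))

-- Conditions (i) and (ii)

pair : Decision → ℕ × ℤ
pair x = dIdx x , dVal x

drop-cons : ∀ (xs : List ℤ) {n v} → at xs (suc n) ≡ fin v → drop n xs ≡ v ∷ drop (suc n) xs
drop-cons (x ∷ xs) {zero}  refl = refl
drop-cons (x ∷ xs) {suc n} e    = drop-cons xs e

drop-length-self : ∀ (xs : List ℤ) → drop (length xs) xs ≡ []
drop-length-self []       = refl
drop-length-self (x ∷ xs) = drop-length-self xs

≡ᵇ-< : ∀ {i j} → i < j → (i ℕ.≡ᵇ j) ≡ false × (j ℕ.≡ᵇ i) ≡ false
≡ᵇ-< {zero}  {suc j} _       = refl , refl
≡ᵇ-< {suc i} {suc j} (s≤s h) = ≡ᵇ-< h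

member-∷ : ∀ {j v t ds} → All (λ x → j < dIdx x) ds → All (λ x → memberᵇ ds (dIdx x) ≡ inSet x) ds →
           All (λ x → memberᵇ (dec j v t ∷ ds) (dIdx x) ≡ inSet x) (dec j v t ∷ ds)
member-∷ {j} {v} {t} {ds} new ms = head ∷ tail new ms
  where
  fresh : ∀ {ds} → All (λ x → j < dIdx x) ds → memberᵇ ds j ≡ false
  fresh []                                   = refl
  fresh {x ∷ ds} (h ∷ hs) rewrite proj₂ (≡ᵇ-< h) = fresh hs
  head : memberᵇ (dec j v t ∷ ds) j ≡ t
  head rewrite ≡ᵇ-refl j | fresh new = ∨-identityʳ t
  tail : ∀ {xs} → All (λ x → j < dIdx x) xs → All (λ x → memberᵇ ds (dIdx x) ≡ inSet x) xs →
         All (λ x → memberᵇ (dec j v t ∷ ds) (dIdx x) ≡ inSet x) xs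
  tail []       []       = []
  tail {x ∷ xs} (h ∷ hs) (m ∷ ms) = trans (cong (λ z → (z ∧ t) ∨ memberᵇ ds (dIdx x)) (proj₁ (≡ᵇ-< h))) m ∷ tail hs ms

module _ {d a c b : List ℤ} {N : ℕ} {M : ℤ} where
  pairs : ∀ {dD dC p p′ Γ Q acc} → Run d a c b N M dD dC p p′ Γ Q acc → L.map pair dD ≡ enum (suc p) (drop p d)
  pairs start            = sym (cong (enum _) (drop-length-self d))
  pairs (rejD v r e o x) = trans (cong (_ ∷_) (pairs r)) (sym (cong (enum _) (drop-cons d e)))
  pairs (accD v r e o x) = trans (cong (_ ∷_) (pairs r)) (sym (cong (enum _) (drop-cons d e)))
  pairs (rejC v r e o x) = pairs r
  pairs (accC v r e o x) = pairs r

  members : ∀ {dD dC p p′ Γ Q acc} → Run d a c b N M dD dC p p′ Γ Q acc →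
            All (λ x → memberᵇ dD (dIdx x) ≡ inSet x) dD
  members start            = []
  members (rejD v r e o x) = member-∷ (idx> r) (members r)
  members (accD v r e o x) = member-∷ (idx> r) (members r)
  members (rejC v r e o x) = members r
  members (accC v r e o x) = members r

count-map : ∀ {A B : Set} (f : B → Bool) (h : A → B) xs → countᵇ f (L.map h xs) ≡ countᵇ (λ x → f (h x)) xs
count-map f h []       = refl
count-map f h (x ∷ xs) with f (h x)
... | true  = cong suc (count-map f h xs)
... | false = count-map f h xs

filter-map : ∀ {A B : Set} (f : B → Bool) (h : A → B) xs → L.filterᵇ f (L.map h xs) ≡ L.map h (L.filterᵇ (λ x → f (h x)) xs)
filter-map f h []       = refl
filter-map f h (x ∷ xs) with f (h x)
... | true  = cong (h x ∷_) (filter-map f h xs)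
... | false = filter-map f h xs

ins : List Decision → List ℤ
ins ds = L.map dVal (L.filterᵇ isIn ds)

length-ins : ∀ ds → length (ins ds) ≡ countᵇ isIn ds
length-ins []       = refl
length-ins (x ∷ ds) with inSet x
... | true  = cong suc (length-ins ds)
... | false = length-ins ds

below-count : List Decision → ℤ → ℕ
below-count dD v = countᵇ (λ x → not (inSet x) ∧ (dVal x <ᵇ v)) dD

later-sum : List Decision → ℕ → ℤ
later-sum dD z = sumVals (L.filterᵇ (λ x → (z <ℕᵇ dIdx x) ∧ not (inSet x)) dD)

-- One instance of condition (i), as a function of the quantities z, m, h′ - y, #{i ∉ Δ | d_i < c^y}
-- and of the two sums on its right-hand side.
record Ineq (a e : List ℤ) (z my n t : ℕ) (S σ : ℤ) : Set where
  constructor ineq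
  field
    holds : (ℤ.+ length a) ℤ.- (ℤ.+ n) ℤ.+ (ℤ.+ t) ℤ.≤ (ℤ.+ my) →
      rangeSum∞ e ((ℤ.+ z) ℤ.+ ((ℤ.+ length a) ℤ.- (ℤ.+ n) ℤ.+ (ℤ.+ t))) (ℤ.+ (z + my)) ≤∞
        fin (S ℤ.- σ ℤ.- sumFrom a my)

Ineq-cong : ∀ {a e z z′ my n n′ t t′ S S′ σ σ′} → z ≡ z′ → n ≡ n′ → t ≡ t′ → S ≡ S′ → σ ≡ σ′ →
            Ineq a e z my n t S σ → Ineq a e z′ my n′ t′ S′ σ′
Ineq-cong refl refl refl refl refl h = h

-- The recursion follows the run: the head is the entry of S accepted last, and the length of the
-- rest is h′ - y.
Ineqs : (a d e : List ℤ) (dD : List Decision) (cs : List ℤ) → Set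
Ineqs a d e dD []       = ⊤
Ineqs a d e dD (v ∷ cs) =
  Ineq a e (countᵇ (v <ᵇ_) d) (countᵇ (v <ᵇ_) a) (length cs) (below-count dD v)
       (sumℤ (v ∷ cs)) (later-sum dD (countᵇ (v <ᵇ_) d))
  × Ineqs a d e dD cs

IneqAt : (a d e : List ℤ) (dD : List Decision) (cs : List ℤ) → Fin (length cs) → Set
IneqAt a d e dD cs y = let v = L.lookup cs y in
  Ineq a e (countᵇ (v <ᵇ_) d) (countᵇ (v <ᵇ_) a) (length cs ∸ suc (F.toℕ y)) (below-count dD v)
       (sumℤ (drop (F.toℕ y) cs)) (later-sum dD (countᵇ (v <ᵇ_) d))

Ineqs⇒ : ∀ {a d e dD} cs → Ineqs a d e dD cs → ∀ y → IneqAt a d e dD cs y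
Ineqs⇒ (v ∷ cs) (h , hs) F.zero    = h
Ineqs⇒ (v ∷ cs) (h , hs) (F.suc y) = Ineqs⇒ cs hs y

⇒Ineqs : ∀ {a d e dD} cs → (∀ y → IneqAt a d e dD cs y) → Ineqs a d e dD cs
⇒Ineqs []       h = tt
⇒Ineqs (v ∷ cs) h = h F.zero , ⇒Ineqs cs λ y → h (F.suc y)

module CondFinal {d a c b : List ℤ} {N : ℕ} {M : ℤ} {dD dC : List Decision} {Γ : ℕ} {Q : ℤ} {acc : List ℤ}
                 (r : Run d a c b N M dD dC 0 0 Γ Q acc) where
  indexed-d : indexed d ≡ L.map pair dD
  indexed-d = trans (indexed≡ d) (sym (pairs r))

  selected-d : selected (memberᵇ dD) d ≡ ins dD
  selected-d = trans (cong (λ z → L.map proj₂ (L.filterᵇ (λ q → memberᵇ dD (proj₁ q)) z)) indexed-d)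
    (trans (cong (L.map proj₂) (filter-map (λ q → memberᵇ dD (proj₁ q)) pair dD))
    (trans (sym (Lₚ.map-∘ (L.filterᵇ (λ x → memberᵇ dD (dIdx x)) dD)))
           (cong (L.map dVal) (filter-cong (members r)))))

  count≡ : ∀ v → countᵇ (λ q → not (memberᵇ dD (proj₁ q)) ∧ (proj₂ q <ᵇ v)) (indexed d) ≡ below-count dD v
  count≡ v = trans (cong (countᵇ _) indexed-d) (trans (count-map _ pair dD)
    (count-cong (All.map (λ {x} h → cong (λ z → not z ∧ (dVal x <ᵇ v)) h) (members r))))

  sum≡ : ∀ z → sumℤ (L.map proj₂ (L.filterᵇ (λ q → (z <ℕᵇ proj₁ q) ∧ not (memberᵇ dD (proj₁ q))) (indexed d))) ≡ later-sum dD z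
  sum≡ z = cong sumℤ (trans (cong (λ i → L.map proj₂ (L.filterᵇ (λ q → (z <ℕᵇ proj₁ q) ∧ not (memberᵇ dD (proj₁ q))) i)) indexed-d)
    (trans (cong (L.map proj₂) (filter-map (λ q → (z <ℕᵇ proj₁ q) ∧ not (memberᵇ dD (proj₁ q))) pair dD))
    (trans (sym (Lₚ.map-∘ (L.filterᵇ (λ x → (z <ℕᵇ dIdx x) ∧ not (memberᵇ dD (dIdx x))) dD)))
           (cong (L.map dVal) (filter-cong (All.map (λ {x} h → cong (λ u → (z <ℕᵇ dIdx x) ∧ not u) h) (members r)))))))

  Cond⇒Ineqs : ∀ {e cs} → Cond a d e (memberᵇ dD) cs → Ineqs a d e dD cs
  Cond⇒Ineqs {cs = cs} C = ⇒Ineqs cs λ y →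
    Ineq-cong refl refl (count≡ (L.lookup cs y)) refl (sum≡ (countᵇ (L.lookup cs y <ᵇ_) d)) (ineq (C y))

  Ineqs⇒Cond : ∀ {e cs} → Ineqs a d e dD cs → Cond a d e (memberᵇ dD) cs
  Ineqs⇒Cond {cs = cs} I y = Ineq.holds
    (Ineq-cong refl refl (sym (count≡ (L.lookup cs y))) refl (sym (sum≡ (countᵇ (L.lookup cs y <ᵇ_) d))) (Ineqs⇒ cs I y))

Ineqs-cong : ∀ {a d e dD dD′} cs → All (λ v → below-count dD v ≡ below-count dD′ v ×
               later-sum dD (countᵇ (v <ᵇ_) d) ≡ later-sum dD′ (countᵇ (v <ᵇ_) d)) cs →
             Ineqs a d e dD cs → Ineqs a d e dD′ cs
Ineqs-cong []       []              h        = tt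
Ineqs-cong (v ∷ cs) ((p , q) ∷ eqs) (h , hs) = Ineq-cong refl refl p refl q h , Ineqs-cong cs eqs hs

ins-All : ∀ {R : ℤ → Set} {ds} → All (λ x → R (dVal x)) ds → All R (ins ds)
ins-All {ds = []}     []       = []
ins-All {ds = x ∷ ds} (h ∷ hs) with inSet x
... | true  = h ∷ ins-All hs
... | false = ins-All hs

module CondRun {d a c b e : List ℤ} {N : ℕ} {M : ℤ} (mg : Merged d a e) (sd : Sorted d) (sa : Sorted a) (sc : Sorted c)
    (N≡ : N ≡ length d + length a) (M≡ : M ≡ sumℤ d ℤ.+ sumℤ a) where

  -- An entry of d processed after u ∈ S exceeds u, and its index is at most z. Condition (i) for u,
  -- stated with the final Δ, can therefore be evaluated when u is accepted.
  unaffected : ∀ {dD dC p p′ Γ Q acc v t} → Run d a c b N M dD dC (suc p) p′ Γ Q acc → at d (suc p) ≡ fin v →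
    All (λ u → below-count (dec (suc p) v t ∷ dD) u ≡ below-count dD u ×
               later-sum (dec (suc p) v t ∷ dD) (countᵇ (u <ᵇ_) d) ≡ later-sum dD (countᵇ (u <ᵇ_) d)) (ins dC)
  unaffected {dD = dD} {p = p} {v = v} {t} r eq = ins-All (All.map (λ {x} h → same (dVal x) h) (dC<d sd sc r))
    where
    same : ∀ u → fin u <∞ at d (suc p) → below-count (dec (suc p) v t ∷ dD) u ≡ below-count dD u ×
           later-sum (dec (suc p) v t ∷ dD) (countᵇ (u <ᵇ_) d) ≡ later-sum dD (countᵇ (u <ᵇ_) d)
    same u h = if-false (∧-false {not t} (<ᵇ⇐≥ (fin≤⁻ (subst (fin u ≤∞_) eq (<∞⇒≤∞ h))))) ,
               cong sumVals (reject {λ x → (countᵇ (u <ᵇ_) d <ℕᵇ dIdx x) ∧ not (inSet x)} {dec (suc p) v t} {dD}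
                 (cong (_∧ not t) (<ℕᵇ-false (count-at d sd (suc p) h))))
      where
      reject : ∀ {f : Decision → Bool} {x xs} → f x ≡ false → L.filterᵇ f (x ∷ xs) ≡ L.filterᵇ f xs
      reject {f} {x} h with f x
      reject refl | false = refl

  module Event {dD dC p p′ Γ Q acc v} (r : Run d a c b N M dD dC p (suc p′) (suc Γ) Q acc)
               (eq : at c (suc p′) ≡ fin v) (o : fin v <∞ at d p) where
    my A B : ℕ
    my = countᵇ (v <ᵇ_) a
    A  = countᵇ isIn dC
    B  = countᵇ isOut dD
    I O : ℤ
    I = sumVals (L.filterᵇ isIn dC)
    O = sumVals (L.filterᵇ isOut dD)

    d<v : at d (suc p) <∞ fin v
    d<v = subst (at d (suc p) <∞_) eq (d<c sc r)
    z≡ : countᵇ (v <ᵇ_) d ≡ p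
    z≡ = count-unique d sd o (<∞⇒≤∞ d<v)
    t≡ : below-count dD v ≡ B
    t≡ = count-cong (All.map (λ h → ∧-true (<ᵇ⇐< (fin<⁻ (≤∞-<∞-trans h d<v)))) (val≤ sd r))
    σ≡ : later-sum dD (countᵇ (v <ᵇ_) d) ≡ O
    σ≡ = trans (cong (later-sum dD) z≡)
      (cong sumVals (filter-cong (All.map (λ h → cong (_∧ _) (<ℕᵇ-true h)) (idx> r))))

    balance≡ : suc Γ + A ≡ p + length a + B
    balance≡ = count-balance N≡ r

    ty : ℤ
    ty = (ℤ.+ length a) ℤ.- (ℤ.+ A) ℤ.+ (ℤ.+ B)

    -- By the count balance, the sum over e in condition (i) starts right after the first Γ entries.
    p+ty : (ℤ.+ p) ℤ.+ ty ≡ ℤ.+ suc Γ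
    p+ty = trans (arith₁ (ℤ.+ p) (ℤ.+ length a) (ℤ.+ A) (ℤ.+ B))
      (trans (cong (λ x → x ℤ.- (ℤ.+ A)) (cong ℤ.+_ (sym balance≡))) (arith₂ (ℤ.+ suc Γ) (ℤ.+ A)))
      where
      arith₁ : ∀ p s A B → p ℤ.+ (s ℤ.- A ℤ.+ B) ≡ (p ℤ.+ s ℤ.+ B) ℤ.- A
      arith₁ = solve-∀
      arith₂ : ∀ G A → (G ℤ.+ A) ℤ.- A ≡ G
      arith₂ = solve-∀

    ty≤⇒ : ty ℤ.≤ ℤ.+ my → suc Γ ≤ p + my
    ty≤⇒ h = ℤₚ.drop‿+≤+ (subst (ℤ._≤ ℤ.+ (p + my)) p+ty (ℤₚ.+-monoʳ-≤ (ℤ.+ p) h))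

    ⇒ty≤ : suc Γ ≤ p + my → ty ℤ.≤ ℤ.+ my
    ⇒ty≤ h = lin (subst (ℤ._≤ ℤ.+ (p + my)) (sym p+ty) (ℤ.+≤+ h)) (arith (ℤ.+ p) (ℤ.+ my) ty)
      where
      arith : ∀ p m t → (p ℤ.+ m) ℤ.- (p ℤ.+ t) ≡ m ℤ.- t
      arith = solve-∀

    v<a : ∀ k → k ≤ my → fin v <∞ at a k
    v<a = at-count a sa

    p≤ : p ≤ length d
    p≤ = p≤length r
    my≤ : my ≤ length a
    my≤ = count-≤ v a

    -- The first p entries of d and the first `my` of a are exactly those above v, so no exchange
    -- improves this split.
    P-e : P e (p + my) ≡ P d p ℤ.+ P a my
    P-e with Merged.some-split mg (ℕₚ.+-mono-≤ p≤ my≤)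
    ... | p₀ , J₀ , eq′ , p₀≤ , J₀≤ , f = ℤₚ.≤-antisym
      (ℤₚ.≤-trans (ℤₚ.≤-reflexive f) (split-opt d a sd sa eq′ p₀≤ J₀≤ p≤ my≤
        (≤∞-trans (¬<∞⇒≥∞ λ h → ℕₚ.1+n≰n (count-at a sa (suc my) h)) (<∞⇒≤∞ o))
        (≤∞-trans (<∞⇒≤∞ d<v) (<∞⇒≤∞ (v<a my ℕₚ.≤-refl)))))
      (Merged.all-splits mg p≤ my≤)

    range : suc Γ ≤ p + my → rangeSum∞ e ((ℤ.+ p) ℤ.+ ty) (ℤ.+ (p + my)) ≡ fin (P e (p + my) ℤ.- P e Γ)
    range h with ℕₚ.m≤n⇒∃[o]m+o≡n (ℕₚ.<⇒≤ h)
    ... | n , eq′ = trans (cong₂ (λ x y → rangeSum∞ e x (ℤ.+ y)) p+ty (sym eq′))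
      (trans (rangeSum e Γ n (subst₂ _≤_ (sym eq′) (sym (Merged.length≡ mg)) (ℕₚ.+-mono-≤ p≤ my≤)))
             (cong (λ k → fin (P e k ℤ.- P e Γ)) eq′))

    -- Both sides of condition (i) now contain P e (p + my); cancelling it leaves Q - v ≤ P e Γ.
    rhs≡ : (v ℤ.+ I) ℤ.- O ℤ.- sumFrom a my ≡ (P e (p + my) ℤ.+ v) ℤ.- Q
    rhs≡ = trans (arith₁ v I O (sumFrom a my) (P a my) Q)
      (trans (cong₂ (λ x y → x ℤ.- O ℤ.- y ℤ.+ P a my ℤ.+ v ℤ.- Q) (sum-balance M≡ r) (P+drop my a))
      (trans (arith₂ (P d p) O (sumℤ a) (P a my) v Q) (cong (λ x → (x ℤ.+ v) ℤ.- Q) (sym P-e))))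
      where
      arith₁ : ∀ v I O s x Q → (v ℤ.+ I) ℤ.- O ℤ.- s ≡ (Q ℤ.+ I) ℤ.- O ℤ.- (x ℤ.+ s) ℤ.+ x ℤ.+ v ℤ.- Q
      arith₁ = solve-∀
      arith₂ : ∀ p O s x v Q → (p ℤ.+ O ℤ.+ s) ℤ.- O ℤ.- s ℤ.+ x ℤ.+ v ℤ.- Q ≡ ((p ℤ.+ x) ℤ.+ v) ℤ.- Q
      arith₂ = solve-∀

    Single : Set
    Single = (∀ w → suc Γ ≡ p + w → fin v <∞ at a w) → Q ℤ.- v ℤ.≤ P e Γ

    single⇒ : Single → Ineq a e p my A B (v ℤ.+ I) O
    single⇒ s = ineq λ h → let Γ< = ty≤⇒ h in subst₂ _≤∞_ (sym (range Γ<)) (cong fin (sym rhs≡))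
      (fin≤ (lin (s λ w eq′ → v<a w (ℕₚ.+-cancelˡ-≤ p w my (subst (_≤ p + my) eq′ Γ<)))
                 (arith (P e (p + my)) (P e Γ) v Q)))
      where
      arith : ∀ x y v Q → y ℤ.- (Q ℤ.- v) ≡ ((x ℤ.+ v) ℤ.- Q) ℤ.- (x ℤ.- y)
      arith = solve-∀

    ⇒single : Ineq a e p my A B (v ℤ.+ I) O → Single
    ⇒single h s = lin (fin≤⁻ (subst₂ _≤∞_ (range Γ<) (cong fin rhs≡) (Ineq.holds h (⇒ty≤ Γ<)))) (arith (P e (p + my)) (P e Γ) v Q)
      where
      Γ< : suc Γ ≤ p + my
      Γ< with ℕₚ.≤-total (suc Γ) p
      ... | inj₁ k = ℕₚ.≤-trans k (ℕₚ.m≤m+n p my)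
      ... | inj₂ k with ℕₚ.m≤n⇒∃[o]m+o≡n k
      ... | w , eq′ = subst (_≤ p + my) eq′ (ℕₚ.+-monoʳ-≤ p (count-at a sa w (s w (sym eq′))))
      arith : ∀ x y v Q → ((x ℤ.+ v) ℤ.- Q) ℤ.- (x ℤ.- y) ≡ y ℤ.- (Q ℤ.- v)
      arith = solve-∀

  Ineqs⇒RunCond : ∀ {dD dC p p′ Γ Q acc} (r : Run d a c b N M dD dC p p′ Γ Q acc) → Ineqs a d e dD (ins dC) → RunCond e r
  Ineqs⇒RunCond start            h = tt
  Ineqs⇒RunCond {dC = dC} (rejD v r eq o x) h = Ineqs⇒RunCond r (Ineqs-cong (ins dC) (unaffected r eq) h)
  Ineqs⇒RunCond {dC = dC} (accD v r eq o x) h = Ineqs⇒RunCond r (Ineqs-cong (ins dC) (unaffected r eq) h)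
  Ineqs⇒RunCond (rejC v r eq o x) h = Ineqs⇒RunCond r h
  Ineqs⇒RunCond {dC = _ ∷ dC} (accC v r eq o x) (h , hs) =
    E.⇒single (Ineq-cong E.z≡ (length-ins dC) E.t≡ refl E.σ≡ h) , Ineqs⇒RunCond r hs
    where module E = Event r eq o

  RunCond⇒Ineqs : ∀ {dD dC p p′ Γ Q acc} (r : Run d a c b N M dD dC p p′ Γ Q acc) → RunCond e r → Ineqs a d e dD (ins dC)
  RunCond⇒Ineqs start            h = tt
  RunCond⇒Ineqs {dC = dC} (rejD v r eq o x) h =
    Ineqs-cong (ins dC) (All.map (λ { (p , q) → sym p , sym q }) (unaffected r eq)) (RunCond⇒Ineqs r h)
  RunCond⇒Ineqs {dC = dC} (accD v r eq o x) h =
    Ineqs-cong (ins dC) (All.map (λ { (p , q) → sym p , sym q }) (unaffected r eq)) (RunCond⇒Ineqs r h)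
  RunCond⇒Ineqs (rejC v r eq o x) h = RunCond⇒Ineqs r h
  RunCond⇒Ineqs {dC = _ ∷ dC} (accC v r eq o x) (h , hs) =
    Ineq-cong (sym E.z≡) (sym (length-ins dC)) (sym E.t≡) refl (sym E.σ≡) (E.single⇒ h) , RunCond⇒Ineqs r hs
    where module E = Event r eq o

necessity : ∀ {d a c b e N M g} → Merged d a e → GM g d a → GM g c b → Sorted d → Sorted a → Sorted c → Sorted b →
  length g ≡ N → sumℤ g ≡ M →
  ∀ {dD dC p p′ Γ Q acc} (r : Run d a c b N M dD dC p p′ Γ Q acc) → RunCond e r
necessity mg G₁ G₂ sd sa sc sb l s start            = tt
necessity mg G₁ G₂ sd sa sc sb l s (rejD v r e o x) = necessity mg G₁ G₂ sd sa sc sb l s r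
necessity mg G₁ G₂ sd sa sc sb l s (accD v r e o x) = necessity mg G₁ G₂ sd sa sc sb l s r
necessity mg G₁ G₂ sd sa sc sb l s (rejC v r e o x) = necessity mg G₁ G₂ sd sa sc sb l s r
necessity {e = e} {g = g} mg G₁ G₂ sd sa sc sb refl s r@(accC {Γ = Γ} v r′ _ o x) =
  (λ _ → ℤₚ.≤-trans (Q≤Pg G₁ G₂ sd sa sc sb refl s r) (majorized (best-split G₁ (Γ≤N r)))) ,
  necessity mg G₁ G₂ sd sa sc sb refl s r′
  where
  majorized : _ → P g Γ ℤ.≤ P e Γ
  majorized (J , p , refl , p≤ , J≤ , h , _) = ℤₚ.≤-trans h (Merged.all-splits mg p≤ J≤)

-- Passage between vectors and lists, and the equivalence

Nonincreasing⇒Sorted : ∀ {n} (v : Vec ℤ n) → Nonincreasing v → Sorted (toList v)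
Nonincreasing⇒Sorted V.[]              h zero    = ≤+∞
Nonincreasing⇒Sorted V.[]              h (suc i) = -∞≤
Nonincreasing⇒Sorted (x V.∷ V.[])      h         = Sorted-∷ -∞≤ (Nonincreasing⇒Sorted V.[] (λ ()))
Nonincreasing⇒Sorted (x V.∷ y V.∷ v)   h         = Sorted-∷ (fin≤ (h F.zero (F.suc F.zero) z≤n))
  (Nonincreasing⇒Sorted (y V.∷ v) λ i j i≤j → h (F.suc i) (F.suc j) (s≤s i≤j))

at-lookup : ∀ {n} (v : Vec ℤ n) i → at (toList v) (suc (F.toℕ i)) ≡ fin (lookup v i)
at-lookup (x V.∷ v) F.zero    = refl
at-lookup (x V.∷ v) (F.suc i) = at-lookup v i

at-toList : ∀ {n} (v : Vec ℤ n) i {x} → at (toList v) (suc i) ≡ fin x → ∃[ j ] lookup v j ≡ x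
at-toList (x V.∷ v) zero    refl = F.zero , refl
at-toList (x V.∷ v) (suc i) e    with at-toList v i e
... | j , e′ = F.suc j , e′

Sorted⇒Nonincreasing : ∀ {n} (v : Vec ℤ n) → Sorted (toList v) → Nonincreasing v
Sorted⇒Nonincreasing v s i j i≤j = fin≤⁻ (subst₂ _≤∞_ (at-lookup v j) (at-lookup v i) (at-anti (toList v) s (s≤s i≤j)))

toVec : ∀ {n} (xs : List ℤ) → length xs ≡ n → ∃[ v ] toList {n = n} v ≡ xs
toVec xs refl = V.fromList xs , Vₚ.toList∘fromList xs

module Equivalence {d a c b : List ℤ} {N : ℕ} (sd : Sorted d) (sa : Sorted a) (sc : Sorted c) (sb : Sorted b)
    (N≡ : N ≡ length d + length a) (N≡′ : N ≡ length c + length b)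
    (M≡ : sumℤ d ℤ.+ sumℤ a ≡ sumℤ c ℤ.+ sumℤ b) {dD dC : List Decision}
    (run : AnyRun d a c b N (sumℤ d ℤ.+ sumℤ a) dD dC 0 0) where
  private
    e e′ : List ℤ
    e  = valsOf (eTagged d a)
    e′ = valsOf (eTagged c b)
    r = proj₂ (proj₂ (proj₂ run))
    mg : Merged d a e
    mg = merged sd sa
    mg′ : Merged c b e′
    mg′ = merged sc sb
    module FD = CondFinal r
    module FC = CondFinal (swap r)
    module RD = CondRun {b = b} mg sd sa sc N≡ refl
    module RC = CondRun {b = a} mg′ sc sb sd N≡′ M≡

  Cond-i Cond-ii : Set
  Cond-i  = Cond a d e (memberᵇ dD) (selected (memberᵇ dC) c)
  Cond-ii = Cond b c e′ (memberᵇ dC) (selected (memberᵇ dD) d)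

  necessary : ∀ {g} → length g ≡ N → GMaj g d a → GMaj g c b → Cond-i × Cond-ii
  necessary {g} len G₁ G₂ =
    subst (Cond a d e (memberᵇ dD)) (sym FC.selected-d)
      (FD.Ineqs⇒Cond (RD.RunCond⇒Ineqs r (necessity mg gm₁ gm₂ sd sa sc sb len (GMaj.cond-sum G₁) r))) ,
    subst (Cond b c e′ (memberᵇ dC)) (sym FD.selected-d)
      (FC.Ineqs⇒Cond (RC.RunCond⇒Ineqs (swap r) (necessity mg′ gm₂ gm₁ sc sb sd sa len (GMaj.cond-sum G₁) (swap r))))
    where
    gm₁ : GM g d a
    gm₁ = GMaj⇒GM (trans len N≡) G₁
    gm₂ : GM g c b
    gm₂ = GMaj⇒GM (trans len N≡′) G₂

  sufficient : 1 ≤ N → Cond-i → Cond-ii → ∃[ g ] length g ≡ N × Sorted g × GMaj g d a × GMaj g c b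
  sufficient 1≤N i ii = from-crit (sufficiency mg mg′ sd sa sc sb N≡ N≡′ 1≤N refl M≡ r
    (RD.Ineqs⇒RunCond r (FD.Cond⇒Ineqs (subst (Cond a d e (memberᵇ dD)) FC.selected-d i)))
    (RC.Ineqs⇒RunCond (swap r) (FC.Cond⇒Ineqs (subst (Cond b c e′ (memberᵇ dC)) FD.selected-d ii))))
    where
    from-crit : ∃[ g ] length g ≡ N × Sorted g × sumℤ g ≡ sumℤ d ℤ.+ sumℤ a × Crit g d a × Crit g c b →
                ∃[ g ] length g ≡ N × Sorted g × GMaj g d a × GMaj g c b
    from-crit (g , len , sg , sum , crD , crC) =
      g , len , sg , Crit⇒GMaj (trans len N≡) sg sum crD , Crit⇒GMaj (trans len N≡′) sg (trans sum M≡) crC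

vector-solution : ∀ {N d a c b} → ∃[ g ] length g ≡ N × Sorted g × GMaj g d a × GMaj g c b →
  Σ[ g ∈ Vec ℤ N ] (Nonincreasing g × GMaj (toList g) d a × GMaj (toList g) c b)
vector-solution (gl , len , sg , G₁ , G₂) with toVec gl len
... | g , refl = g , Sorted⇒Nonincreasing g sg , G₁ , G₂

theorem4p2 : (m n s k : ℕ) → 1 ≤ m → 1 ≤ n → 1 ≤ s → 1 ≤ k → m + s ≡ n + k →
    (a : Vec ℤ s) (d : Vec ℤ m) (b : Vec ℤ k) (c : Vec ℤ n) →
    Nonincreasing a → Nonincreasing d → Nonincreasing b → Nonincreasing c →
    ((i : Fin n) (j : Fin m) → lookup c i ≢ lookup d j) →
    (Σ[ g ∈ Vec ℤ (m + s) ] (Nonincreasing g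
    × GMaj (toList g) (toList d) (toList a)
    × GMaj (toList g) (toList c) (toList b)))
    ⇔
    ((sumℤ (toList c) ℤ.+ sumℤ (toList b) ≡ sumℤ (toList d) ℤ.+ sumℤ (toList a))
    × Cond (toList a) (toList d) (valsOf (eTagged (toList d) (toList a)))
    (inΔ (toList a) (toList d) (toList b) (toList c))
    (selected (inS (toList a) (toList d) (toList b) (toList c)) (toList c))
    × Cond (toList b) (toList c) (valsOf (eTagged (toList c) (toList b)))
    (inS (toList a) (toList d) (toList b) (toList c))
    (selected (inΔ (toList a) (toList d) (toList b) (toList c)) (toList d)))
theorem4p2 m n s k 1≤m 1≤n 1≤s 1≤k m+s≡n+k a d b c na nd nb nc c≠d = mk⇔
  (λ { (g , _ , G₁ , G₂) → let M≡ = trans (sym (GMaj.cond-sum G₁)) (GMaj.cond-sum G₂) in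
       sym M≡ , E.necessary M≡ (run M≡) (Vₚ.length-toList g) G₁ G₂ })
  (λ { (sum≡ , i , ii) → vector-solution
       (E.sufficient (sym sum≡) (run (sym sum≡)) (ℕₚ.≤-trans 1≤m (ℕₚ.m≤m+n m s)) i ii) })
  where
  sa : Sorted (toList a)
  sa = Nonincreasing⇒Sorted a na
  sd : Sorted (toList d)
  sd = Nonincreasing⇒Sorted d nd
  sb : Sorted (toList b)
  sb = Nonincreasing⇒Sorted b nb
  sc : Sorted (toList c)
  sc = Nonincreasing⇒Sorted c nc
  N≡ : m + s ≡ length (toList d) + length (toList a)
  N≡ = sym (cong₂ _+_ (Vₚ.length-toList d) (Vₚ.length-toList a))
  N≡′ : m + s ≡ length (toList c) + length (toList b)
  N≡′ = trans m+s≡n+k (sym (cong₂ _+_ (Vₚ.length-toList c) (Vₚ.length-toList b)))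
  d≠c : ∀ {i j x} → at (toList c) (suc i) ≡ fin x → at (toList d) (suc j) ≡ fin x → ⊥
  d≠c {i} {j} e e′ =
    let i′ , eq = at-toList c i e
        j′ , eq′ = at-toList d j e′
    in c≠d i′ j′ (trans eq (sym eq′))
  module E = Equivalence {N = m + s} sd sa sc sb N≡ N≡′
  run : (M≡ : sumℤ (toList d) ℤ.+ sumℤ (toList a) ≡ sumℤ (toList c) ℤ.+ sumℤ (toList b)) →
        AnyRun (toList d) (toList a) (toList c) (toList b) (m + s) (sumℤ (toList d) ℤ.+ sumℤ (toList a))
          (proj₁ (construct (toList a) (toList d) (toList b) (toList c)))
          (proj₂ (construct (toList a) (toList d) (toList b) (toList c))) 0 0
  run M≡ = Construct.construct-run (toList a) (toList d) (toList b) (toList c) sd sa sc sb N≡ N≡′ refl M≡ d≠c
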